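{- Let $q$ be a prime power and $\lambda,\mu$ partitions of $n$. For every type $\mathbf t$ of conjugacy class of $\operatorname{GL}_n(\mathbb F_q)$ and every partition $\nu$ of $n$, the number of elements of $\operatorname{GL}_\nu(\mathbb F_q)$ lying in a conjugacy class of $\operatorname{GL}_n(\mathbb F_q)$ of type $\mathbf t$ is the same for all conjugacy classes of type $\mathbf t$; denote it $a_{\mathbf t,\nu}$. Moreover $$|\operatorname{GL}_\lambda(\mathbb F_q)\backslash\operatorname{GL}_n(\mathbb F_q)/\operatorname{GL}_\mu(\mathbb F_q)|=\frac1{|\operatorname{GL}_\lambda(\mathbb F_q)|\cdot|\operatorname{GL}_\mu(\mathbb F_q)|}\sum_{\mathbf t}N_{\mathbf t}\,a_{\mathbf t,\lambda}\,a_{\mathbf t,\mu}\prod_{d\ge1}\prod_{\kappa\in\mathbf t_d}c_d(\kappa),$$ where the sum runs over all distinct types $\mathbf t$ of conjugacy classes of $\operatorname{GL}_n(\mathbb F_q)$, the inner product runs over the elements of the multiset $\mathbf t_d$ with multiplicity, and $N_{\mathbf t}$ is the number of conjugacy classes of $\operatorname{GL}_n(\mathbb F_q)$ of type $\mathbf t$.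
   Context: For $\nu=(\nu_1,\dots,\nu_r)\vdash n$, $\operatorname{GL}_\nu(\mathbb F_q)=\prod_{i=1}^r\operatorname{GL}_{\nu_i}(\mathbb F_q)$, embedded in $\operatorname{GL}_n(\mathbb F_q)$ as block-diagonal matrices. Let $\Phi_q$ be the set of monic irreducible polynomials in $\mathbb F_q[X]$. Conjugacy classes of $\operatorname{GL}_n(\mathbb F_q)$ correspond to maps $f:\Phi_q\to\{\text{partitions}\}$ with $f(X)=\emptyset$ and $\sum_\phi\deg(\phi)|f(\phi)|=n$, via the decomposition of the $\mathbb F_q[X]$-module $\mathbb F_q^n$ (with $X$ acting by the matrix) as $\bigoplus_\phi\bigoplus_j\mathbb F_q[X]/(\phi^{\lambda_{\phi,j}})$, $f(\phi)=(\lambda_{\phi,j})_j$. The type of the class $C_f$ is the sequence of multisets $\mathbf t=(\mathbf t_d)_{d\ge1}$, $\mathbf t_d=\{f(\phi):\deg\phi=d,\ f(\phi)\ne\emptyset\}$. For a partition $\kappa$ with $m_k$ parts equal to $k$, let $d_k=m_1+2m_2+\dots+km_k+k(m_{k+1}+m_{k+2}+\cdots)$ and $c_d(\kappa)=\prod_{k\ge1}\prod_{i=1}^{m_k}\left(q^{d_kd}-q^{(d_k-i)d}\right)$. -}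

module Defs where

open import Level using (0ℓ)
open import Data.Nat as ℕ using (ℕ; zero; suc; _≤_; _<?_; _∸_; _^_)
open import Data.Fin using (Fin; toℕ) renaming (_≟_ to _≟F_)
open import Data.Vec as Vec using (Vec; lookup; tabulate; transpose; replicate; toList)
open import Data.List as List using (List; []; _∷_; _++_; [_]; length; upTo; concatMap; zip; filterᵇ)
open import Data.Nat.ListAction using (sum; product)
open import Data.List.Relation.Unary.All using (All)
open import Data.List.Relation.Unary.Any using (Any)
open import Data.List.Relation.Unary.AllPairs using (AllPairs)
open import Data.List.Relation.Unary.Linked using (Linked)
open import Data.List.Relation.Unary.Unique.Propositional using (Unique)
open import Data.List.Relation.Binary.Pointwise using (Pointwise)
open import Data.List.Relation.Binary.Permutation.Propositional using (_↭_)
open import Data.List.Membership.Propositional using (_∈_)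
open import Data.Product using (Σ; ∃; _×_; _,_; proj₁; proj₂)
open import Data.Bool using (if_then_else_)
open import Relation.Nullary using (¬_; does)
open import Relation.Binary.PropositionalEquality using (_≡_; _≢_)
open import Algebra.Structures using (IsCommutativeRing)

HasSize : {A : Set} → (A → Set) → ℕ → Set
HasSize {A} P k = Σ (List A) λ xs →
  Unique xs × (∀ x → x ∈ xs → P x) × (∀ x → P x → x ∈ xs) × length xs ≡ k

NumClasses : {A : Set} → (A → Set) → (A → A → Set) → ℕ → Set
NumClasses {A} P R k = Σ (List A) λ xs →
  All P xs × AllPairs (λ x y → ¬ R x y) xs × (∀ x → P x → Any (R x) xs) × length xs ≡ k

IsPartition : List ℕ → Set
IsPartition κ = All (1 ≤_) κ × Linked (λ a b → b ≤ a) κ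

PartitionOf : ℕ → List ℕ → Set
PartitionOf n κ = IsPartition κ × sum κ ≡ n

mult : List ℕ → ℕ → ℕ
mult κ k = length (filterᵇ (λ p → does (p ℕ.≟ k)) κ)

dk : List ℕ → ℕ → ℕ   -- m_1 + 2 m_2 + ... + k m_k + k (m_{k+1} + ...)
dk κ k = sum (List.map (λ p → ℕ._⊓_ p k) κ)

-- c_d(κ) = ∏_{k≥1} ∏_{i=1}^{m_k} (q^{d_k d} - q^{(d_k - i) d});
-- k ranges over 1..|κ| (m_k = 0 beyond the largest part)
cd : ℕ → ℕ → List ℕ → ℕ
cd q d κ = product (List.map (λ k →
              product (List.map (λ i → q ^ (dk κ k ℕ.* d) ∸ q ^ ((dk κ k ∸ i) ℕ.* d))
                                (List.map suc (upTo (mult κ k)))))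
           (List.map suc (upTo (sum κ))))

-- types: a multiset of pairs (d , κ) = (degree, partition), as a list up to permutation
Ty : Set
Ty = List (ℕ × List ℕ)

cprod : ℕ → Ty → ℕ
cprod q t = product (List.map (λ p → cd q (proj₁ p) (proj₂ p)) t)

blockOf : List ℕ → ℕ → ℕ
blockOf [] i = 0
blockOf (k ∷ ks) i = if does (i <? k) then 0 else suc (blockOf ks (i ∸ k))

record FiniteField (q : ℕ) : Set where
  infixl 6 _+F_
  infixl 7 _*F_
  field
    _+F_ _*F_ : Fin q → Fin q → Fin q
    -F_ : Fin q → Fin q
    0F 1F : Fin q
    isCommutativeRing : IsCommutativeRing _≡_ _+F_ _*F_ -F_ 0F 1F
    0≢1 : 0F ≢ 1F
    inverse : ∀ x → x ≢ 0F → ∃ λ y → x *F y ≡ 1F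

module LinAlg {q : ℕ} (F : FiniteField q) where
  open FiniteField F

  K : Set
  K = Fin q

  Mat : ℕ → Set
  Mat n = Vec (Vec K n) n

  sumK : List K → K
  sumK = List.foldr _+F_ 0F

  dot : ∀ {n} → Vec K n → Vec K n → K
  dot u v = sumK (toList (Vec.zipWith _*F_ u v))

  _·_ : ∀ {n} → Mat n → Mat n → Mat n
  A · B = Vec.map (λ row → Vec.map (λ col → dot row col) (transpose B)) A

  _▹_ : ∀ {n} → Mat n → Vec K n → Vec K n
  A ▹ v = Vec.map (λ row → dot row v) A

  _⊕_ : ∀ {n} → Vec K n → Vec K n → Vec K n
  u ⊕ v = Vec.zipWith _+F_ u v

  scale : ∀ {n} → K → Vec K n → Vec K n
  scale c v = Vec.map (c *F_) v

  0v : ∀ {n} → Vec K n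
  0v = replicate _ 0F

  I : ∀ {n} → Mat n
  I = tabulate λ i → tabulate λ j → if does (i ≟F j) then 1F else 0F

  powApply : ∀ {n} → Mat n → ℕ → Vec K n → Vec K n
  powApply A zero v = v
  powApply A (suc i) v = A ▹ powApply A i v

  GL : ∀ n → Mat n → Set
  GL n A = ∃ λ B → A · B ≡ I × B · A ≡ I

  GLν : ∀ n → List ℕ → Mat n → Set
  GLν n ν g = GL n g × (∀ i j → blockOf ν (toℕ i) ≢ blockOf ν (toℕ j) → lookup (lookup g i) j ≡ 0F)

  Conj : ∀ {n} → Mat n → Mat n → Set
  Conj {n} A B = ∃ λ g → GL n g × g · A ≡ B · g

  linComb : ∀ {n} → List K → List (Vec K n) → Vec K n
  linComb [] _ = 0v
  linComb (_ ∷ _) [] = 0v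
  linComb (c ∷ cs) (v ∷ vs) = scale c v ⊕ linComb cs vs

  LinIndep : ∀ {n} → List (Vec K n) → Set
  LinIndep vs = ∀ cs → length cs ≡ length vs → linComb cs vs ≡ 0v → All (_≡ 0F) cs

  IsBasis : ∀ n → List (Vec K n) → Set
  IsBasis n vs = LinIndep vs × length vs ≡ n

  -- Polynomials in F_q[X]: coefficient lists, lowest degree first

  Poly : Set
  Poly = List K

  deg : Poly → ℕ
  deg p = length p ∸ 1

  polyAdd : Poly → Poly → Poly
  polyAdd [] p = p
  polyAdd (a ∷ p) [] = a ∷ p
  polyAdd (a ∷ p) (b ∷ r) = (a +F b) ∷ polyAdd p r

  polyMul : Poly → Poly → Poly
  polyMul [] r = []
  polyMul (a ∷ p) r = polyAdd (List.map (a *F_) r) (0F ∷ polyMul p r)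

  polyPow : Poly → ℕ → Poly
  polyPow p zero = [ 1F ]
  polyPow p (suc k) = polyMul p (polyPow p k)

  Monic : Poly → Set
  Monic p = ∃ λ r → p ≡ r ++ [ 1F ]

  MonicIrreducible : Poly → Set
  MonicIrreducible φ = Monic φ × 1 ≤ deg φ ×
    (∀ g h → Monic g → Monic h → 1 ≤ deg g → 1 ≤ deg h → polyMul g h ≢ φ)

  Xpoly : Poly
  Xpoly = 0F ∷ 1F ∷ []

  polyApply : ∀ {n} → Poly → Mat n → Vec K n → Vec K n
  polyApply [] A v = 0v
  polyApply (c ∷ p) A v = scale c v ⊕ (A ▹ polyApply p A v)

  -- Conjugacy class data f : Φ_q → partitions, given by its finite support
  -- as a list of pairs (φ , f(φ)) with distinct φ.

  ClassData : Set
  ClassData = List (Poly × List ℕ)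

  ValidData : ClassData → Set
  ValidData D =
    All (λ e → MonicIrreducible (proj₁ e) × proj₁ e ≢ Xpoly × IsPartition (proj₂ e) × proj₂ e ≢ []) D
    × AllPairs (λ e e′ → proj₁ e ≢ proj₁ e′) D

  -- the summands F_q[X]/(φ^{λ_{φ,j}}), one per part
  summands : ClassData → List (Poly × ℕ)
  summands D = concatMap (λ e → List.map (λ l → (proj₁ e , l)) (proj₂ e)) D

  cyclicBasis : ∀ {n} → Mat n → List (Vec K n × (Poly × ℕ)) → List (Vec K n)
  cyclicBasis A gs = concatMap (λ g → List.map (λ i → powApply A i (proj₁ g))
                                  (upTo (deg (proj₁ (proj₂ g)) ℕ.* proj₂ (proj₂ g)))) gs

  -- A ∈ C_f : the F_q[X]-module F_q^n (X acting by A) is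
  -- ⊕_φ ⊕_j F_q[X]/(φ^{λ_{φ,j}}), i.e. it is the internal direct sum of cyclic
  -- submodules F_q[X] v_{φ,j} with v_{φ,j} annihilated by φ^{λ_{φ,j}} and the
  -- vectors X^i v_{φ,j} (i < deg φ^{λ_{φ,j}}) together forming a basis.
  InClass : ∀ n → Mat n → ClassData → Set
  InClass n A D = ValidData D × Σ (List (Vec K n)) λ vs →
    Pointwise (λ v s → polyApply (polyPow (proj₁ s) (proj₂ s)) A v ≡ 0v) vs (summands D)
    × IsBasis n (cyclicBasis A (zip vs (summands D)))

  typeOf : ClassData → Ty
  typeOf D = List.map (λ e → (deg (proj₁ e) , proj₂ e)) D

  HasType : ∀ n → Mat n → Ty → Set
  HasType n A t = ∃ λ D → InClass n A D × typeOf D ↭ t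

  CountInClass : ∀ n → List ℕ → Mat n → ℕ → Set
  CountInClass n ν A a = HasSize (λ g → GLν n ν g × Conj A g) a

  DoubleCosetRel : ∀ n → List ℕ → List ℕ → Mat n → Mat n → Set
  DoubleCosetRel n la mu g h = ∃ λ x → ∃ λ y → GLν n la x × GLν n mu y × (x · g) · y ≡ h

-- Let T be the set of (x , y , g) in GL_λ × GL_μ × GL_n with x g = g y.  Counted through double cosets,
-- T has |GL_λ| |GL_μ| · #(double cosets) elements; counted through conjugacy classes C it has
-- Σ_C |C ∩ GL_λ| |C ∩ GL_μ| |Z(C)| elements.
--
-- That |C ∩ GL_ν| depends only on the type of C: if φ and ψ are irreducible of the same degree, ψ has a root
-- modulo φ which is simple modulo φ², so by the Chinese remainder theorem matrices A and B of the same type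
-- admit a polynomial P with P(A) conjugate to B.  The map x ↦ P(x) then carries the class of A onto the class
-- of B and preserves block diagonal matrices; by symmetry the classes have equal size, so the map is injective.
--
-- The order of the centralizer of A: an automorphism of the module is given by the images w of the cyclic
-- generators of order φ^l, and it is bijective exactly when the vectors φ^(l-1) w are independent over
-- F_q[X]/φ.  Choosing the w with the largest l first, a choice with j predecessors and d = deg φ has
-- |ker φ^l| - q^(d j) |ker φ^(l-1)| possibilities, and |ker φ^k| = q^(d d_k).
module Submission where

open import Defs
open import Data.Nat.Base using (ℕ)

-- Simplicity of the root modulo φ² is what lets the exponents survive: φ then divides ψ(P) exactly
-- once, so φ^l divides c(P) if and only if ψ^l divides c, and the generators of the module of A
-- serve unchanged for P(A). Such a root exists because X^N - X with N = q^(deg φ) vanishes at all N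
-- residues modulo φ and is ψ times a nonzero cofactor with at most N coefficients, too few to
-- vanish at all of them. That independence of the vectors φ^(l-1) w suffices for bijectivity is a
-- socle argument: a nonzero kernel of an endomorphism, being killed by a product of irreducibles,
-- contains a nonzero vector killed by one of them. Taking the largest l first makes every
-- combination of the earlier vectors a value of φ^(l-1), so each combination excludes exactly one
-- coset of ker φ^(l-1). The sum over types also requires the type to be a conjugacy invariant; it
-- is recovered from the sizes of ker φ^k. Quotient rings appear only through representatives:
-- residues are coefficient lists of fixed length, and equations in a quotient are divisibilities.

-- Counting by duplicate-free enumerations, and finite sums.

module Counting where
  open import Data.Nat
  open import Data.Nat.Properties
  open import Data.List.Base using (List; []; _∷_; _++_; length; map; filter; [_])
  open import Data.List.Properties using (length-++; length-map)
  open import Data.Nat.ListAction using (sum; product)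
  open import Data.List.Relation.Unary.Unique.Propositional using (Unique)
  open import Data.List.Relation.Unary.AllPairs using (AllPairs; []; _∷_)
  open import Data.List.Relation.Unary.All as All using (All; []; _∷_)
  open import Data.List.Relation.Unary.Any using (Any; here; there; any?)
  open import Data.List.Membership.Propositional using (_∈_; _∉_; find; lose)
  open import Data.List.Membership.Propositional.Properties using (∈-∃++; ∈-++⁻; ∈-++⁺ˡ; ∈-++⁺ʳ; ∈-map⁺; ∈-map⁻; ∈-filter⁺; ∈-filter⁻)
  open import Data.List.Relation.Binary.Pointwise using (Pointwise; []; _∷_; Pointwise-length)
  import Data.List.Relation.Unary.Unique.Propositional.Properties as Uniq
  open import Data.Product using (∃; _×_; _,_; proj₁; proj₂)
  open import Data.Sum using (_⊎_; inj₁; inj₂)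
  open import Data.Unit using (⊤; tt)
  open import Data.Empty using (⊥-elim)
  open import Relation.Nullary
  open import Relation.Unary using (Decidable)
  open import Relation.Binary using (DecidableEquality)
  open import Relation.Binary.PropositionalEquality hiding ([_])

  private variable
    A B : Set
    P Q : A → Set

  ∈-delete : ∀ {x y : A} as {bs} → x ∈ as ++ y ∷ bs → x ≢ y → x ∈ as ++ bs
  ∈-delete as x∈ x≢y with ∈-++⁻ as x∈
  ... | inj₁ x∈as = ∈-++⁺ˡ x∈as
  ... | inj₂ (here x≡y) = ⊥-elim (x≢y x≡y)
  ... | inj₂ (there x∈bs) = ∈-++⁺ʳ as x∈bs

  length-delete : ∀ as {y : A} {bs} → length (as ++ y ∷ bs) ≡ suc (length (as ++ bs))
  length-delete [] = refl
  length-delete (_ ∷ as) = cong suc (length-delete as)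

  -- Pigeonhole: one occurrence of the head of `xs` is deleted from `ys`, which the rest of `xs`,
  -- being free of repetitions, does not miss.
  unique-⊆-length : ∀ {xs ys : List A} → Unique xs → (∀ x → x ∈ xs → x ∈ ys) → length xs ≤ length ys
  unique-⊆-length [] _ = z≤n
  unique-⊆-length {xs = x ∷ xs} {ys} (x∉ ∷ u) sub with ∈-∃++ (sub x (here refl))
  ... | as , bs , refl = subst (suc (length xs) ≤_) (sym (length-delete as))
    (s≤s (unique-⊆-length u λ z z∈ → ∈-delete as (sub z (there z∈)) λ { refl → All.lookup x∉ z∈ refl }))

  -- Equality case of the pigeonhole. A head `y` of `ys` that recurs in the tail, or that is missing
  -- from `xs`, could be dropped, leaving a list too short to contain `xs`; otherwise `y` is deleted
  -- on both sides.
  length-⊆-unique : DecidableEquality A → ∀ {xs ys : List A} → Unique xs → (∀ x → x ∈ xs → x ∈ ys) →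
                    length ys ≤ length xs → Unique ys
  length-⊆-unique _≟A_ {ys = []} _ _ _ = []
  length-⊆-unique _≟A_ {xs} {y ∷ ys} u sub le with any? (y ≟A_) ys | any? (y ≟A_) xs
  ... | yes y∈ys | _ = ⊥-elim (<-irrefl refl (≤-trans le (unique-⊆-length u λ x x∈ → drop x (sub x x∈))))
    where drop : ∀ x → x ∈ y ∷ ys → x ∈ ys
          drop x (here refl) = y∈ys
          drop x (there p) = p
  ... | no _ | no y∉xs = ⊥-elim (<-irrefl refl (≤-trans le (unique-⊆-length u λ x x∈ → drop x x∈ (sub x x∈))))
    where drop : ∀ x → x ∈ xs → x ∈ y ∷ ys → x ∈ ys
          drop x x∈ (here refl) = ⊥-elim (y∉xs x∈)
          drop x x∈ (there p) = p
  ... | no y∉ys | yes y∈xs with ∈-∃++ y∈xs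
  ... | as , bs , refl = All.tabulate (λ { z∈ refl → y∉ys z∈ }) ∷
        length-⊆-unique _≟A_ {as ++ bs} (proj₁ (split as u))
          (λ x x∈ → drop x (sub x (widen as x∈)) λ { refl → proj₂ (split as u) x∈ })
          (s≤s⁻¹ (subst (suc (length ys) ≤_) (length-delete as) le))
    where
    widen : ∀ {x} as → x ∈ as ++ bs → x ∈ as ++ y ∷ bs
    widen as x∈ with ∈-++⁻ as x∈
    ... | inj₁ p = ∈-++⁺ˡ p
    ... | inj₂ p = ∈-++⁺ʳ as (there p)
    split : ∀ as → Unique (as ++ y ∷ bs) → Unique (as ++ bs) × y ∉ as ++ bs
    split [] (y∉ ∷ u) = u , λ y∈ → All.lookup y∉ y∈ refl
    split (a ∷ as) (a∉ ∷ u) with split as u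
    ... | u′ , y∉ = (All.tabulate (λ z∈ → All.lookup a∉ (widen as z∈)) ∷ u′) ,
          λ { (here refl) → All.lookup a∉ (∈-++⁺ʳ as (here refl)) refl ; (there p) → y∉ p }
    drop : ∀ x → x ∈ y ∷ ys → x ≢ y → x ∈ ys
    drop x (here e) ne = ⊥-elim (ne e)
    drop x (there p) _ = p

  module _ {A B : Set} {P : A → Set} {Q : B → Set} {R : A → B → Set}
    (total : ∀ x → P x → ∃ λ y → Q y × R x y) where

    images : ∀ xs → (∀ x → x ∈ xs → P x) → ∃ λ ys → Pointwise R xs ys × All Q ys
    images [] _ = [] , [] , []
    images (x ∷ xs) p with total x (p x (here refl)) | images xs (λ z z∈ → p z (there z∈))
    ... | y , qy , r | ys , rs , qs = y ∷ ys , r ∷ rs , qy ∷ qs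

    image-of : ∀ {xs ys} → Pointwise R xs ys → ∀ {x} → x ∈ xs → ∃ λ y → y ∈ ys × R x y
    image-of (r ∷ rs) (here refl) = _ , here refl , r
    image-of (r ∷ rs) (there x∈) with image-of rs x∈
    ... | y , y∈ , r′ = y , there y∈ , r′

    preimage-of : ∀ {xs ys} → Pointwise R xs ys → ∀ {y} → y ∈ ys → ∃ λ x → x ∈ xs × R x y
    preimage-of (r ∷ rs) (here refl) = _ , here refl , r
    preimage-of (r ∷ rs) (there y∈) with preimage-of rs y∈
    ... | x , x∈ , r′ = x , there x∈ , r′

    images-unique : (∀ x x′ y → P x → P x′ → R x y → R x′ y → x ≡ x′) →
      ∀ {xs ys} → (∀ x → x ∈ xs → P x) → Unique xs → Pointwise R xs ys → Unique ys
    images-unique inj p [] [] = []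
    images-unique inj p (x∉ ∷ u) (r ∷ rs) =
      All.tabulate (λ { y∈ refl → let x′ , x′∈ , r′ = preimage-of rs y∈ in
        All.lookup x∉ x′∈ (inj _ _ _ (p _ (here refl)) (p _ (there x′∈)) r r′) })
      ∷ images-unique inj (λ z z∈ → p z (there z∈)) u rs

    size-≤ : ∀ {k l} → (∀ x x′ y → P x → P x′ → R x y → R x′ y → x ≡ x′) →
      HasSize P k → HasSize Q l → k ≤ l
    size-≤ inj (xs , ux , px , cx , refl) (ys , uy , py , cy , refl) with images xs px
    ... | zs , rs , qs = subst (_≤ length ys) (sym (Pointwise-length rs))
          (unique-⊆-length (images-unique inj px ux rs) λ z z∈ → cy z (All.lookup qs z∈))

  -- A bijection as a relation. Both directions are existence statements, so a map that is known
  -- only through a construction with choices, such as extending a map from generators, can be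
  -- counted; and all four conditions are restricted to `P` and `Q`.
  record Corr {A B : Set} (P : A → Set) (Q : B → Set) (R : A → B → Set) : Set where
    field
      total : ∀ x → P x → ∃ λ y → Q y × R x y
      onto  : ∀ y → Q y → ∃ λ x → P x × R x y
      inj   : ∀ x x′ y → P x → P x′ → R x y → R x′ y → x ≡ x′
      fun   : ∀ x y y′ → P x → Q y → Q y′ → R x y → R x y′ → y ≡ y′

  size-corr : ∀ {A B : Set} {P : A → Set} {Q : B → Set} {R : A → B → Set} {k} →
    Corr P Q R → HasSize P k → HasSize Q k
  size-corr c (xs , ux , px , cx , refl) with images (Corr.total c) xs px
  ... | ys , rs , qs = ys , images-unique total inj px ux rs , (λ y y∈ → All.lookup qs y∈) ,
        (λ y qy → let x , p , r = onto y qy ; y′ , y′∈ , r′ = image-of total rs (cx x p) in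
          subst (_∈ ys) (fun x y′ y p (All.lookup qs y′∈) qy r′ r) y′∈) ,
        sym (Pointwise-length rs)
    where open Corr c

  size-⇔ : ∀ {k} → (∀ x → P x → Q x) → (∀ x → Q x → P x) → HasSize P k → HasSize Q k
  size-⇔ f g (xs , u , p , c , l) = xs , u , (λ x x∈ → f x (p x x∈)) , (λ x q → c x (g x q)) , l

  size-unique : ∀ {k l} → HasSize P k → HasSize P l → k ≡ l
  size-unique (xs , ux , px , cx , refl) (ys , uy , py , cy , refl) =
    ≤-antisym (unique-⊆-length ux λ x x∈ → cy x (px x x∈)) (unique-⊆-length uy λ x x∈ → cx x (py x x∈))

  size-filter : ∀ {k} → Decidable Q → HasSize P k → ∃ λ l → HasSize (λ x → P x × Q x) l
  size-filter Q? (xs , u , p , c , _) = _ , filter Q? xs , Uniq.filter⁺ Q? u ,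
    (λ x x∈ → let y , q = ∈-filter⁻ Q? x∈ in p x y , q) ,
    (λ { x (px , qx) → ∈-filter⁺ Q? (c x px) qx }) , refl

  length-filter-split : (Q? : Decidable Q) (xs : List A) →
    length xs ≡ length (filter Q? xs) + length (filter (λ x → ¬? (Q? x)) xs)
  length-filter-split Q? [] = refl
  length-filter-split Q? (x ∷ xs) with Q? x
  ... | yes _ = cong suc (length-filter-split Q? xs)
  ... | no _ = trans (cong suc (length-filter-split Q? xs)) (sym (+-suc _ _))

  size-diff : ∀ {k l} → Decidable Q → HasSize P k → HasSize (λ x → P x × Q x) l →
    HasSize (λ x → P x × ¬ Q x) (k ∸ l)
  size-diff {l = l} Q? hk@(xs , u , p , c , refl) hl with size-filter (λ x → ¬? (Q? x)) hk
  ... | m , hm = subst (HasSize _) eq hm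
    where
    eq : m ≡ length xs ∸ l
    eq with size-unique (proj₂ (size-filter Q? hk)) hl | size-unique (proj₂ (size-filter (λ x → ¬? (Q? x)) hk)) hm
    ... | refl | refl = sym (trans (cong (_∸ length (filter Q? xs)) (length-filter-split Q? xs)) (m+n∸m≡n (length (filter Q? xs)) _))

  -- The second predicate may vary with the first component as long as its fibres have a common
  -- size. This is the rule for successive choices, where the later options depend on the earlier
  -- ones but their number does not.
  size-× : ∀ {A B : Set} {P : A → Set} {Q : A → B → Set} {k m} → HasSize P k →
    (∀ x → P x → HasSize (Q x) m) → HasSize (λ p → P (proj₁ p) × Q (proj₁ p) (proj₂ p)) (k * m)
  size-× {A} {B} {P} {Q} {k} {m} (xs , u , p , c , refl) h with go xs u p
    where
    go : ∀ xs → Unique xs → (∀ x → x ∈ xs → P x) →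
      HasSize {A × B} (λ z → proj₁ z ∈ xs × Q (proj₁ z) (proj₂ z)) (length xs * m)
    go [] _ _ = [] , [] , (λ _ ()) , (λ _ ()) , refl
    go (x ∷ xs) (x∉ ∷ u) p with h x (p x (here refl)) | go xs u (λ z z∈ → p z (there z∈))
    ... | ys , uy , py , cy , ly | zs , uz , pz , cz , lz =
      map (x ,_) ys ++ zs , Uniq.++⁺ (Uniq.map⁺ (λ { refl → refl }) uy) uz disj ,
      (λ z z∈ → sound z (∈-++⁻ (map (x ,_) ys) z∈)) ,
      complete , trans (length-++ (map (x ,_) ys)) (cong₂ _+_ (trans (length-map (x ,_) ys) ly) lz)
      where
      disj : ∀ {z} → ¬ (z ∈ map (x ,_) ys × z ∈ zs)
      disj (z∈ , z∈′) with ∈-map⁻ (x ,_) z∈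
      ... | y , y∈ , refl = All.lookup x∉ (proj₁ (pz _ z∈′)) refl
      sound : ∀ z → z ∈ map (x ,_) ys ⊎ z ∈ zs → proj₁ z ∈ x ∷ xs × Q (proj₁ z) (proj₂ z)
      sound z (inj₁ z∈) with ∈-map⁻ (x ,_) z∈
      ... | y , y∈ , refl = here refl , py y y∈
      sound z (inj₂ z∈) = there (proj₁ (pz z z∈)) , proj₂ (pz z z∈)
      complete : ∀ z → proj₁ z ∈ x ∷ xs × Q (proj₁ z) (proj₂ z) → z ∈ map (x ,_) ys ++ zs
      complete (_ , y) (here refl , q) = ∈-++⁺ˡ (∈-map⁺ (x ,_) (cy y q))
      complete (x′ , y) (there x∈ , q) = ∈-++⁺ʳ (map (x ,_) ys) (cz _ (x∈ , q))
  ... | hs = size-⇔ (λ { z (i , q) → p _ i , q }) (λ { z (i , q) → c _ i , q }) hs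

  -- Turns a count into a decision procedure; the span condition on socle elements becomes decidable
  -- in this way, by enumerating the vectors that satisfy it.
  size-dec : ∀ {k} → DecidableEquality A → HasSize {A} P k → Decidable P
  size-dec _≟A_ (xs , u , p , c , _) x with any? (x ≟A_) xs
  ... | yes x∈ = yes (p x x∈)
  ... | no x∉ = no λ px → x∉ (c x px)

  size-∃? : ∀ {k} → Decidable Q → HasSize P k → Dec (∃ λ x → P x × Q x)
  size-∃? Q? (xs , u , p , c , _) with any? Q? xs
  ... | yes a = let x , x∈ , q = find a in yes (x , p x x∈ , q)
  ... | no ¬a = no λ { (x , px , qx) → ¬a (lose (c x px) qx) }

  size-⊤-filter : ∀ {A : Set} {Q : A → Set} {k} → HasSize {A} (λ _ → ⊤) k → Decidable Q → ∃ λ l → HasSize Q l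
  size-⊤-filter h Q? = let l , hl = size-filter Q? h in l , size-⇔ (λ _ → proj₂) (λ _ q → tt , q) hl

  -- A missed `y`, put in front of the image list, would give more distinct elements of `Q` than
  -- there are.
  injective⇒onto : DecidableEquality B → ∀ {k} {P : A → Set} {Q : B → Set} → HasSize P k → HasSize Q k →
    (f : A → B) → (∀ x → P x → Q (f x)) → (∀ x x′ → P x → P x′ → f x ≡ f x′ → x ≡ x′) →
    ∀ y → Q y → ∃ λ x → P x × f x ≡ y
  injective⇒onto _≟B_ {P = P} {Q} (xs , ux , px , cx , lx) (ys , uy , py , cy , ly) f pres inj y qy
    with any? (y ≟B_) (map f xs)
  ... | yes y∈ = let x , x∈ , e = ∈-map⁻ f y∈ in x , px x x∈ , sym e
  ... | no y∉ = ⊥-elim (<-irrefl (trans (length-map f xs) (trans lx (sym ly)))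
        (unique-⊆-length (All.tabulate (λ { z∈ refl → y∉ z∈ }) ∷ um xs ux px)
          λ { z (here refl) → cy z qy ; z (there z∈) → let x , x∈ , e = ∈-map⁻ f z∈ in subst (_∈ ys) (sym e) (cy _ (pres x (px x x∈))) }))
    where
    um : ∀ xs → Unique xs → (∀ x → x ∈ xs → P x) → Unique (map f xs)
    um [] _ _ = []
    um (x ∷ xs) (x∉ ∷ u) p = All.tabulate (λ z∈ e → let x′ , x′∈ , e′ = ∈-map⁻ f z∈ in
        All.lookup x∉ x′∈ (inj x x′ (p x (here refl)) (p x′ (there x′∈)) (trans e e′)))
      ∷ um xs u (λ z z∈ → p z (there z∈))

  -- The image list covers `Q` and is exactly as long as the enumeration of `Q`, so nothing in it is
  -- repeated.
  onto⇒injective : DecidableEquality B → ∀ {k} {P : A → Set} {Q : B → Set} → HasSize P k → HasSize Q k →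
    (f : A → B) → (∀ y → Q y → ∃ λ x → P x × f x ≡ y) →
    ∀ x x′ → P x → P x′ → f x ≡ f x′ → x ≡ x′
  onto⇒injective _≟B_ {P = P} {Q} (xs , ux , px , cx , lx) (ys , uy , py , cy , ly) f onto x x′ p p′ e =
    um xs (length-⊆-unique _≟B_ uy (λ y y∈ → let z , pz , e = onto y (py y y∈) in subst (_∈ map f xs) e (∈-map⁺ f (cx z pz)))
      (≤-reflexive (trans (length-map f xs) (trans lx (sym ly))))) (cx x p) (cx x′ p′) e
    where
    um : ∀ xs {x x′} → Unique (map f xs) → x ∈ xs → x′ ∈ xs → f x ≡ f x′ → x ≡ x′
    um (_ ∷ xs) (n ∷ u) (here refl) (here refl) e = refl
    um (_ ∷ xs) (n ∷ u) (here refl) (there q) e = ⊥-elim (All.lookup n (∈-map⁺ f q) e)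
    um (_ ∷ xs) (n ∷ u) (there p) (here refl) e = ⊥-elim (All.lookup n (∈-map⁺ f p) (sym e))
    um (_ ∷ xs) (n ∷ u) (there p) (there q) e = um xs u p q e

  size-pointwise : ∀ {S B : Set} {Q : S → B → Set} {m : S → ℕ} ss → All (λ s → HasSize (Q s) (m s)) ss →
    HasSize (Pointwise Q ss) (product (map m ss))
  size-pointwise [] [] = [ [] ] , ([] ∷ []) , (λ { _ (here refl) → [] }) , (λ { _ [] → here refl }) , refl
  size-pointwise {Q = Q} (s ∷ ss) (h ∷ hs) = size-corr {R = λ p ys → ys ≡ proj₁ p ∷ proj₂ p}
    (record { total = λ { (y , ys) (q , qs) → y ∷ ys , q ∷ qs , refl }
            ; onto = λ { (y ∷ ys) (q ∷ qs) → (y , ys) , (q , qs) , refl }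
            ; inj = λ { _ _ _ _ _ refl refl → refl }
            ; fun = λ { _ _ _ _ _ _ refl refl → refl } })
    (size-× h (λ _ _ → size-pointwise ss hs))

  size-lists : ∀ {A : Set} {k} {P : A → Set} → HasSize P k → ∀ n → HasSize (λ xs → length xs ≡ n × All P xs) (k ^ n)
  size-lists h zero = [ [] ] , ([] ∷ []) , (λ { _ (here refl) → refl , [] }) , (λ { [] _ → here refl ; (_ ∷ _) () }) , refl
  size-lists h (suc n) = size-corr {R = λ p ys → ys ≡ proj₁ p ∷ proj₂ p}
    (record { total = λ { (y , ys) (q , l , qs) → y ∷ ys , (cong suc l , q ∷ qs) , refl }
            ; onto = λ { (y ∷ ys) (l , q ∷ qs) → (y , ys) , (q , suc-injective l , qs) , refl ; [] (() , _) }
            ; inj = λ { _ _ _ _ _ refl refl → refl }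
            ; fun = λ { _ _ _ _ _ _ refl refl → refl } })
    (size-× h (λ _ _ → size-lists h n))

  ∑ : List A → (A → ℕ) → ℕ
  ∑ xs f = sum (map f xs)

  ∑-cong : ∀ (xs : List A) {f g : A → ℕ} → (∀ x → x ∈ xs → f x ≡ g x) → ∑ xs f ≡ ∑ xs g
  ∑-cong [] _ = refl
  ∑-cong (x ∷ xs) e = cong₂ _+_ (e x (here refl)) (∑-cong xs λ z z∈ → e z (there z∈))

  ∑-+ : ∀ (xs : List A) {f g : A → ℕ} → ∑ xs (λ x → f x + g x) ≡ ∑ xs f + ∑ xs g
  ∑-+ [] = refl
  ∑-+ (x ∷ xs) {f} {g} = trans (cong (f x + g x +_) (∑-+ xs)) (+-interchange (f x) (g x) _ _)
    where
    +-interchange : ∀ a b c d → (a + b) + (c + d) ≡ (a + c) + (b + d)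
    +-interchange a b c d = trans (+-assoc a b _) (trans (cong (a +_) (trans (sym (+-assoc b c d))
      (trans (cong (_+ d) (+-comm b c)) (+-assoc c b d)))) (sym (+-assoc a c _)))

  ∑-0 : ∀ (xs : List A) → ∑ xs (λ _ → 0) ≡ 0
  ∑-0 [] = refl
  ∑-0 (x ∷ xs) = ∑-0 xs

  ∑-swap : ∀ (xs : List A) (ys : List B) (f : A → B → ℕ) →
    ∑ xs (λ x → ∑ ys (f x)) ≡ ∑ ys (λ y → ∑ xs (λ x → f x y))
  ∑-swap [] ys f = sym (∑-0 ys)
  ∑-swap (x ∷ xs) ys f = trans (cong (∑ ys (f x) +_) (∑-swap xs ys f)) (sym (∑-+ ys))

  ∑-const : ∀ (xs : List A) c → ∑ xs (λ _ → c) ≡ length xs * c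
  ∑-const [] c = refl
  ∑-const (x ∷ xs) c = cong (c +_) (∑-const xs c)

  ∑-*ʳ : ∀ (xs : List A) (f : A → ℕ) c → ∑ xs (λ x → f x * c) ≡ ∑ xs f * c
  ∑-*ʳ [] f c = refl
  ∑-*ʳ (x ∷ xs) f c = trans (cong (f x * c +_) (∑-*ʳ xs f c)) (sym (*-distribʳ-+ c (f x) _))

  ∑-*ˡ : ∀ (xs : List A) (f : A → ℕ) c → ∑ xs (λ x → c * f x) ≡ c * ∑ xs f
  ∑-*ˡ xs f c = trans (∑-cong xs λ x _ → *-comm c (f x)) (trans (∑-*ʳ xs f c) (*-comm _ c))

  ∑-++ : ∀ (xs ys : List A) (f : A → ℕ) → ∑ (xs ++ ys) f ≡ ∑ xs f + ∑ ys f
  ∑-++ [] ys f = refl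
  ∑-++ (x ∷ xs) ys f = trans (cong (f x +_) (∑-++ xs ys f)) (sym (+-assoc (f x) _ _))

  -- Iverson bracket, indexed by the decision so that a sum can be evaluated by matching on it.
  ⟦_⟧ : {X : Set} → Dec X → ℕ
  ⟦ yes _ ⟧ = 1
  ⟦ no _ ⟧ = 0

  size-∑ : ∀ {xs : List A} (Q? : Decidable Q) → Unique xs →
    HasSize (λ x → x ∈ xs × Q x) (∑ xs λ x → ⟦ Q? x ⟧)
  size-∑ {xs = xs} Q? u = filter Q? xs , Uniq.filter⁺ Q? u ,
    (λ x x∈ → ∈-filter⁻ Q? x∈) , (λ { x (x∈ , q) → ∈-filter⁺ Q? x∈ q }) , len xs
    where
    len : ∀ xs → length (filter Q? xs) ≡ ∑ xs λ x → ⟦ Q? x ⟧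
    len [] = refl
    len (x ∷ xs) with Q? x
    ... | yes _ = cong suc (len xs)
    ... | no _ = len xs

  -- Exactly one entry is related to `g`: at least one by the `Any`, at most one because two of them
  -- would be related to each other. A sum supported on the class of `g` thus collapses to a single
  -- term; the relation will be double coset equivalence, conjugacy or equality.
  ∑-representative : ∀ {R : A → A → Set} {g c} (xs : List A) (f : A → ℕ) → AllPairs (λ x y → ¬ R x y) xs →
    (∀ {x y} → R g x → R g y → R x y) → Any (R g) xs →
    (∀ x → R g x → f x ≡ c) → (∀ x → ¬ R g x → f x ≡ 0) → ∑ xs f ≡ c
  ∑-representative (x ∷ xs) f (n ∷ ns) eucl (here r) same other =
    trans (cong₂ _+_ (same x r) (trans (∑-cong xs λ y y∈ → other y λ r′ → All.lookup n y∈ (eucl r r′)) (∑-0 xs))) (+-identityʳ _)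
  ∑-representative (x ∷ xs) f (n ∷ ns) eucl (there a) same other =
    cong₂ _+_ (other x λ r → let y , y∈ , r′ = find a in All.lookup n y∈ (eucl r r′))
              (∑-representative xs f ns eucl a same other)

-- The polynomial ring over the finite field.

module PolyRing {q : ℕ} (F : FiniteField q) where
  open import Level using (0ℓ)
  open import Data.Nat.Base using (ℕ; zero; suc)
  open import Data.List.Base using ([]; _∷_; map; [_])
  open import Data.Product using (_,_)
  open import Algebra.Bundles using (CommutativeRing)
  open import Algebra.Structures
  open import Relation.Binary.PropositionalEquality hiding ([_])
  import Algebra.Solver.Ring.NaturalCoefficients.Default as NatSolver
  open FiniteField F public
  open LinAlg F hiding (_⊕_)

  fieldRing : CommutativeRing 0ℓ 0ℓ
  fieldRing = record { isCommutativeRing = isCommutativeRing }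

  module 𝔽 = CommutativeRing fieldRing
  module 𝔽Solver = NatSolver 𝔽.commutativeSemiring

  coef : Poly → ℕ → K
  coef [] _ = 0F
  coef (a ∷ p) zero = a
  coef (a ∷ p) (suc i) = coef p i

  infix 4 _≈_
  -- Coefficient lists may end in zeros, so equality of polynomials is equality of all coefficients.
  -- The record wrapper keeps `p` and `r` recoverable from the type.
  record _≈_ (p r : Poly) : Set where
    constructor coefs
    field at : ∀ i → coef p i ≡ coef r i
  open _≈_ public

  ≈-refl : ∀ {p} → p ≈ p
  ≈-refl = coefs λ _ → refl

  ≈-sym : ∀ {p r} → p ≈ r → r ≈ p
  ≈-sym e = coefs λ i → sym (at e i)

  ≈-trans : ∀ {p r s} → p ≈ r → r ≈ s → p ≈ s
  ≈-trans e f = coefs λ i → trans (at e i) (at f i)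

  cons-cong : ∀ {a b p r} → a ≡ b → p ≈ r → a ∷ p ≈ b ∷ r
  cons-cong e f = coefs λ { zero → e ; (suc i) → at f i }

  scaleP : K → Poly → Poly
  scaleP a = map (a *F_)

  negP : Poly → Poly
  negP = map -F_

  coef-scaleP : ∀ a p i → coef (scaleP a p) i ≡ a *F coef p i
  coef-scaleP a [] i = sym (𝔽.zeroʳ a)
  coef-scaleP a (b ∷ p) zero = refl
  coef-scaleP a (b ∷ p) (suc i) = coef-scaleP a p i

  -0≡0 : -F 0F ≡ 0F
  -0≡0 = trans (sym (𝔽.+-identityˡ _)) (𝔽.-‿inverseʳ 0F)

  coef-negP : ∀ p i → coef (negP p) i ≡ -F coef p i
  coef-negP [] i = sym -0≡0
  coef-negP (b ∷ p) zero = refl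
  coef-negP (b ∷ p) (suc i) = coef-negP p i

  coef-+ : ∀ p r i → coef (polyAdd p r) i ≡ coef p i +F coef r i
  coef-+ [] r i = sym (𝔽.+-identityˡ _)
  coef-+ (a ∷ p) [] i = sym (𝔽.+-identityʳ _)
  coef-+ (a ∷ p) (b ∷ r) zero = refl
  coef-+ (a ∷ p) (b ∷ r) (suc i) = coef-+ p r i

  +P-cong : ∀ {p p′ r r′} → p ≈ p′ → r ≈ r′ → polyAdd p r ≈ polyAdd p′ r′
  +P-cong {p} {p′} {r} {r′} e f = coefs λ i →
    trans (coef-+ p r i) (trans (cong₂ _+F_ (at e i) (at f i)) (sym (coef-+ p′ r′ i)))

  +P-assoc : ∀ p r s → polyAdd (polyAdd p r) s ≈ polyAdd p (polyAdd r s)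
  +P-assoc p r s = coefs λ i → begin
    coef (polyAdd (polyAdd p r) s) i ≡⟨ coef-+ (polyAdd p r) s i ⟩
    coef (polyAdd p r) i +F coef s i ≡⟨ cong (_+F coef s i) (coef-+ p r i) ⟩
    coef p i +F coef r i +F coef s i ≡⟨ 𝔽.+-assoc _ _ _ ⟩
    coef p i +F (coef r i +F coef s i) ≡⟨ cong (coef p i +F_) (coef-+ r s i) ⟨
    coef p i +F coef (polyAdd r s) i ≡⟨ coef-+ p (polyAdd r s) i ⟨
    coef (polyAdd p (polyAdd r s)) i ∎
    where open ≡-Reasoning

  +P-comm : ∀ p r → polyAdd p r ≈ polyAdd r p
  +P-comm p r = coefs λ i → trans (coef-+ p r i) (trans (𝔽.+-comm _ _) (sym (coef-+ r p i)))

  +P-identityʳ : ∀ p → polyAdd p [] ≈ p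
  +P-identityʳ p = coefs λ i → trans (coef-+ p [] i) (𝔽.+-identityʳ _)

  +P-inverseʳ : ∀ p → polyAdd p (negP p) ≈ []
  +P-inverseʳ p = coefs λ i → trans (coef-+ p (negP p) i) (trans (cong (coef p i +F_) (coef-negP p i)) (𝔽.-‿inverseʳ _))

  negP-cong : ∀ {p r} → p ≈ r → negP p ≈ negP r
  negP-cong {p} {r} e = coefs λ i → trans (coef-negP p i) (trans (cong -F_ (at e i)) (sym (coef-negP r i)))

  scaleP-cong : ∀ {a b p r} → a ≡ b → p ≈ r → scaleP a p ≈ scaleP b r
  scaleP-cong {a} {b} {p} {r} refl e = coefs λ i →
    trans (coef-scaleP a p i) (trans (cong (a *F_) (at e i)) (sym (coef-scaleP a r i)))

  scaleP-+ : ∀ a p r → scaleP a (polyAdd p r) ≈ polyAdd (scaleP a p) (scaleP a r)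
  scaleP-+ a p r = coefs λ i → begin
    coef (scaleP a (polyAdd p r)) i ≡⟨ coef-scaleP a (polyAdd p r) i ⟩
    a *F coef (polyAdd p r) i ≡⟨ cong (a *F_) (coef-+ p r i) ⟩
    a *F (coef p i +F coef r i) ≡⟨ 𝔽.distribˡ a _ _ ⟩
    a *F coef p i +F a *F coef r i ≡⟨ cong₂ _+F_ (coef-scaleP a p i) (coef-scaleP a r i) ⟨
    coef (scaleP a p) i +F coef (scaleP a r) i ≡⟨ coef-+ (scaleP a p) (scaleP a r) i ⟨
    coef (polyAdd (scaleP a p) (scaleP a r)) i ∎
    where open ≡-Reasoning

  scaleP-scaleP : ∀ a b p → scaleP a (scaleP b p) ≈ scaleP (a *F b) p
  scaleP-scaleP a b p = coefs λ i → trans (coef-scaleP a (scaleP b p) i)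
    (trans (cong (a *F_) (coef-scaleP b p i)) (trans (sym (𝔽.*-assoc a b _)) (sym (coef-scaleP (a *F b) p i))))

  scaleP-0 : ∀ p → scaleP 0F p ≈ []
  scaleP-0 p = coefs λ i → trans (coef-scaleP 0F p i) (𝔽.zeroˡ _)

  scaleP-1 : ∀ p → scaleP 1F p ≈ p
  scaleP-1 p = coefs λ i → trans (coef-scaleP 1F p i) (𝔽.*-identityˡ _)

  0∷[]≈[] : 0F ∷ [] ≈ []
  0∷[]≈[] = coefs λ { zero → refl ; (suc i) → refl }

  cons-+ : ∀ p r → 0F ∷ polyAdd p r ≈ polyAdd (0F ∷ p) (0F ∷ r)
  cons-+ p r = cons-cong (sym (𝔽.+-identityˡ 0F)) ≈-refl

  scaleP-cons : ∀ a p → scaleP a (0F ∷ p) ≈ 0F ∷ scaleP a p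
  scaleP-cons a p = cons-cong (𝔽.zeroʳ a) ≈-refl

  +P-interchange : ∀ p r s t → polyAdd (polyAdd p r) (polyAdd s t) ≈ polyAdd (polyAdd p s) (polyAdd r t)
  +P-interchange p r s t = coefs λ i → begin
    coef (polyAdd (polyAdd p r) (polyAdd s t)) i ≡⟨ expand p r s t i ⟩
    (coef p i +F coef r i) +F (coef s i +F coef t i) ≡⟨ swap (coef p i) (coef r i) (coef s i) (coef t i) ⟩
    (coef p i +F coef s i) +F (coef r i +F coef t i) ≡⟨ expand p s r t i ⟨
    coef (polyAdd (polyAdd p s) (polyAdd r t)) i ∎
    where
    open ≡-Reasoning
    expand : ∀ p r s t i → coef (polyAdd (polyAdd p r) (polyAdd s t)) i ≡ (coef p i +F coef r i) +F (coef s i +F coef t i)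
    expand p r s t i = trans (coef-+ (polyAdd p r) (polyAdd s t) i) (cong₂ _+F_ (coef-+ p r i) (coef-+ s t i))
    swap : ∀ a b c d → (a +F b) +F (c +F d) ≡ (a +F c) +F (b +F d)
    swap = 𝔽Solver.solve 4 (λ a b c d → (a :+ b) :+ (c :+ d) := (a :+ c) :+ (b :+ d)) refl
      where open 𝔽Solver

  mulʳ-[] : ∀ p → polyMul p [] ≈ []
  mulʳ-[] [] = ≈-refl
  mulʳ-[] (a ∷ p) = ≈-trans (cons-cong refl (mulʳ-[] p)) 0∷[]≈[]

  mul-congʳ : ∀ p {r s} → r ≈ s → polyMul p r ≈ polyMul p s
  mul-congʳ [] e = ≈-refl
  mul-congʳ (a ∷ p) e = +P-cong (scaleP-cong refl e) (cons-cong refl (mul-congʳ p e))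

  mul-distribˡ : ∀ p r s → polyMul p (polyAdd r s) ≈ polyAdd (polyMul p r) (polyMul p s)
  mul-distribˡ [] r s = ≈-refl
  mul-distribˡ (a ∷ p) r s = ≈-trans
    (+P-cong (scaleP-+ a r s) (≈-trans (cons-cong refl (mul-distribˡ p r s)) (cons-+ (polyMul p r) (polyMul p s))))
    (+P-interchange (scaleP a r) (scaleP a s) _ _)

  mul-scaleʳ : ∀ p a r → polyMul p (scaleP a r) ≈ scaleP a (polyMul p r)
  mul-scaleʳ [] a r = ≈-refl
  mul-scaleʳ (b ∷ p) a r = ≈-trans
    (+P-cong (≈-trans (scaleP-scaleP b a r) (≈-trans (scaleP-cong (𝔽.*-comm b a) ≈-refl) (≈-sym (scaleP-scaleP a b r))))
             (≈-trans (cons-cong refl (mul-scaleʳ p a r)) (≈-sym (scaleP-cons a _))))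
    (≈-sym (scaleP-+ a (scaleP b r) _))

  mul-consʳ : ∀ p r → polyMul p (0F ∷ r) ≈ 0F ∷ polyMul p r
  mul-consʳ [] r = ≈-sym 0∷[]≈[]
  mul-consʳ (a ∷ p) r = ≈-trans
    (+P-cong (scaleP-cons a r) (cons-cong refl (mul-consʳ p r))) (≈-sym (cons-+ (scaleP a r) (0F ∷ polyMul p r)))

  mul-[-]ʳ : ∀ p a → polyMul p [ a ] ≈ scaleP a p
  mul-[-]ʳ [] a = ≈-refl
  mul-[-]ʳ (b ∷ p) a = cons-cong (trans (𝔽.+-identityʳ _) (𝔽.*-comm b a)) (mul-[-]ʳ p a)

  cons-split : ∀ a p → a ∷ p ≈ polyAdd [ a ] (0F ∷ p)
  cons-split a p = cons-cong (sym (𝔽.+-identityʳ a)) ≈-refl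

  -- The recursion of `polyMul` is on the left factor. Once `a ∷ p` stands on the right, splitting
  -- it into constant and shift replays the same recursion on the other side.
  mul-comm : ∀ p r → polyMul p r ≈ polyMul r p
  mul-comm [] r = ≈-sym (mulʳ-[] r)
  mul-comm (a ∷ p) r = ≈-trans
    (+P-cong (≈-sym (mul-[-]ʳ r a)) (≈-trans (cons-cong refl (mul-comm p r)) (≈-sym (mul-consʳ r p))))
    (≈-trans (≈-sym (mul-distribˡ r [ a ] (0F ∷ p))) (mul-congʳ r (≈-sym (cons-split a p))))

  -- Equivalent left factors may have different lengths, so congruence on the left is obtained from
  -- congruence on the right by commutativity.
  mul-cong : ∀ {p p′ r r′} → p ≈ p′ → r ≈ r′ → polyMul p r ≈ polyMul p′ r′
  mul-cong {p} {p′} {r} {r′} e f = ≈-trans (mul-congʳ p f)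
    (≈-trans (mul-comm p r′) (≈-trans (mul-congʳ r′ e) (mul-comm r′ p′)))

  mul-distribʳ : ∀ s p r → polyMul (polyAdd p r) s ≈ polyAdd (polyMul p s) (polyMul r s)
  mul-distribʳ s p r = ≈-trans (mul-comm (polyAdd p r) s)
    (≈-trans (mul-distribˡ s p r) (+P-cong (mul-comm s p) (mul-comm s r)))

  mul-scaleˡ : ∀ a p r → polyMul (scaleP a p) r ≈ scaleP a (polyMul p r)
  mul-scaleˡ a p r = ≈-trans (mul-comm (scaleP a p) r) (≈-trans (mul-scaleʳ r a p) (scaleP-cong refl (mul-comm r p)))

  mul-consˡ : ∀ p r → polyMul (0F ∷ p) r ≈ 0F ∷ polyMul p r
  mul-consˡ p r = +P-cong (scaleP-0 r) ≈-refl

  mul-assoc : ∀ p r s → polyMul (polyMul p r) s ≈ polyMul p (polyMul r s)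
  mul-assoc [] r s = ≈-refl
  mul-assoc (a ∷ p) r s = ≈-trans (mul-distribʳ s (scaleP a r) (0F ∷ polyMul p r))
    (+P-cong (mul-scaleˡ a r s) (≈-trans (mul-consˡ (polyMul p r) s) (cons-cong refl (mul-assoc p r s))))

  mul-identityˡ : ∀ p → polyMul [ 1F ] p ≈ p
  mul-identityˡ p = ≈-trans (+P-cong (scaleP-1 p) 0∷[]≈[]) (+P-identityʳ p)

  -- Opaque because unification cannot recover the operands of the list recursions polyAdd and polyMul.
  opaque
    infixl 6 _+_
    infixl 7 _*_
    infix 8 -_ _·P_

    _+_ _*_ : Poly → Poly → Poly
    _+_ = polyAdd
    _*_ = polyMul

    -_ : Poly → Poly
    -_ = negP

    _·P_ : K → Poly → Poly
    _·P_ = scaleP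

  opaque
    unfolding _+_

    +-def : ∀ p r → p + r ≡ polyAdd p r
    +-def p r = refl

    *-def : ∀ p r → p * r ≡ polyMul p r
    *-def p r = refl

    ·P-def : ∀ a p → a ·P p ≡ scaleP a p
    ·P-def a p = refl

    coef-add : ∀ p r i → coef (p + r) i ≡ coef p i +F coef r i
    coef-add = coef-+

    coef-·P : ∀ a p i → coef (a ·P p) i ≡ a *F coef p i
    coef-·P = coef-scaleP

    ·P-cong : ∀ {a p r} → p ≈ r → a ·P p ≈ a ·P r
    ·P-cong e = scaleP-cong refl e

    1·P : ∀ p → 1F ·P p ≈ p
    1·P = scaleP-1

    ·P-·P : ∀ a b p → a ·P (b ·P p) ≈ (a *F b) ·P p
    ·P-·P = scaleP-scaleP

    cons≈ : ∀ a p → a ∷ p ≈ [ a ] + (0F ∷ p)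
    cons≈ = cons-split

    cons+cons : ∀ a b p r → (a ∷ p) + (b ∷ r) ≡ (a +F b) ∷ (p + r)
    cons+cons a b p r = refl

    *-consʳ : ∀ p r → p * (0F ∷ r) ≈ 0F ∷ p * r
    *-consʳ = mul-consʳ

    *-constʳ : ∀ p a → p * [ a ] ≈ a ·P p
    *-constʳ = mul-[-]ʳ

    ·P-*ʳ : ∀ p a r → p * (a ·P r) ≈ a ·P (p * r)
    ·P-*ʳ = mul-scaleʳ

    isCommutativeRingP : IsCommutativeRing _≈_ _+_ _*_ -_ [] [ 1F ]
    isCommutativeRingP = record
      { *-comm = mul-comm
      ; isRing = record
        { *-cong = mul-cong
        ; *-assoc = mul-assoc
        ; *-identity = mul-identityˡ , λ p → ≈-trans (mul-comm p [ 1F ]) (mul-identityˡ p)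
        ; distrib = mul-distribˡ , mul-distribʳ
        ; +-isAbelianGroup = record
          { comm = +P-comm
          ; isGroup = record
            { ⁻¹-cong = negP-cong
            ; inverse = (λ p → ≈-trans (+P-comm (negP p) p) (+P-inverseʳ p)) , +P-inverseʳ
            ; isMonoid = record
              { identity = (λ _ → ≈-refl) , +P-identityʳ
              ; isSemigroup = record
                { assoc = +P-assoc
                ; isMagma = record
                  { ∙-cong = +P-cong
                  ; isEquivalence = record { refl = ≈-refl ; sym = ≈-sym ; trans = ≈-trans } } } } } } } }

  polyRing : CommutativeRing 0ℓ 0ℓ
  polyRing = record { isCommutativeRing = isCommutativeRingP }

  module ℙ = CommutativeRing polyRing
  module ℙSolver = NatSolver ℙ.commutativeSemiring

  pow-suc : ∀ p k → polyPow p (suc k) ≡ p * polyPow p k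
  pow-suc p k = sym (*-def p _)

-- Divisibility, division with remainder, and irreducible polynomials.

module PolyArith {q : ℕ} (F : FiniteField q) where
  open import Data.Nat.Base as ℕ using (zero; suc; _≤_; _<_; z≤n; s≤s; s≤s⁻¹; _∸_)
  import Data.Nat.Properties as ℕP
  open import Data.Fin.Properties using () renaming (_≟_ to _≟K_)
  open import Data.List.Base using ([]; _∷_; _++_; length; [_])
  open import Data.List.Properties using (length-++; length-map; map-++; map-id; map-cong; ∷ʳ-injective)
  open import Data.Product using (∃; _×_; _,_; proj₁; proj₂)
  open import Data.Sum using (_⊎_; inj₁; inj₂)
  open import Data.Empty using (⊥-elim)
  open import Relation.Nullary
  open import Relation.Binary.PropositionalEquality hiding ([_])
  open PolyRing F
  open LinAlg F hiding (_⊕_)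
  open ℙ using (+-cong; *-cong; *-comm; *-assoc; distribˡ; +-identityʳ; zeroʳ; *-identityʳ; *-identityˡ)
  open ℙSolver using (solve; _:=_; _:+_; _:*_; con)
  import Relation.Binary.Reasoning.Setoid ℙ.setoid as ≈R

  infix 4 _∣_
  _∣_ : Poly → Poly → Set
  d ∣ p = ∃ λ s → p ≈ d * s

  ∣-resp : ∀ {d p r} → p ≈ r → d ∣ p → d ∣ r
  ∣-resp e (s , f) = s , ≈-trans (≈-sym e) f

  ∣-respˡ : ∀ {d d′ p} → d ≈ d′ → d ∣ p → d′ ∣ p
  ∣-respˡ e (s , f) = s , ≈-trans f (*-cong e ≈-refl)

  ∣-refl : ∀ {d} → d ∣ d
  ∣-refl {d} = [ 1F ] , ≈-sym (*-identityʳ d)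

  ∣-zero : ∀ {d} → d ∣ []
  ∣-zero {d} = [] , ≈-sym (zeroʳ d)

  ∣-+ : ∀ {d p r} → d ∣ p → d ∣ r → d ∣ p + r
  ∣-+ {d} (s , e) (t , f) = s + t , ≈-trans (+-cong e f) (≈-sym (distribˡ d s t))

  ∣-*ʳ : ∀ {d p} r → d ∣ p → d ∣ p * r
  ∣-*ʳ {d} r (s , e) = s * r , ≈-trans (*-cong e ≈-refl) (*-assoc d s r)

  ∣-*ˡ : ∀ {d p} r → d ∣ p → d ∣ r * p
  ∣-*ˡ {d} {p} r h = ∣-resp (*-comm p r) (∣-*ʳ r h)

  ∣-trans : ∀ {a b c} → a ∣ b → b ∣ c → a ∣ c
  ∣-trans {a} (s , e) (t , f) = s * t , ≈-trans f (≈-trans (*-cong e ≈-refl) (*-assoc a s t))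

  -- Subtraction is written as adding `neg1 * x`: the ring solver works with natural coefficients
  -- and treats `neg1` as one more variable, whose law `neg1-cancel` is applied by hand.
  neg1 : Poly
  neg1 = - [ 1F ]

  neg1-cancel : ∀ x → x + neg1 * x ≈ []
  neg1-cancel x = begin
    x + neg1 * x ≈⟨ solve 2 (λ x m → x :+ m :* x := (con 1 :+ m) :* x) ≈-refl x neg1 ⟩
    ([ 1F ] + neg1) * x ≈⟨ *-cong (ℙ.-‿inverseʳ [ 1F ]) ≈-refl ⟩
    [] * x ≈⟨ ℙ.zeroˡ x ⟩
    [] ∎
    where open ≈R

  subtract : ∀ {x y z} → x + y ≈ z → y ≈ z + neg1 * x
  subtract {x} {y} {z} e = begin
    y ≈⟨ +-identityʳ y ⟨
    y + [] ≈⟨ +-cong ≈-refl (neg1-cancel x) ⟨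
    y + (x + neg1 * x) ≈⟨ solve 3 (λ x y m → y :+ (x :+ m :* x) := (x :+ y) :+ m :* x) ≈-refl x y neg1 ⟩
    (x + y) + neg1 * x ≈⟨ +-cong e ≈-refl ⟩
    z + neg1 * x ∎
    where open ≈R

  ∣-cancel : ∀ {d p r} → d ∣ p + r → d ∣ p → d ∣ r
  ∣-cancel h k = ∣-resp (≈-sym (subtract ≈-refl)) (∣-+ h (∣-*ˡ neg1 k))

  _≈0? : ∀ p → Dec (p ≈ [])
  [] ≈0? = yes ≈-refl
  (a ∷ p) ≈0? with a ≟K 0F | p ≈0?
  ... | yes refl | yes e = yes (≈-trans (cons-cong refl e) 0∷[]≈[])
  ... | no a≢0 | _ = no λ e → a≢0 (at e 0)
  ... | yes _ | no n = no λ e → n (coefs λ i → at e (suc i))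

  ≈⇒≡ : ∀ p r → length p ≡ length r → p ≈ r → p ≡ r
  ≈⇒≡ [] [] _ _ = refl
  ≈⇒≡ (a ∷ p) (b ∷ r) l e = cong₂ _∷_ (at e 0) (≈⇒≡ p r (ℕP.suc-injective l) (coefs λ i → at e (suc i)))

  ¬[]≈snoc : ∀ p {a} → a ≢ 0F → ¬ ([] ≈ p ++ [ a ])
  ¬[]≈snoc [] a≢0 e = a≢0 (sym (at e 0))
  ¬[]≈snoc (_ ∷ p) a≢0 e = ¬[]≈snoc p a≢0 (coefs λ i → at e (suc i))

  -- A nonzero last entry is the leading coefficient, so both lists are the shortest representative
  -- of one polynomial.
  snoc-≈⇒≡ : ∀ p r {a b} → a ≢ 0F → b ≢ 0F → p ++ [ a ] ≈ r ++ [ b ] → p ++ [ a ] ≡ r ++ [ b ]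
  snoc-≈⇒≡ [] [] a≢0 b≢0 e = cong [_] (at e 0)
  snoc-≈⇒≡ [] (x ∷ r) a≢0 b≢0 e = ⊥-elim (¬[]≈snoc r b≢0 (coefs λ i → at e (suc i)))
  snoc-≈⇒≡ (x ∷ p) [] a≢0 b≢0 e = ⊥-elim (¬[]≈snoc p a≢0 (coefs λ i → sym (at e (suc i))))
  snoc-≈⇒≡ (x ∷ p) (y ∷ r) a≢0 b≢0 e = cong₂ _∷_ (at e 0) (snoc-≈⇒≡ p r a≢0 b≢0 (coefs λ i → at e (suc i)))

  1≢0 : 1F ≢ 0F
  1≢0 e = 0≢1 (sym e)

  add-monic : ∀ p m → length p ≤ length m → ∃ λ s → polyAdd p (m ++ [ 1F ]) ≡ s ++ [ 1F ] × length s ≡ length m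
  add-monic [] m _ = m , refl , refl
  add-monic (a ∷ p) (b ∷ m) (s≤s le) = let s , e , l = add-monic p m le in
    (a +F b) ∷ s , cong (_ ∷_) e , cong suc l

  scaleP-1≡ : ∀ p → scaleP 1F p ≡ p
  scaleP-1≡ p = trans (map-cong 𝔽.*-identityˡ p) (map-id p)

  length-snoc : ∀ (p : Poly) {a} → length (p ++ [ a ]) ≡ suc (length p)
  length-snoc p = trans (length-++ p) (ℕP.+-comm (length p) 1)

  mul-monic : ∀ p r → ∃ λ s → polyMul (p ++ [ 1F ]) (r ++ [ 1F ]) ≡ s ++ [ 1F ] × length s ≡ length p ℕ.+ length r
  mul-monic [] r = r , trans (cong (λ z → polyAdd z [ 0F ]) (scaleP-1≡ (r ++ [ 1F ]))) (add-0 r) , refl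
    where
    polyAdd-[] : ∀ p → polyAdd p [] ≡ p
    polyAdd-[] [] = refl
    polyAdd-[] (_ ∷ _) = refl
    add-0 : ∀ r → polyAdd (r ++ [ 1F ]) [ 0F ] ≡ r ++ [ 1F ]
    add-0 [] = cong [_] (𝔽.+-identityʳ _)
    add-0 (x ∷ r) = cong₂ _∷_ (𝔽.+-identityʳ _) (polyAdd-[] (r ++ [ 1F ]))
  mul-monic (a ∷ p) r with mul-monic p r
  ... | s , e , l with add-monic (scaleP a (r ++ [ 1F ])) (0F ∷ s)
                       (subst (_≤ _) (sym (trans (length-map _ (r ++ [ 1F ])) (length-snoc r)))
                         (s≤s (subst (length r ≤_) (sym l) (ℕP.m≤n+m (length r) (length p)))))
  ... | t , e′ , l′ = t , trans (cong (λ z → polyAdd (scaleP a (r ++ [ 1F ])) (0F ∷ z)) e) e′ , trans l′ (cong suc l)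

  pow-monic : ∀ p k → ∃ λ s → polyPow (p ++ [ 1F ]) k ≡ s ++ [ 1F ] × length s ≡ length p ℕ.* k
  pow-monic p zero = [] , refl , sym (ℕP.*-zeroʳ (length p))
  pow-monic p (suc k) with pow-monic p k
  ... | s , e , l with mul-monic p s
  ... | t , e′ , l′ = t , trans (cong (polyMul (p ++ [ 1F ])) e) e′ , trans l′ (trans (cong (length p ℕ.+_) l) (sym (ℕP.*-suc (length p) k)))

  pow-+ : ∀ p k l → polyPow p (k ℕ.+ l) ≈ polyPow p k * polyPow p l
  pow-+ p zero l = ≈-sym (*-identityˡ _)
  pow-+ p (suc k) l = begin
    polyPow p (suc (k ℕ.+ l)) ≡⟨ pow-suc p (k ℕ.+ l) ⟩
    p * polyPow p (k ℕ.+ l) ≈⟨ *-cong ≈-refl (pow-+ p k l) ⟩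
    p * (polyPow p k * polyPow p l) ≈⟨ *-assoc p (polyPow p k) (polyPow p l) ⟨
    p * polyPow p k * polyPow p l ≡⟨ cong (_* polyPow p l) (pow-suc p k) ⟨
    polyPow p (suc k) * polyPow p l ∎
    where open ≈R

  pow-∣ : ∀ p {k l} → k ≤ l → polyPow p k ∣ polyPow p l
  pow-∣ p {k} {l} le = polyPow p (l ∸ k) , ≈-trans (ℙ.reflexive (cong (polyPow p) (sym (ℕP.m+[n∸m]≡n le)))) (pow-+ p k (l ∸ k))

  pow-1 : ∀ p → polyPow p 1 ≈ p
  pow-1 p = ≈-trans (ℙ.reflexive (pow-suc p 0)) (*-identityʳ p)

  coef-snoc : ∀ p a → coef (p ++ [ a ]) (length p) ≡ a
  coef-snoc [] a = refl
  coef-snoc (_ ∷ p) a = coef-snoc p a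

  coef-beyond : ∀ p i → length p ≤ i → coef p i ≡ 0F
  coef-beyond [] i _ = refl
  coef-beyond (a ∷ p) (suc i) (s≤s le) = coef-beyond p i le

  cons≈[] : ∀ {a p} → a ≡ 0F → p ≈ [] → a ∷ p ≈ []
  cons≈[] refl e = ≈-trans (cons-cong refl e) 0∷[]≈[]

  *-cons : ∀ p a r → p * (a ∷ r) ≈ a ·P p + (0F ∷ p * r)
  *-cons p a r = ≈-trans (*-cong ≈-refl (cons≈ a r))
      (≈-trans (distribˡ p [ a ] (0F ∷ r)) (+-cong (*-constʳ p a) (*-consʳ p r)))

  -- A degree argument run from the low end. In φ (a + X s) = a φ + X φ s the term a φ ends at index
  -- `length m`, so the higher coefficients give the hypothesis for `s`; once `s` vanishes, the
  -- coefficient at `length m` is `a` itself.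
  monic-mul-small : ∀ m s → (∀ i → length m ≤ i → coef ((m ++ [ 1F ]) * s) i ≡ 0F) → s ≈ []
  monic-mul-small m [] _ = ≈-refl
  monic-mul-small m (a ∷ s) h = cons≈[] a≡0 s≈0
    where
    φ = m ++ [ 1F ]
    coef-expand : ∀ i → coef (φ * (a ∷ s)) i ≡ a *F coef φ i +F coef (0F ∷ φ * s) i
    coef-expand i = trans (at (*-cons φ a s) i) (trans (coef-add (a ·P φ) (0F ∷ φ * s) i) (cong (_+F coef (0F ∷ φ * s) i) (coef-·P a φ i)))
    s≈0 : s ≈ []
    s≈0 = monic-mul-small m s λ i le → begin
      coef (φ * s) i ≡⟨ 𝔽.+-identityˡ _ ⟨
      0F +F coef (φ * s) i ≡⟨ cong (_+F coef (φ * s) i) (trans (cong (a *F_) (coef-beyond φ (suc i) (subst (_≤ suc i) (sym (length-snoc m)) (s≤s le)))) (𝔽.zeroʳ a)) ⟨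
      a *F coef φ (suc i) +F coef (φ * s) i ≡⟨ coef-expand (suc i) ⟨
      coef (φ * (a ∷ s)) (suc i) ≡⟨ h (suc i) (ℕP.m≤n⇒m≤1+n le) ⟩
      0F ∎
      where open ≡-Reasoning
    a≡0 : a ≡ 0F
    a≡0 = begin
      a ≡⟨ 𝔽.*-identityʳ a ⟨
      a *F 1F ≡⟨ cong (a *F_) (coef-snoc m 1F) ⟨
      a *F coef φ (length m) ≡⟨ 𝔽.+-identityʳ _ ⟨
      a *F coef φ (length m) +F 0F ≡⟨ cong (a *F coef φ (length m) +F_) (at (cons≈[] {p = φ * s} refl (≈-trans (*-cong ≈-refl s≈0) (zeroʳ φ))) (length m)) ⟨
      a *F coef φ (length m) +F coef (0F ∷ φ * s) (length m) ≡⟨ coef-expand (length m) ⟨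
      coef (φ * (a ∷ s)) (length m) ≡⟨ h (length m) ℕP.≤-refl ⟩
      0F ∎
      where open ≡-Reasoning

  monic-∣-short : ∀ m {p} → length p ≤ length m → m ++ [ 1F ] ∣ p → p ≈ []
  monic-∣-short m {p} le (s , e) = ≈-trans e (≈-trans (*-cong ≈-refl
    (monic-mul-small m s λ i l → trans (sym (at e i)) (coef-beyond p i (ℕP.≤-trans le l)))) (zeroʳ (m ++ [ 1F ])))

  minus-zero : ∀ {s t} → s + neg1 * t ≈ [] → s ≈ t
  minus-zero {s} {t} z = begin
    s ≈⟨ +-identityʳ s ⟨
    s + [] ≈⟨ +-cong ≈-refl (neg1-cancel t) ⟨
    s + (t + neg1 * t) ≈⟨ solve 3 (λ s t n → s :+ (t :+ n :* t) := t :+ (s :+ n :* t)) ≈-refl s t neg1 ⟩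
    t + (s + neg1 * t) ≈⟨ +-cong ≈-refl z ⟩
    t + [] ≈⟨ +-identityʳ t ⟩
    t ∎
    where open ≈R

  monic-cancel : ∀ {m} → Monic m → ∀ {s t} → m * s ≈ m * t → s ≈ t
  monic-cancel {m} (m₀ , refl) {s} {t} e = minus-zero (monic-mul-small m₀ _ λ i _ → at (begin
      m * (s + neg1 * t) ≈⟨ solve 4 (λ m s t n → m :* (s :+ n :* t) := m :* s :+ n :* (m :* t)) ≈-refl m s t neg1 ⟩
      m * s + neg1 * (m * t) ≈⟨ +-cong e ≈-refl ⟩
      m * t + neg1 * (m * t) ≈⟨ neg1-cancel (m * t) ⟩
      [] ∎) i)
    where open ≈R

  unsnoc : ∀ d (p : Poly) → length p ≡ suc d → ∃ λ r → ∃ λ c → p ≡ r ++ [ c ] × length r ≡ d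
  unsnoc zero (a ∷ []) refl = [] , a , refl , refl
  unsnoc (suc d) (a ∷ p) l = let r , c , e , l′ = unsnoc d p (ℕP.suc-injective l) in a ∷ r , c , cong (a ∷_) e , cong suc l′

  pad : ℕ → Poly → Poly
  pad zero p = p
  pad (suc d) [] = 0F ∷ pad d []
  pad (suc d) (a ∷ p) = a ∷ pad d p

  pad-≈ : ∀ d p → p ≈ pad d p
  pad-≈ zero p = ≈-refl
  pad-≈ (suc d) [] = ≈-trans (≈-sym 0∷[]≈[]) (cons-cong refl (pad-≈ d []))
  pad-≈ (suc d) (a ∷ p) = cons-cong refl (pad-≈ d p)

  length-pad : ∀ d p → length p ≤ d → length (pad d p) ≡ d
  length-pad zero [] _ = refl
  length-pad (suc d) [] _ = cong suc (length-pad d [] z≤n)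
  length-pad (suc d) (a ∷ p) (s≤s le) = cong suc (length-pad d p le)

  reduce-lead : ∀ m r c → length r ≡ length m → ∃ λ r′ → length r′ ≡ length m × r ++ [ c ] ≈ c ·P (m ++ [ 1F ]) + r′
  reduce-lead [] [] c _ = [] , refl , coefs λ i → trans (sym (1c i)) (trans (sym (coef-·P c [ 1F ] i)) (sym (at (+-identityʳ (c ·P [ 1F ])) i)))
    where
    1c : ∀ i → c *F coef [ 1F ] i ≡ coef [ c ] i
    1c zero = 𝔽.*-identityʳ c
    1c (suc i) = 𝔽.zeroʳ c
  reduce-lead (x ∷ m) (y ∷ r) c l with reduce-lead m r c (ℕP.suc-injective l)
  ... | r′ , l′ , e = (y +F -F (c *F x)) ∷ r′ , cong suc l′ , coefs λ
    { zero → trans head (sym (trans (coef-add (c ·P (x ∷ m ++ [ 1F ])) _ 0) (cong (_+F (y +F -F (c *F x))) (coef-·P c (x ∷ m ++ [ 1F ]) 0))))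
    ; (suc i) → trans (at e i) (trans (trans (coef-add (c ·P (m ++ [ 1F ])) r′ i) (cong (_+F coef r′ i) (trans (coef-·P c (m ++ [ 1F ]) i) (sym (coef-·P c (x ∷ m ++ [ 1F ]) (suc i))))))
        (sym (coef-add (c ·P (x ∷ m ++ [ 1F ])) ((y +F -F (c *F x)) ∷ r′) (suc i)))) }
    where
    open ≡-Reasoning
    head : y ≡ c *F x +F (y +F -F (c *F x))
    head = begin
      y ≡⟨ 𝔽.+-identityʳ y ⟨
      y +F 0F ≡⟨ cong (y +F_) (𝔽.-‿inverseʳ (c *F x)) ⟨
      y +F (c *F x +F -F (c *F x)) ≡⟨ 𝔽.+-assoc _ _ _ ⟨
      y +F c *F x +F -F (c *F x) ≡⟨ cong (_+F -F (c *F x)) (𝔽.+-comm y _) ⟩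
      c *F x +F y +F -F (c *F x) ≡⟨ 𝔽.+-assoc _ _ _ ⟩
      c *F x +F (y +F -F (c *F x)) ∎

  -- In the manner of Horner: the remainder of the tail, shifted, has one coefficient too many, and
  -- `reduce-lead` trades its top entry `c` for the new lowest coefficient of the quotient.
  -- Remainders keep the exact length `length m`, which makes them canonical residues; the bound on
  -- the quotient serves the root count.
  divMod : ∀ m p → ∃ λ s → ∃ λ r → length r ≡ length m × length s ≤ length p ∸ length m × p ≈ (m ++ [ 1F ]) * s + r
  divMod m p with length p ℕP.≤? length m
  ... | yes le = [] , pad (length m) p , length-pad _ p le , z≤n ,
    ≈-sym (≈-trans (+-cong (zeroʳ (m ++ [ 1F ])) (≈-sym (pad-≈ (length m) p))) (ℙ.+-identityˡ p))
  divMod m [] | no ¬le = ⊥-elim (¬le z≤n)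
  divMod m (a ∷ p) | no ¬le with divMod m p
  ... | s , r , lr , ls , e with unsnoc (length m) (a ∷ r) (cong suc lr)
  ... | r₁ , c , e′ , l₁ with reduce-lead m r₁ c l₁
  ... | r₂ , l₂ , e₂ = c ∷ s , r₂ , l₂ ,
      subst (suc (length s) ≤_) (sym (ℕP.+-∸-assoc 1 (s≤s⁻¹ (ℕP.≰⇒> ¬le)))) (s≤s ls) ,
      (begin
        a ∷ p ≈⟨ cons-cong (sym (𝔽.+-identityˡ a)) e ⟩
        (0F +F a) ∷ (φ * s + r) ≡⟨ cons+cons 0F a (φ * s) r ⟨
        (0F ∷ φ * s) + (a ∷ r) ≡⟨ cong ((0F ∷ φ * s) +_) e′ ⟩
        (0F ∷ φ * s) + (r₁ ++ [ c ]) ≈⟨ +-cong ≈-refl e₂ ⟩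
        (0F ∷ φ * s) + (c ·P φ + r₂) ≈⟨ solve 3 (λ a b c → a :+ (b :+ c) := (b :+ a) :+ c) ≈-refl (0F ∷ φ * s) (c ·P φ) r₂ ⟩
        (c ·P φ + (0F ∷ φ * s)) + r₂ ≈⟨ +-cong (*-cons φ c s) ≈-refl ⟨
        φ * (c ∷ s) + r₂ ∎)
    where
    open ≈R
    φ = m ++ [ 1F ]

  normalize : ∀ p → p ≈ [] ⊎ ∃ λ p₀ → ∃ λ c → c ≢ 0F × p ≈ p₀ ++ [ c ] × length p₀ < length p
  normalize [] = inj₁ ≈-refl
  normalize (a ∷ p) with normalize p
  ... | inj₂ (p₀ , c , c≢0 , e , lt) = inj₂ (a ∷ p₀ , c , c≢0 , cons-cong refl e , s≤s lt)
  ... | inj₁ e with a ≟K 0F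
  ... | yes a≡0 = inj₁ (cons≈[] a≡0 e)
  ... | no a≢0 = inj₂ ([] , a , a≢0 , cons-cong refl e , s≤s z≤n)

  monicize : ∀ p → p ≈ [] ⊎ ∃ λ m → ∃ λ c → ∃ λ d → c *F d ≡ 1F × p ≈ c ·P (m ++ [ 1F ]) × m ++ [ 1F ] ≈ d ·P p × length m < length p
  monicize p with normalize p
  ... | inj₁ e = inj₁ e
  ... | inj₂ (p₀ , c , c≢0 , e , lt) with inverse c c≢0
  ... | d , cd = inj₂ (m , c , d , cd ,
        ≈-trans e (≈-trans (≈-sym (1·P _)) (≈-trans (ℙ.reflexive (cong (_·P (p₀ ++ [ c ])) (sym cd))) (≈-trans (≈-sym (·P-·P c d _)) (·P-cong (ℙ.reflexive (sym eq)))))) ,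
        ≈-trans (ℙ.reflexive eq) (·P-cong (≈-sym e)) ,
        subst (_< length p) (sym (length-map _ p₀)) lt)
    where
    m = scaleP d p₀
    eq : m ++ [ 1F ] ≡ d ·P (p₀ ++ [ c ])
    eq = trans (cong (λ z → m ++ [ z ]) (trans (sym cd) (𝔽.*-comm c d))) (trans (sym (map-++ (d *F_) p₀ [ c ])) (sym (·P-def d _)))

  ·P-const : ∀ a p → a ·P p ≈ [ a ] * p
  ·P-const a p = ≈-trans (≈-sym (*-constʳ p a)) (*-comm p [ a ])

  deg-snoc : ∀ (m : Poly) a → deg (m ++ [ a ]) ≡ length m
  deg-snoc m a = cong (_∸ 1) (length-snoc m)

  -- `MonicIrreducible` speaks of monic factors only. So the cofactor is made monic, comparison of
  -- leading coefficients shows its scalar `c` to be 1, and irreducibility leaves only a cofactor of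
  -- degree 0.
  irreducible-factor : ∀ {φ} → MonicIrreducible φ → ∀ m s → 1 ≤ length m → φ ≈ (m ++ [ 1F ]) * s → φ ≡ m ++ [ 1F ]
  irreducible-factor {φ} ((φ₀ , refl) , 1≤d , irr) m s 1≤m e with monicize s
  ... | inj₁ s≈0 = ⊥-elim (¬[]≈snoc φ₀ 1≢0 (≈-sym (≈-trans e (≈-trans (*-cong ≈-refl s≈0) (zeroʳ _)))))
  ... | inj₂ (s₀ , c , d , cd , es , _ , _) with mul-monic m s₀
  ... | t , et , _ = result s₀ refl
    where
    c≢0 : c ≢ 0F
    c≢0 refl = 1≢0 (trans (sym cd) (𝔽.zeroˡ d))
    eq : φ₀ ++ [ 1F ] ≈ c ·P (t ++ [ 1F ])
    eq = ≈-trans e (≈-trans (*-cong ≈-refl es) (≈-trans (·P-*ʳ _ c _) (·P-cong (ℙ.reflexive (trans (*-def _ _) et)))))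
    eq′ : φ₀ ++ [ 1F ] ≡ scaleP c t ++ [ c *F 1F ]
    eq′ = snoc-≈⇒≡ φ₀ (scaleP c t) 1≢0 (λ z → c≢0 (trans (sym (𝔽.*-identityʳ c)) z))
      (≈-trans eq (ℙ.reflexive (trans (·P-def c _) (map-++ (c *F_) t [ 1F ]))))
    c≡1 : c ≡ 1F
    c≡1 = trans (sym (𝔽.*-identityʳ c)) (sym (proj₂ (∷ʳ-injective φ₀ _ eq′)))
    eq″ : φ₀ ++ [ 1F ] ≡ t ++ [ 1F ]
    eq″ = trans eq′ (cong₂ (λ a b → a ++ [ b ]) (trans (cong (λ z → scaleP z t) c≡1) (scaleP-1≡ t)) (trans (𝔽.*-identityʳ c) c≡1))
    result : ∀ s₁ → s₁ ≡ s₀ → φ₀ ++ [ 1F ] ≡ m ++ [ 1F ]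
    result [] refl = snoc-≈⇒≡ φ₀ m 1≢0 1≢0 (≈-trans (ℙ.reflexive eq″) (≈-trans (ℙ.reflexive (trans (sym et) (sym (*-def _ _)))) (*-identityʳ _)))
    result (x ∷ s₁) refl = ⊥-elim (irr (m ++ [ 1F ]) (s₀ ++ [ 1F ]) (m , refl) (s₀ , refl)
      (subst (1 ≤_) (sym (deg-snoc m 1F)) 1≤m) (subst (1 ≤_) (sym (deg-snoc s₀ 1F)) (s≤s z≤n)) (trans et (sym eq″)))

  -- A Bezout identity, because the identities of two factors multiply to one for their product.
  Coprime : Poly → Poly → Set
  Coprime a b = ∃ λ u → ∃ λ v → u * a + v * b ≈ [ 1F ]

  coprime-sym : ∀ {a b} → Coprime a b → Coprime b a
  coprime-sym {a} {b} (u , v , e) = v , u , ≈-trans (ℙ.+-comm (v * b) (u * a)) e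

  module _ {φ : Poly} (irr : MonicIrreducible φ) where
    private
      φ₀ = proj₁ (proj₁ irr)
      φ≡ : φ ≡ φ₀ ++ [ 1F ]
      φ≡ = proj₂ (proj₁ irr)

      -- Euclid's algorithm on monic combinations of `p` and `φ` of degree below `deg φ`. A zero
      -- remainder would make `m ++ [ 1F ]` equal to `φ` by irreducibility, against the degree; a
      -- nonzero one is again such a combination, of smaller degree, until the constant 1 is
      -- reached. `k` is only a bound on the number of steps.
      euclid : ∀ k m p → length m < k → length m < length φ₀ → (∃ λ u → ∃ λ v → u * p + v * φ ≈ m ++ [ 1F ]) → Coprime p φ
      euclid (suc k) [] p lt lt′ c = c
      euclid (suc k) m@(_ ∷ _) p (s≤s lt) lt′ (u , v , e) with divMod m φ
      ... | s , r , lr , _ , eφ with monicize r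
      ... | inj₁ r≈0 = ⊥-elim (ℕP.<-irrefl (trans (sym (ℕP.suc-injective (trans (sym (length-snoc φ₀)) (trans (cong length (trans (sym φ≡)
              (irreducible-factor irr m s (s≤s z≤n) (≈-trans eφ (≈-trans (+-cong ≈-refl r≈0) (+-identityʳ _)))))) (length-snoc m))))) refl) lt′)
      ... | inj₂ (r₀ , c , d , cd , _ , er , l<) = euclid k r₀ p (ℕP.<-≤-trans (subst (length r₀ <_) lr l<) lt)
              (ℕP.<-trans (subst (length r₀ <_) lr l<) lt′)
              ([ d ] * (neg1 * s * u) , [ d ] * ([ 1F ] + neg1 * s * v) , (begin
                [ d ] * (neg1 * s * u) * p + [ d ] * ([ 1F ] + neg1 * s * v) * φ
                  ≈⟨ solve 7 (λ d n s u p v φ → d :* (n :* s :* u) :* p :+ d :* (con 1 :+ n :* s :* v) :* φ := d :* (φ :+ n :* (s :* (u :* p :+ v :* φ)))) ≈-refl [ d ] neg1 s u p v φ ⟩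
                [ d ] * (φ + neg1 * (s * (u * p + v * φ))) ≈⟨ *-cong ≈-refl (+-cong ≈-refl (*-cong ≈-refl (≈-trans (*-cong ≈-refl e) (*-comm s _)))) ⟩
                [ d ] * (φ + neg1 * ((m ++ [ 1F ]) * s)) ≈⟨ *-cong ≈-refl (subtract (≈-sym eφ)) ⟨
                [ d ] * r ≈⟨ ·P-const d r ⟨
                d ·P r ≈⟨ er ⟨
                r₀ ++ [ 1F ] ∎))
        where open ≈R

    bezout : ∀ p → φ ∣ p ⊎ Coprime p φ
    bezout p with divMod φ₀ p
    ... | s , r , lr , _ , e with monicize r
    ... | inj₁ r≈0 = inj₁ (s , ≈-trans e (≈-trans (+-cong ≈-refl r≈0) (≈-trans (+-identityʳ _) (*-cong (ℙ.reflexive (sym φ≡)) ≈-refl))))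
    ... | inj₂ (r₀ , c , d , cd , _ , er , l<) = inj₂ (euclid (suc (length r₀)) r₀ p ℕP.≤-refl (subst (length r₀ <_) lr l<)
          ([ d ] , [ d ] * (neg1 * s) , (begin
            [ d ] * p + [ d ] * (neg1 * s) * φ ≈⟨ solve 5 (λ d p n s φ → d :* p :+ d :* (n :* s) :* φ := d :* (p :+ n :* (φ :* s))) ≈-refl [ d ] p neg1 s φ ⟩
            [ d ] * (p + neg1 * (φ * s)) ≈⟨ *-cong ≈-refl (+-cong ≈-refl (*-cong ≈-refl (*-cong (ℙ.reflexive φ≡) ≈-refl))) ⟩
            [ d ] * (p + neg1 * ((φ₀ ++ [ 1F ]) * s)) ≈⟨ *-cong ≈-refl (subtract (≈-sym e)) ⟨
            [ d ] * r ≈⟨ ·P-const d r ⟨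
            d ·P r ≈⟨ er ⟨
            r₀ ++ [ 1F ] ∎)))
      where open ≈R

    irreducible-∤1 : ¬ (φ ∣ [ 1F ])
    irreducible-∤1 h = ¬[]≈snoc [] 1≢0 (≈-sym (monic-∣-short φ₀ 1≤ (∣-respˡ (ℙ.reflexive φ≡) h)))
      where
      1≤ : 1 ≤ length φ₀
      1≤ = subst (1 ≤_) (trans (cong deg φ≡) (deg-snoc φ₀ 1F)) (proj₁ (proj₂ irr))

    coprime-∤ : ∀ {p} → Coprime p φ → ¬ (φ ∣ p)
    coprime-∤ (u , v , e) h = irreducible-∤1 (∣-resp e (∣-+ (∣-*ˡ u h) (∣-*ˡ v ∣-refl)))

    ∣? : ∀ p → Dec (φ ∣ p)
    ∣? p with bezout p
    ... | inj₁ h = yes h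
    ... | inj₂ c = no (coprime-∤ c)

  coprime-∣ : ∀ {a b c} → Coprime b a → a ∣ b * c → a ∣ c
  coprime-∣ {a} {b} {c} (u , v , e) h = ∣-resp (begin
    u * (b * c) + v * c * a ≈⟨ solve 5 (λ u b c v a → u :* (b :* c) :+ v :* c :* a := (u :* b :+ v :* a) :* c) ≈-refl u b c v a ⟩
    (u * b + v * a) * c ≈⟨ *-cong e ≈-refl ⟩
    [ 1F ] * c ≈⟨ *-identityˡ c ⟩
    c ∎) (∣-+ (∣-*ˡ u h) (∣-*ˡ (v * c) ∣-refl))
    where open ≈R

  irreducible-prime : ∀ {φ} → MonicIrreducible φ → ∀ {p r} → φ ∣ p * r → φ ∣ p ⊎ φ ∣ r
  irreducible-prime irr {p} h with bezout irr p
  ... | inj₁ d = inj₁ d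
  ... | inj₂ c = inj₂ (coprime-∣ c h)

  coprime-* : ∀ {a b c} → Coprime a c → Coprime b c → Coprime (a * b) c
  coprime-* {a} {b} {c} (u , v , e) (u′ , v′ , e′) = u * u′ , u * a * v′ + v * (u′ * b) + v * v′ * c , (begin
    u * u′ * (a * b) + (u * a * v′ + v * (u′ * b) + v * v′ * c) * c
      ≈⟨ solve 7 (λ u u′ a b v v′ c → u :* u′ :* (a :* b) :+ (u :* a :* v′ :+ v :* (u′ :* b) :+ v :* v′ :* c) :* c := (u :* a :+ v :* c) :* (u′ :* b :+ v′ :* c)) ≈-refl u u′ a b v v′ c ⟩
    (u * a + v * c) * (u′ * b + v′ * c) ≈⟨ *-cong e e′ ⟩
    [ 1F ] * [ 1F ] ≈⟨ *-identityˡ _ ⟩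
    [ 1F ] ∎)
    where open ≈R

  coprime-1 : ∀ {c} → Coprime [ 1F ] c
  coprime-1 {c} = [ 1F ] , [] , ≈-trans (+-cong (*-identityˡ _) (ℙ.zeroˡ c)) (+-identityʳ _)

  coprime-pow : ∀ {a c} k → Coprime a c → Coprime (polyPow a k) c
  coprime-pow zero h = coprime-1
  coprime-pow {a} {c} (suc k) h = subst (λ z → Coprime z c) (sym (pow-suc a k)) (coprime-* h (coprime-pow k h))

  coprime-pows : ∀ {a c} k l → Coprime a c → Coprime (polyPow a k) (polyPow c l)
  coprime-pows k l h = coprime-pow k (coprime-sym (coprime-pow l (coprime-sym h)))

  distinct-coprime : ∀ {φ ψ} → MonicIrreducible φ → MonicIrreducible ψ → φ ≢ ψ → Coprime φ ψ
  distinct-coprime {φ} {ψ} iφ@((φ₀ , refl) , 1≤ , _) iψ ne with bezout iψ φ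
  ... | inj₂ c = c
  ... | inj₁ (s , e) with iψ
  ... | (ψ₀ , refl) , 1≤ψ , _ = ⊥-elim (ne (irreducible-factor iφ ψ₀ s (subst (1 ≤_) (deg-snoc ψ₀ 1F) 1≤ψ) e))

-- Fermat's theorem in residue fields, simple roots, Chinese remainders.

module Roots {q : ℕ} (F : FiniteField q) where
  open import Data.Nat.Base as ℕ using (zero; suc; _≤_; z≤n; s≤s; _∸_; _⊔_; _^_)
  import Data.Nat.Properties as ℕP
  open import Data.Fin.Base using (Fin)
  open import Data.Fin.Properties using () renaming (_≟_ to _≟K_)
  open import Data.List.Base using (List; []; _∷_; _++_; length; map; [_]; allFin; foldr)
  open import Data.List.Properties using (length-tabulate; length-map; ≡-dec)
  open import Data.List.Relation.Unary.All as All using (All; []; _∷_)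
  open import Data.List.Relation.Unary.Any using (here; there)
  open import Data.List.Relation.Unary.AllPairs using (AllPairs; []; _∷_)
  open import Data.List.Relation.Unary.Unique.Propositional using (Unique)
  import Data.List.Relation.Unary.Unique.Propositional.Properties as Uniq
  open import Data.List.Membership.Propositional using (_∈_)
  open import Data.List.Membership.Propositional.Properties using (∈-allFin; ∈-map⁺; ∈-map⁻)
  open import Data.List.Relation.Binary.Permutation.Propositional using (_↭_; refl; prep; swap; trans)
  open import Data.List.Relation.Binary.BagAndSetEquality using (∼bag⇒↭)
  open import Data.List.Membership.Propositional.Properties.WithK using (unique∧set⇒bag)
  open import Data.Product using (∃; _×_; _,_; proj₁; proj₂)
  open import Data.Sum using (_⊎_; inj₁; inj₂)
  open import Data.Unit using (⊤; tt)
  open import Data.Empty using (⊥; ⊥-elim)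
  open import Function.Bundles using (mk⇔)
  open import Relation.Nullary
  open import Relation.Binary.PropositionalEquality as ≡ using (_≡_; cong; cong₂; subst; subst₂; sym)
  open Counting
  open PolyRing F
  open PolyArith F
  open LinAlg F hiding (_⊕_)
  open ℙ using (+-cong; *-cong; *-comm; *-assoc; +-identityʳ; zeroʳ; *-identityʳ; *-identityˡ)
  open ℙSolver using (solve; _:=_; _:+_; _:*_; con)
  import Relation.Binary.Reasoning.Setoid ℙ.setoid as ≈R

  comp : Poly → Poly → Poly
  comp [] P = []
  comp (c ∷ p) P = [ c ] + P * comp p P

  opaque
    unfolding _+_

    neg1-def : neg1 ≡ [ -F 1F ]
    neg1-def = ≡.refl

    const-+ : ∀ a b → [ a ] + [ b ] ≡ [ a +F b ]
    const-+ a b = ≡.refl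

    const-* : ∀ a b → [ a ] * [ b ] ≈ [ a *F b ]
    const-* a b = cons-cong (𝔽.+-identityʳ _) ≈-refl

  0ₚ : [ 0F ] ≈ []
  0ₚ = 0∷[]≈[]

  comp-[] : ∀ p P → p ≈ [] → comp p P ≈ []
  comp-[] [] P e = ≈-refl
  comp-[] (c ∷ p) P e = ≈-trans (+-cong (cons≈[] (at e 0) ≈-refl)
    (≈-trans (*-cong ≈-refl (comp-[] p P (coefs λ i → at e (suc i)))) (zeroʳ P))) (+-identityʳ [])

  comp-cong : ∀ p r P → p ≈ r → comp p P ≈ comp r P
  comp-cong [] r P e = ≈-sym (comp-[] r P (≈-sym e))
  comp-cong (c ∷ p) [] P e = comp-[] (c ∷ p) P e
  comp-cong (c ∷ p) (d ∷ r) P e = +-cong (cons-cong (at e 0) ≈-refl) (*-cong ≈-refl (comp-cong p r P (coefs λ i → at e (suc i))))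

  comp-arg : ∀ p {P Q} → P ≈ Q → comp p P ≈ comp p Q
  comp-arg [] _ = ≈-refl
  comp-arg (a ∷ p) e = +-cong ≈-refl (*-cong e (comp-arg p e))

  comp-polyAdd : ∀ p r P → comp (polyAdd p r) P ≈ comp p P + comp r P
  comp-polyAdd [] r P = ≈-sym (ℙ.+-identityˡ _)
  comp-polyAdd (a ∷ p) [] P = ≈-sym (+-identityʳ _)
  comp-polyAdd (a ∷ p) (b ∷ r) P = begin
    [ a +F b ] + P * comp (polyAdd p r) P ≈⟨ +-cong (ℙ.reflexive (sym (const-+ a b))) (*-cong ≈-refl (comp-polyAdd p r P)) ⟩
    ([ a ] + [ b ]) + P * (comp p P + comp r P)
      ≈⟨ solve 5 (λ a b P x y → (a :+ b) :+ P :* (x :+ y) := (a :+ P :* x) :+ (b :+ P :* y)) ≈-refl [ a ] [ b ] P (comp p P) (comp r P) ⟩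
    ([ a ] + P * comp p P) + ([ b ] + P * comp r P) ∎
    where open ≈R

  comp-+ : ∀ p r P → comp (p + r) P ≈ comp p P + comp r P
  comp-+ p r P = subst (λ z → comp z P ≈ comp p P + comp r P) (sym (+-def p r)) (comp-polyAdd p r P)

  comp-scaleP : ∀ a p P → comp (scaleP a p) P ≈ [ a ] * comp p P
  comp-scaleP a [] P = ≈-sym (zeroʳ [ a ])
  comp-scaleP a (b ∷ p) P = begin
    [ a *F b ] + P * comp (scaleP a p) P ≈⟨ +-cong (≈-sym (const-* a b)) (*-cong ≈-refl (comp-scaleP a p P)) ⟩
    [ a ] * [ b ] + P * ([ a ] * comp p P) ≈⟨ solve 4 (λ a b P x → a :* b :+ P :* (a :* x) := a :* (b :+ P :* x)) ≈-refl [ a ] [ b ] P (comp p P) ⟩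
    [ a ] * ([ b ] + P * comp p P) ∎
    where open ≈R

  comp-shift : ∀ p P → comp (0F ∷ p) P ≈ P * comp p P
  comp-shift p P = ≈-trans (+-cong 0ₚ ≈-refl) (ℙ.+-identityˡ _)

  comp-polyMul : ∀ p r P → comp (polyMul p r) P ≈ comp p P * comp r P
  comp-polyMul [] r P = ≈-sym (ℙ.zeroˡ _)
  comp-polyMul (a ∷ p) r P = begin
    comp (polyAdd (scaleP a r) (0F ∷ polyMul p r)) P ≈⟨ comp-polyAdd (scaleP a r) (0F ∷ polyMul p r) P ⟩
    comp (scaleP a r) P + comp (0F ∷ polyMul p r) P ≈⟨ +-cong (comp-scaleP a r P) (≈-trans (comp-shift (polyMul p r) P) (*-cong ≈-refl (comp-polyMul p r P))) ⟩
    [ a ] * comp r P + P * (comp p P * comp r P) ≈⟨ solve 4 (λ a r P x → a :* r :+ P :* (x :* r) := (a :+ P :* x) :* r) ≈-refl [ a ] (comp r P) P (comp p P) ⟩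
    ([ a ] + P * comp p P) * comp r P ∎
    where open ≈R

  comp-* : ∀ p r P → comp (p * r) P ≈ comp p P * comp r P
  comp-* p r P = subst (λ z → comp z P ≈ comp p P * comp r P) (sym (*-def p r)) (comp-polyMul p r P)

  comp-const : ∀ a P → comp [ a ] P ≈ [ a ]
  comp-const a P = ≈-trans (+-cong ≈-refl (zeroʳ P)) (+-identityʳ _)

  comp-X : ∀ P → comp Xpoly P ≈ P
  comp-X P = ≈-trans (comp-shift [ 1F ] P) (≈-trans (*-cong ≈-refl (comp-const 1F P)) (*-identityʳ P))

  comp-pow : ∀ p k P → comp (polyPow p k) P ≈ polyPow (comp p P) k
  comp-pow p zero P = comp-const 1F P
  comp-pow p (suc k) P = ≈-trans (comp-polyMul p (polyPow p k) P)
    (≈-trans (*-cong ≈-refl (comp-pow p k P)) (ℙ.reflexive (sym (pow-suc (comp p P) k))))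

  comp-congruent : ∀ p P d s → ∃ λ t → comp p (P + d * s) ≈ comp p P + d * t
  comp-congruent [] P d s = [] , ≈-sym (≈-trans (ℙ.+-identityˡ _) (zeroʳ d))
  comp-congruent (c ∷ p) P d s with comp-congruent p P d s
  ... | t , e = P * t + s * comp p P + d * s * t , (begin
    [ c ] + (P + d * s) * comp p (P + d * s) ≈⟨ +-cong ≈-refl (*-cong ≈-refl e) ⟩
    [ c ] + (P + d * s) * (comp p P + d * t)
      ≈⟨ solve 6 (λ c P d s x t → c :+ (P :+ d :* s) :* (x :+ d :* t) := (c :+ P :* x) :+ d :* (P :* t :+ s :* x :+ d :* s :* t)) ≈-refl [ c ] P d s (comp p P) t ⟩
    ([ c ] + P * comp p P) + d * (P * t + s * comp p P + d * s * t) ∎)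
    where open ≈R

  pow-cong : ∀ {p r} k → p ≈ r → polyPow p k ≈ polyPow r k
  pow-cong zero e = ≈-refl
  pow-cong {p} {r} (suc k) e = ≈-trans (ℙ.reflexive (pow-suc p k)) (≈-trans (*-cong e (pow-cong k e)) (ℙ.reflexive (sym (pow-suc r k))))

  -- Polynomials in a second variable with coefficients in the polynomial ring. Read modulo `φ` they
  -- are the polynomials over the residue field whose roots are to be counted.
  eval : List Poly → Poly → Poly
  eval [] x = []
  eval (c ∷ cs) x = c + x * eval cs x

  -- Synthetic division: the quotient of `cs` by T - `a`. In `eval-synth` the variable T is written
  -- as `a + d`, so that the linear factor is simply `d`.
  synth : List Poly → Poly → List Poly
  synth [] a = []
  synth (c ∷ []) a = []
  synth (c ∷ cs@(_ ∷ _)) a = eval cs a ∷ synth cs a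

  length-synth : ∀ cs a {k} → length cs ≤ suc k → length (synth cs a) ≤ k
  length-synth [] a _ = z≤n
  length-synth (c ∷ []) a _ = z≤n
  length-synth (c ∷ cs@(_ ∷ _)) a {suc k} (s≤s le) = s≤s (length-synth cs a le)

  eval-synth : ∀ cs a d → eval cs (a + d) ≈ eval cs a + d * eval (synth cs a) (a + d)
  eval-synth [] a d = ≈-sym (≈-trans (ℙ.+-identityˡ _) (zeroʳ d))
  eval-synth (c ∷ []) a d = ≈-trans (+-cong ≈-refl (≈-trans (zeroʳ (a + d)) (≈-sym (zeroʳ a)))) (≈-trans (≈-sym (+-identityʳ _)) (+-cong ≈-refl (≈-sym (zeroʳ d))))
  eval-synth (c ∷ cs@(_ ∷ _)) a d = begin
    c + (a + d) * eval cs (a + d) ≈⟨ +-cong ≈-refl (≈-trans (ℙ.distribʳ _ a d) (+-cong (*-cong ≈-refl (eval-synth cs a d)) (*-cong ≈-refl (eval-synth cs a d)))) ⟩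
    c + (a * (x + d * y) + d * (x + d * y)) ≈⟨ solve 5 (λ c a d x y → c :+ (a :* (x :+ d :* y) :+ d :* (x :+ d :* y)) := c :+ a :* x :+ d :* (x :+ (a :+ d) :* y)) ≈-refl c a d x y ⟩
    c + a * x + d * (x + (a + d) * y) ∎
    where
    open ≈R
    x = eval cs a
    y = eval (synth cs a) (a + d)

  eval-cong : ∀ cs {x y} → x ≈ y → eval cs x ≈ eval cs y
  eval-cong [] e = ≈-refl
  eval-cong (c ∷ cs) e = +-cong ≈-refl (*-cong e (eval-cong cs e))

  add-back : ∀ x y → x + (y + neg1 * x) ≈ y
  add-back x y = ≈-trans (solve 3 (λ x y n → x :+ (y :+ n :* x) := y :+ (x :+ n :* x)) ≈-refl x y neg1)
    (≈-trans (+-cong ≈-refl (neg1-cancel x)) (+-identityʳ y))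

  module _ {φ : Poly} (irr : MonicIrreducible φ) where

    synth-zero : ∀ cs a → All (φ ∣_) (synth cs a) → φ ∣ eval cs a → All (φ ∣_) cs
    synth-zero [] a _ _ = []
    synth-zero (c ∷ []) a _ h = ∣-resp (≈-trans (+-cong ≈-refl (zeroʳ a)) (+-identityʳ c)) h ∷ []
    synth-zero (c ∷ cs@(_ ∷ _)) a (h ∷ hs) k = ∣-cancel (∣-resp (ℙ.+-comm c _) k) (∣-*ˡ a h) ∷ synth-zero cs a hs h

    -- The first root `a` is split off by synthetic division. At another point `b` the factor
    -- `b - a` is not divisible by `φ`, so primality hands the root on to the quotient, which is one
    -- coefficient shorter.
    root-bound : ∀ pts cs → AllPairs (λ x y → ¬ (φ ∣ y + neg1 * x)) pts → length cs ≤ length pts →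
      All (λ x → φ ∣ eval cs x) pts → All (φ ∣_) cs
    root-bound [] [] _ _ _ = []
    root-bound (a ∷ pts) cs (n ∷ ns) le (h ∷ hs) = synth-zero cs a (root-bound pts (synth cs a) ns (length-synth cs a le)
      (All.tabulate λ {b} b∈ → case-prime (irreducible-prime irr (∣-cancel (∣-resp
          (≈-trans (eval-cong cs (≈-sym (add-back a b))) (≈-trans (eval-synth cs a (b + neg1 * a))
            (+-cong ≈-refl (*-cong ≈-refl (eval-cong (synth cs a) (add-back a b)))))) (All.lookup hs b∈)) h)) (All.lookup n b∈))) h
      where
      case-prime : ∀ {A B : Set} → A ⊎ B → ¬ A → B
      case-prime (inj₁ a) n = ⊥-elim (n a)
      case-prime (inj₂ b) n = b

  size-K : HasSize {K} (λ _ → ⊤) q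
  size-K = allFin q , Uniq.allFin⁺ q , (λ _ _ → tt) , (λ x _ → ∈-allFin x) , length-tabulate (λ x → x)

  size-length : ∀ d → HasSize (λ (p : Poly) → length p ≡ d) (q ^ d)
  size-length d = size-⇔ (λ _ → proj₁) (λ p l → l , All.universal (λ _ → tt) p) (size-lists size-K d)

  _≟P_ : (p r : Poly) → Dec (p ≡ r)
  _≟P_ = ≡-dec _≟K_

  prodP : List Poly → Poly
  prodP = foldr _*_ [ 1F ]

  prodP-↭ : ∀ {xs ys} → xs ↭ ys → prodP xs ≈ prodP ys
  prodP-↭ refl = ≈-refl
  prodP-↭ (prep x p) = *-cong ≈-refl (prodP-↭ p)
  prodP-↭ (swap x y p) = ≈-trans (exchange x y _) (*-cong ≈-refl (*-cong ≈-refl (prodP-↭ p)))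
    where
    exchange : ∀ x y z → x * (y * z) ≈ y * (x * z)
    exchange = solve 3 (λ x y z → x :* (y :* z) := y :* (x :* z)) ≈-refl
  prodP-↭ (trans p r) = ≈-trans (prodP-↭ p) (prodP-↭ r)

  same-members⇒↭ : ∀ {A : Set} {xs ys : List A} → Unique xs → Unique ys → (∀ x → x ∈ xs → x ∈ ys) → (∀ x → x ∈ ys → x ∈ xs) → xs ↭ ys
  same-members⇒↭ u v f g = ∼bag⇒↭ (unique∧set⇒bag u v (λ {x} → mk⇔ (f x) (g x)))

  length-polyAdd : ∀ p r → length (polyAdd p r) ≡ length p ⊔ length r
  length-polyAdd [] r = ≡.refl
  length-polyAdd (_ ∷ p) [] = ≡.refl
  length-polyAdd (_ ∷ p) (_ ∷ r) = cong suc (length-polyAdd p r)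

  -- The difference has at most `deg φ` coefficients, too few for a nonzero multiple of the monic
  -- `φ`. Hence lists of this length are canonical representatives modulo `φ`.
  difference-short : ∀ {φ} → Monic φ → ∀ x y → length x ≡ deg φ → length y ≡ deg φ → φ ∣ y + neg1 * x → x ≡ y
  difference-short {φ} (m , ≡.refl) x y lx ly h = ≈⇒≡ x y (≡.trans lx (sym ly)) (≈-sym (minus-zero z))
    where
    opaque
      unfolding _+_
      len : length (y + scaleP (-F 1F) x) ≡ length m
      len = ≡.trans (length-polyAdd y (scaleP (-F 1F) x)) (≡.trans (cong₂ _⊔_ ly (≡.trans (length-map _ x) lx))
              (≡.trans (ℕP.⊔-idem _) (deg-snoc m 1F)))
    e : neg1 * x ≈ scaleP (-F 1F) x
    e = ≈-trans (*-cong (ℙ.reflexive neg1-def) ≈-refl) (≈-trans (*-comm _ x) (≈-trans (*-constʳ x _) (ℙ.reflexive (·P-def _ x))))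
    z : y + neg1 * x ≈ []
    z = ≈-trans (+-cong ≈-refl e) (monic-∣-short m (ℕP.≤-reflexive len) (∣-resp (+-cong ≈-refl e) h))

  inhabited : ∀ {n} → Fin n → 1 ≤ n
  inhabited Fin.zero = s≤s z≤n
  inhabited (Fin.suc _) = s≤s z≤n

  q>0 : ∀ d → 1 ≤ q ^ d
  q>0 d = ℕP.m^n>0 q {{ℕ.>-nonZero (inhabited 0F)}} d

  -- Multiplication by x permutes the nonzero residues modulo φ.
  module _ {φ : Poly} (irr : MonicIrreducible φ) where
    private
      N = q ^ deg φ
      φ₀ = proj₁ (proj₁ irr)
      φ≡ : φ ≡ φ₀ ++ [ 1F ]
      φ≡ = proj₂ (proj₁ irr)
      d≡ : deg φ ≡ length φ₀
      d≡ = ≡.trans (cong deg φ≡) (deg-snoc φ₀ 1F)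

      rem : Poly → Poly
      rem p = proj₁ (proj₂ (divMod φ₀ p))

      length-rem : ∀ p → length (rem p) ≡ deg φ
      length-rem p = ≡.trans (proj₁ (proj₂ (proj₂ (divMod φ₀ p)))) (sym d≡)

      rem-≈ : ∀ p → p ≈ φ * proj₁ (divMod φ₀ p) + rem p
      rem-≈ p = ≈-trans (proj₂ (proj₂ (proj₂ (proj₂ (divMod φ₀ p))))) (+-cong (*-cong (ℙ.reflexive (sym φ≡)) ≈-refl) ≈-refl)

      Res : Poly → Set
      Res r = length r ≡ deg φ × ¬ (φ ∣ r)

      residues : ∃ λ k → HasSize Res k
      residues = size-filter (λ r → ¬? (∣? irr r)) (size-length (deg φ))

      residue-count : ∀ k → HasSize Res k → suc k ≡ N
      residue-count k h = ≡.trans (cong suc (size-unique h (size-diff (∣? irr) (size-length (deg φ)) zero-size))) (ℕP.m+[n∸m]≡n (q>0 (deg φ)))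
        where
        zero-size : HasSize (λ r → length r ≡ deg φ × φ ∣ r) 1
        zero-size = [ pad (deg φ) [] ] , ([] ∷ []) ,
          (λ { _ (here ≡.refl) → length-pad (deg φ) [] z≤n , ∣-resp (pad-≈ (deg φ) []) ∣-zero }) ,
          (λ { r (l , h) → here (≈⇒≡ r _ (≡.trans l (sym (length-pad (deg φ) [] z≤n)))
              (≈-trans (monic-∣-short φ₀ (ℕP.≤-reflexive (≡.trans l d≡)) (∣-respˡ (ℙ.reflexive φ≡) h)) (pad-≈ (deg φ) []))) }) , ≡.refl

      module _ (x : Poly) (φ∤x : ¬ (φ ∣ x)) where
        f : Poly → Poly
        f r = rem (x * r)

        f-Res : ∀ r → Res r → Res (f r)
        f-Res r (l , n) = length-rem (x * r) , λ h → no-factor (irreducible-prime irr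
            (∣-resp (≈-sym (rem-≈ (x * r))) (∣-+ (_ , ≈-refl) h)))
          where
          no-factor : φ ∣ x ⊎ φ ∣ r → ⊥
          no-factor (inj₁ h) = φ∤x h
          no-factor (inj₂ h) = n h

        f-injective : ∀ r r′ → Res r → Res r′ → f r ≡ f r′ → r ≡ r′
        f-injective r r′ (l , _) (l′ , _) e = difference-short (proj₁ irr) r r′ l l′ (cancel (irreducible-prime irr
            (∣-resp (begin
              φ * s′ + neg1 * (φ * s) ≈⟨ +-identityʳ _ ⟨
              (φ * s′ + neg1 * (φ * s)) + [] ≈⟨ +-cong ≈-refl (neg1-cancel (f r)) ⟨
              (φ * s′ + neg1 * (φ * s)) + (f r + neg1 * f r) ≡⟨ cong (λ z → (φ * s′ + neg1 * (φ * s)) + (z + neg1 * f r)) e ⟩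
              (φ * s′ + neg1 * (φ * s)) + (f r′ + neg1 * f r)
                ≈⟨ solve 5 (λ a b c e n → (a :+ n :* b) :+ (c :+ n :* e) := (a :+ c) :+ n :* (b :+ e)) ≈-refl (φ * s′) (φ * s) (f r′) (f r) neg1 ⟩
              (φ * s′ + f r′) + neg1 * (φ * s + f r) ≈⟨ +-cong (rem-≈ (x * r′)) (*-cong ≈-refl (rem-≈ (x * r))) ⟨
              x * r′ + neg1 * (x * r) ≈⟨ solve 4 (λ x r r′ n → x :* r′ :+ n :* (x :* r) := x :* (r′ :+ n :* r)) ≈-refl x r r′ neg1 ⟩
              x * (r′ + neg1 * r) ∎)
              (∣-+ (s′ , ≈-refl) (∣-*ˡ neg1 (s , ≈-refl))))))
          where
          open ≈R
          s = proj₁ (divMod φ₀ (x * r))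
          s′ = proj₁ (divMod φ₀ (x * r′))
          cancel : φ ∣ x ⊎ φ ∣ r′ + neg1 * r → φ ∣ r′ + neg1 * r
          cancel (inj₁ h) = ⊥-elim (φ∤x h)
          cancel (inj₂ h) = h

        product-step : ∀ rs → ∃ λ s → polyPow x (length rs) * prodP rs ≈ prodP (map f rs) + φ * s
        product-step [] = [] , ≈-trans (*-identityˡ _) (≈-sym (≈-trans (+-cong ≈-refl (zeroʳ φ)) (+-identityʳ _)))
        product-step (r ∷ rs) with product-step rs
        ... | s , e = s₁ * R + s₁ * φ * s + f r * s , (begin
          polyPow x (suc (length rs)) * (r * prodP rs) ≡⟨ cong (_* (r * prodP rs)) (pow-suc x (length rs)) ⟩
          x * X * (r * prodP rs) ≈⟨ solve 4 (λ x X r p → x :* X :* (r :* p) := (x :* r) :* (X :* p)) ≈-refl x X r (prodP rs) ⟩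
          (x * r) * (X * prodP rs) ≈⟨ *-cong (rem-≈ (x * r)) e ⟩
          (φ * s₁ + f r) * (R + φ * s)
            ≈⟨ solve 5 (λ φ s₁ f R s → (φ :* s₁ :+ f) :* (R :+ φ :* s) := f :* R :+ φ :* (s₁ :* R :+ s₁ :* φ :* s :+ f :* s)) ≈-refl φ s₁ (f r) R s ⟩
          f r * R + φ * (s₁ * R + s₁ * φ * s + f r * s) ∎)
          where
          open ≈R
          X = polyPow x (length rs)
          R = prodP (map f rs)
          s₁ = proj₁ (divMod φ₀ (x * r))

        φ∤prodP : ∀ rs → (∀ r → r ∈ rs → Res r) → ¬ (φ ∣ prodP rs)
        φ∤prodP [] _ h = irreducible-∤1 irr h
        φ∤prodP (r ∷ rs) res h with irreducible-prime irr h
        ... | inj₁ k = proj₂ (res r (here ≡.refl)) k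
        ... | inj₂ k = φ∤prodP rs (λ z z∈ → res z (there z∈)) k

        -- The product of all nonzero residues is unchanged modulo `φ` when each factor is
        -- multiplied by `x`, yet acquires `x ^ k`; it can be cancelled because the prime `φ`
        -- divides none of its factors.
        unit-power : ∀ k → HasSize Res k → φ ∣ polyPow x k + neg1
        unit-power k hs@(rs , u , p , c , ≡.refl) with product-step rs
        ... | s , e = cancel (irreducible-prime irr (s , (begin
            prodP rs * (polyPow x k + neg1) ≈⟨ solve 3 (λ r x n → r :* (x :+ n) := x :* r :+ n :* r) ≈-refl (prodP rs) (polyPow x k) neg1 ⟩
            polyPow x k * prodP rs + neg1 * prodP rs ≈⟨ +-cong e ≈-refl ⟩
            (prodP (map f rs) + φ * s) + neg1 * prodP rs ≈⟨ +-cong (+-cong (prodP-↭ perm) ≈-refl) ≈-refl ⟩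
            (prodP rs + φ * s) + neg1 * prodP rs ≈⟨ solve 3 (λ r t n → (r :+ t) :+ n :* r := t :+ (r :+ n :* r)) ≈-refl (prodP rs) (φ * s) neg1 ⟩
            φ * s + (prodP rs + neg1 * prodP rs) ≈⟨ +-cong ≈-refl (neg1-cancel _) ⟩
            φ * s + [] ≈⟨ +-identityʳ _ ⟩
            φ * s ∎)))
          where
          open ≈R
          cancel : φ ∣ prodP rs ⊎ φ ∣ polyPow x k + neg1 → φ ∣ polyPow x k + neg1
          cancel (inj₁ h) = ⊥-elim (φ∤prodP rs p h)
          cancel (inj₂ h) = h
          um : ∀ rs → Unique rs → (∀ r → r ∈ rs → Res r) → Unique (map f rs)
          um [] _ _ = []
          um (y ∷ ys) (n ∷ v) res = All.tabulate (λ z∈ eq → let y′ , y′∈ , eq′ = ∈-map⁻ f z∈ in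
              All.lookup n y′∈ (f-injective y y′ (res y (here ≡.refl)) (res y′ (there y′∈)) (≡.trans eq eq′)))
            ∷ um ys v (λ z z∈ → res z (there z∈))
          perm : map f rs ↭ rs
          perm = same-members⇒↭ (um rs u p) u
            (λ z z∈ → let y , y∈ , eq = ∈-map⁻ f z∈ in c z (subst Res (sym eq) (f-Res y (p y y∈))))
            (λ z z∈ → let y , ry , eq = injective⇒onto _≟P_ hs hs f f-Res f-injective z (p z z∈) in subst (_∈ map f rs) eq (∈-map⁺ f (c y ry)))

    -- The exponent exceeds the number of nonzero residues by one, so `unit-power` multiplied by `x`
    -- gives the claim; if `φ` divides `x`, both terms are multiples of `φ`.
    fermat : ∀ x → φ ∣ polyPow x (q ^ deg φ) + neg1 * x
    fermat x with ∣? irr x | residues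
    ... | no n | k , h = subst (λ z → φ ∣ polyPow x z + neg1 * x) (residue-count k h)
          (∣-resp (≈-trans (solve 3 (λ x X n → x :* (X :+ n) := x :* X :+ n :* x) ≈-refl x (polyPow x k) neg1)
                    (+-cong (ℙ.reflexive (sym (pow-suc x k))) ≈-refl))
                  (∣-*ˡ x (unit-power x n k h)))
    ... | yes y | k , h = subst (λ z → φ ∣ polyPow x z + neg1 * x) (residue-count k h)
          (∣-+ (∣-resp (ℙ.reflexive (sym (pow-suc x k))) (∣-*ʳ _ y)) (∣-*ˡ neg1 y))

  natK : ℕ → K
  natK zero = 0F
  natK (suc k) = 1F +F natK k

  sumK-↭ : ∀ {xs ys} → xs ↭ ys → sumK xs ≡ sumK ys
  sumK-↭ refl = ≡.refl
  sumK-↭ (prep x p) = cong (x +F_) (sumK-↭ p)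
  sumK-↭ (swap x y p) = ≡.trans (exchange x y _) (cong (λ z → y +F (x +F z)) (sumK-↭ p))
    where
    exchange : ∀ x y z → x +F (y +F z) ≡ y +F (x +F z)
    exchange x y z = ≡.trans (sym (𝔽.+-assoc x y z)) (≡.trans (cong (_+F z) (𝔽.+-comm x y)) (𝔽.+-assoc y x z))
  sumK-↭ (trans p r) = ≡.trans (sumK-↭ p) (sumK-↭ r)

  +F-cancelˡ : ∀ a {b c} → a +F b ≡ a +F c → b ≡ c
  +F-cancelˡ a {b} {c} e = begin
    b ≡⟨ 𝔽.+-identityˡ b ⟨
    0F +F b ≡⟨ cong (_+F b) (𝔽.-‿inverseˡ a) ⟨
    -F a +F a +F b ≡⟨ 𝔽.+-assoc _ _ _ ⟩
    -F a +F (a +F b) ≡⟨ cong (-F a +F_) e ⟩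
    -F a +F (a +F c) ≡⟨ 𝔽.+-assoc _ _ _ ⟨
    -F a +F a +F c ≡⟨ cong (_+F c) (𝔽.-‿inverseˡ a) ⟩
    0F +F c ≡⟨ 𝔽.+-identityˡ c ⟩
    c ∎
    where open ≡.≡-Reasoning

  -- Translation by 1 permutes K, so Σ x = Σ (1 + x) = q · 1 + Σ x.
  natK-q : natK q ≡ 0F
  natK-q = +F-cancelˡ (sumK ks) (begin
    sumK ks +F natK q ≡⟨ cong (λ z → sumK ks +F natK z) (length-tabulate {n = q} (λ x → x)) ⟨
    sumK ks +F natK (length ks) ≡⟨ shifted ks ⟨
    sumK (map (1F +F_) ks) ≡⟨ sumK-↭ (same-members⇒↭ (Uniq.map⁺ (+F-cancelˡ 1F) (Uniq.allFin⁺ q)) (Uniq.allFin⁺ q)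
        (λ x _ → ∈-allFin x) (λ x _ → subst (_∈ map (1F +F_) ks) (back x) (∈-map⁺ (1F +F_) (∈-allFin (-F 1F +F x))))) ⟩
    sumK ks ≡⟨ 𝔽.+-identityʳ _ ⟨
    sumK ks +F 0F ∎)
    where
    open ≡.≡-Reasoning
    ks = allFin q
    back : ∀ x → 1F +F (-F 1F +F x) ≡ x
    back x = ≡.trans (sym (𝔽.+-assoc _ _ _)) (≡.trans (cong (_+F x) (𝔽.-‿inverseʳ 1F)) (𝔽.+-identityˡ x))
    shifted : ∀ xs → sumK (map (1F +F_) xs) ≡ sumK xs +F natK (length xs)
    shifted [] = sym (𝔽.+-identityʳ 0F)
    shifted (x ∷ xs) = ≡.trans (cong (1F +F x +F_) (shifted xs))
      (𝔽Solver.solve 4 (λ a b c d → (a 𝔽Solver.:+ b) 𝔽Solver.:+ (c 𝔽Solver.:+ d) 𝔽Solver.:= (b 𝔽Solver.:+ c) 𝔽Solver.:+ (a 𝔽Solver.:+ d)) ≡.refl 1F x (sumK xs) (natK (length xs)))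

  natK-+ : ∀ a b → natK (a ℕ.+ b) ≡ natK a +F natK b
  natK-+ zero b = sym (𝔽.+-identityˡ _)
  natK-+ (suc a) b = ≡.trans (cong (1F +F_) (natK-+ a b)) (sym (𝔽.+-assoc _ _ _))

  natK-* : ∀ a b → natK b ≡ 0F → natK (a ℕ.* b) ≡ 0F
  natK-* zero b e = ≡.refl
  natK-* (suc a) b e = ≡.trans (natK-+ b (a ℕ.* b)) (≡.trans (cong₂ _+F_ e (natK-* a b e)) (𝔽.+-identityʳ _))

  natK-q^ : ∀ d → 1 ≤ d → natK (q ^ d) ≡ 0F
  natK-q^ (suc d) _ = subst (λ z → natK z ≡ 0F) (ℕP.*-comm (q ^ d) q) (natK-* (q ^ d) q natK-q)

  -- The first-order expansion of a power: only the linear coefficient is tracked, everything of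
  -- higher order in `y` is absorbed into `t`.
  binomial-mod-square : ∀ x y k → ∃ λ t → polyPow (x + y) (suc k) ≈ polyPow x (suc k) + [ natK (suc k) ] * (polyPow x k * y) + y * y * t
  binomial-mod-square x y zero = [] , (begin
    polyPow (x + y) 1 ≈⟨ pow-1 _ ⟩
    x + y ≈⟨ +-cong (pow-1 x) (≈-trans (*-cong (cons-cong (𝔽.+-identityʳ 1F) ≈-refl) ≈-refl) (*-identityˡ y)) ⟨
    polyPow x 1 + [ 1F +F 0F ] * y ≈⟨ +-cong ≈-refl (*-cong ≈-refl (*-identityˡ y)) ⟨
    polyPow x 1 + [ 1F +F 0F ] * (polyPow x 0 * y) ≈⟨ +-identityʳ _ ⟨
    polyPow x 1 + [ 1F +F 0F ] * (polyPow x 0 * y) + [] ≈⟨ +-cong ≈-refl (zeroʳ (y * y)) ⟨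
    polyPow x 1 + [ 1F +F 0F ] * (polyPow x 0 * y) + y * y * [] ∎)
    where open ≈R
  binomial-mod-square x y (suc k) with binomial-mod-square x y k
  ... | t , e = x * t + y * t + [ m ] * X , (begin
    polyPow (x + y) (suc (suc k)) ≡⟨ pow-suc (x + y) (suc k) ⟩
    (x + y) * polyPow (x + y) (suc k) ≈⟨ *-cong ≈-refl e ⟩
    (x + y) * (polyPow x (suc k) + [ m ] * (X * y) + y * y * t) ≡⟨ cong (λ z → (x + y) * (z + [ m ] * (X * y) + y * y * t)) (pow-suc x k) ⟩
    (x + y) * (x * X + [ m ] * (X * y) + y * y * t)
      ≈⟨ solve 5 (λ x y X m t → (x :+ y) :* (x :* X :+ m :* (X :* y) :+ y :* y :* t) :=
           x :* (x :* X) :+ (con 1 :+ m) :* (x :* X :* y) :+ y :* y :* (x :* t :+ y :* t :+ m :* X)) ≈-refl x y X [ m ] t ⟩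
    x * (x * X) + ([ 1F ] + [ m ]) * (x * X * y) + y * y * (x * t + y * t + [ m ] * X)
      ≡⟨ cong₂ (λ a b → x * a + b * (a * y) + y * y * (x * t + y * t + [ m ] * X)) (sym (pow-suc x k)) (const-+ 1F m) ⟩
    x * polyPow x (suc k) + [ 1F +F m ] * (polyPow x (suc k) * y) + y * y * (x * t + y * t + [ m ] * X)
      ≡⟨ cong (λ a → a + [ 1F +F m ] * (polyPow x (suc k) * y) + y * y * (x * t + y * t + [ m ] * X)) (sym (pow-suc x (suc k))) ⟩
    polyPow x (suc (suc k)) + [ 1F +F m ] * (polyPow x (suc k) * y) + y * y * (x * t + y * t + [ m ] * X) ∎)
    where
    open ≈R
    X = polyPow x k
    m = natK (suc k)

  binomial-vanishing : ∀ x y N → 1 ≤ N → natK N ≡ 0F → ∃ λ t → polyPow (x + y) N ≈ polyPow x N + y * y * t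
  binomial-vanishing x y (suc k) _ e with binomial-mod-square x y k
  ... | t , e′ = t , ≈-trans e′ (+-cong (≈-trans (+-cong ≈-refl (≈-trans (*-cong (cons≈[] e ≈-refl) ≈-refl) (ℙ.zeroˡ _))) (+-identityʳ _)) ≈-refl)

  -- The polynomial X^N - X with N = q ^ deg φ is divisible by both φ and ψ and takes all residues modulo φ to 0,
  -- so a root count on its cofactor shows that ψ has a root modulo φ; that X^N - X has zero first-order
  -- variation apart from -X lets the root be adjusted so that ψ does not vanish at it modulo φ².
  module _ {φ ψ : Poly} (iφ : MonicIrreducible φ) (iψ : MonicIrreducible ψ) (deg≡ : deg φ ≡ deg ψ) where
    private
      N = q ^ deg φ
      G = polyPow Xpoly N + neg1 * Xpoly
      ψ₀ = proj₁ (proj₁ iψ)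
      ψ≡ : ψ ≡ ψ₀ ++ [ 1F ]
      ψ≡ = proj₂ (proj₁ iψ)

      comp-G : ∀ P → comp G P ≈ polyPow P N + neg1 * P
      comp-G P = ≈-trans (comp-+ (polyPow Xpoly N) (neg1 * Xpoly) P) (+-cong
        (≈-trans (comp-pow Xpoly N P) (pow-cong N (comp-X P)))
        (≈-trans (comp-* neg1 Xpoly P) (*-cong (subst (λ z → comp z P ≈ z) (sym neg1-def) (comp-const (-F 1F) P)) (comp-X P))))

      -- `natK N` is zero, so the power has no linear term, and passing from `P` to `P + φ` changes
      -- `comp G` by `neg1 * φ` modulo `φ * φ`. Divisibility at both points would make `φ` a
      -- multiple of its square.
      not-both : ∀ P → φ * φ ∣ comp G P → ¬ (φ * φ ∣ comp G (P + φ))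
      not-both P h h′ with binomial-vanishing P φ N (q>0 (deg φ)) (natK-q^ (deg φ) (proj₁ (proj₂ iφ)))
      ... | t , e with ∣-cancel (∣-resp eq (∣-resp (comp-G (P + φ)) h′)) (∣-+ (∣-resp (comp-G P) h) (t , ≈-refl))
        where
        open ≈R
        eq : polyPow (P + φ) N + neg1 * (P + φ) ≈ (polyPow P N + neg1 * P + φ * φ * t) + neg1 * φ
        eq = ≈-trans (+-cong e ≈-refl) (solve 5 (λ X f t n p → X :+ f :* f :* t :+ n :* (p :+ f) := (X :+ n :* p :+ f :* f :* t) :+ n :* f) ≈-refl (polyPow P N) φ t neg1 P)
      ... | s , e′ = irreducible-∤1 iφ (s * neg1 , ≈-sym (monic-cancel (proj₁ iφ) (begin
          φ * (φ * (s * neg1)) ≈⟨ solve 3 (λ f s n → f :* (f :* (s :* n)) := n :* (f :* f :* s)) ≈-refl φ s neg1 ⟩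
          neg1 * (φ * φ * s) ≈⟨ *-cong ≈-refl e′ ⟨
          neg1 * (neg1 * φ) ≈⟨ minus-minus φ ⟩
          φ ≈⟨ *-identityʳ φ ⟨
          φ * [ 1F ] ∎)))
        where
        open ≈R
        minus-minus : ∀ x → neg1 * (neg1 * x) ≈ x
        minus-minus x = begin
          neg1 * (neg1 * x) ≈⟨ ℙ.+-identityˡ _ ⟨
          [] + neg1 * (neg1 * x) ≈⟨ +-cong (neg1-cancel x) ≈-refl ⟨
          (x + neg1 * x) + neg1 * (neg1 * x) ≈⟨ ℙ.+-assoc x _ _ ⟩
          x + (neg1 * x + neg1 * (neg1 * x)) ≈⟨ +-cong ≈-refl (neg1-cancel (neg1 * x)) ⟩
          x + [] ≈⟨ +-identityʳ x ⟩
          x ∎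

      G-list : Poly
      G-list = polyAdd (polyPow Xpoly N) (0F ∷ -F 1F ∷ [])

      G≈G-list : G ≈ G-list
      G≈G-list = ≈-trans (+-cong ≈-refl (≈-trans (*-cong (ℙ.reflexive neg1-def) ≈-refl) (≈-trans (*-consʳ [ -F 1F ] [ 1F ])
        (cons-cong ≡.refl (≈-trans (const-* (-F 1F) 1F) (cons-cong (𝔽.*-identityʳ _) ≈-refl)))))) (ℙ.reflexive (+-def _ _))

      length-G-list : length G-list ≡ suc N
      length-G-list with pow-monic [ 0F ] N
      ... | s , e , l = ≡.trans (length-polyAdd (polyPow Xpoly N) _)
            (≡.trans (cong (_⊔ 2) (≡.trans (cong length e) (≡.trans (length-snoc s) (cong suc (≡.trans l (ℕP.+-identityʳ N))))))
                     (cong suc (ℕP.m≥n⇒m⊔n≡m (q>0 (deg φ)))))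

      -- Fermat modulo `ψ`, applied to the residue of X, shows that `ψ` divides `G`, since the
      -- degrees agree. The division is carried out by `divMod` in order to bound the cofactor by
      -- `N` coefficients, the number of residues modulo `φ`.
      quotient : ∃ λ h → length h ≤ N × G ≈ ψ * h
      quotient = from-division (divMod ψ₀ G-list)
        where
        from-division : (∃ λ h → ∃ λ r → length r ≡ length ψ₀ × length h ≤ length G-list ∸ length ψ₀ × G-list ≈ (ψ₀ ++ [ 1F ]) * h + r) →
          ∃ λ h → length h ≤ N × G ≈ ψ * h
        from-division (h , r , lr , lh , e) = h ,
          ℕP.≤-trans lh (subst (λ z → z ∸ length ψ₀ ≤ N) (sym length-G-list) (pred-≤ (length ψ₀) (subst (1 ≤_) (≡.trans (cong deg ψ≡) (deg-snoc ψ₀ 1F)) (proj₁ (proj₂ iψ))))) ,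
          ≈-trans G≈G-list (≈-trans e (≈-trans (+-cong ≈-refl r≈0) (≈-trans (+-identityʳ _) (*-cong (ℙ.reflexive (sym ψ≡)) ≈-refl))))
          where
          pred-≤ : ∀ d → 1 ≤ d → suc N ∸ d ≤ N
          pred-≤ (suc d) _ = ℕP.m∸n≤m N d
          r≈0 : r ≈ []
          r≈0 = monic-∣-short ψ₀ (ℕP.≤-reflexive lr) (∣-cancel
            (∣-resp (≈-trans G≈G-list e) (∣-respˡ (ℙ.reflexive ψ≡) (subst (λ d → ψ ∣ polyPow Xpoly (q ^ d) + neg1 * Xpoly) (sym deg≡) (fermat iψ Xpoly))))
            (h , ≈-refl))

      -- Modulo `φ` every residue is a root of `G`, hence of `ψ` or of `h`. If `ψ` has none, all `N`
      -- residues are roots of `h`, whose at most `N` coefficients must then vanish modulo `φ` and,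
      -- being constants, are zero. So `G` vanishes identically, which contradicts `not-both`.
      no-roots : ¬ (∃ λ r → length r ≡ deg φ × φ ∣ comp ψ r) → HasSize (λ (r : Poly) → length r ≡ deg φ) N →
        (∃ λ h → length h ≤ N × G ≈ ψ * h) → ⊥
      no-roots none (rs , u , p , c , lrs) (h , lh , e) = not-both [] (φ²∣G []) (φ²∣G ([] + φ))
        where
        distinct : ∀ rs → Unique rs → (∀ r → r ∈ rs → length r ≡ deg φ) → AllPairs (λ x y → ¬ (φ ∣ y + neg1 * x)) rs
        distinct [] _ _ = []
        distinct (r ∷ rs) (n ∷ u) p = All.tabulate (λ {y} y∈ d → All.lookup n y∈
            (difference-short (proj₁ iφ) r y (p r (here ≡.refl)) (p y (there y∈)) d)) ∷ distinct rs u (λ z z∈ → p z (there z∈))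
        eval-comp : ∀ h r → eval (map [_] h) r ≡ comp h r
        eval-comp [] r = ≡.refl
        eval-comp (a ∷ h) r = cong (λ z → [ a ] + r * z) (eval-comp h r)
        h-vanishes : ∀ r → r ∈ rs → φ ∣ comp h r
        h-vanishes r r∈ with irreducible-prime iφ (∣-resp (≈-trans (≈-sym (comp-G r)) (≈-trans (comp-cong G (ψ * h) r e) (comp-* ψ h r))) (fermat iφ r))
        ... | inj₁ d = ⊥-elim (none (r , p r r∈ , d))
        ... | inj₂ d = d
        φ∣const : ∀ a → φ ∣ [ a ] → a ≡ 0F
        φ∣const a d = at (monic-∣-short (proj₁ (proj₁ iφ)) (subst (1 ≤_) (≡.trans (cong deg (proj₂ (proj₁ iφ))) (deg-snoc (proj₁ (proj₁ iφ)) 1F)) (proj₁ (proj₂ iφ)))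
          (∣-respˡ (ℙ.reflexive (proj₂ (proj₁ iφ))) d)) 0
        all-zero : ∀ h → All (φ ∣_) (map [_] h) → h ≈ []
        all-zero [] _ = ≈-refl
        all-zero (a ∷ h) (d ∷ ds) = cons≈[] (φ∣const a d) (all-zero h ds)
        h≈0 : h ≈ []
        h≈0 = all-zero h (root-bound iφ rs (map [_] h) (distinct rs u p)
          (subst₂ _≤_ (sym (length-map [_] h)) (sym lrs) lh)
          (All.tabulate λ {r} r∈ → subst (φ ∣_) (sym (eval-comp h r)) (h-vanishes r r∈)))
        φ²∣G : ∀ P → φ * φ ∣ comp G P
        φ²∣G P = ∣-resp (≈-sym (comp-[] G P (≈-trans e (≈-trans (*-cong ≈-refl h≈0) (zeroʳ ψ))))) ∣-zero

      has-root : ∃ λ P → φ ∣ comp ψ P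
      has-root = search (size-∃? (λ r → ∣? iφ (comp ψ r)) (size-length (deg φ)))
        where
        search : Dec (∃ λ r → length r ≡ deg φ × φ ∣ comp ψ r) → ∃ λ P → φ ∣ comp ψ P
        search (yes (P , _ , h)) = P , h
        search (no none) = ⊥-elim (no-roots none (size-length (deg φ)) quotient)

    -- `P` and `P + φ` are both roots modulo `φ`. Where `φ * φ` divides `comp ψ` it also divides
    -- `comp G`, and by `not-both` this fails at one of the two points.
    simple-root : ∃ λ P → φ ∣ comp ψ P × ¬ (φ * φ ∣ comp ψ P)
    simple-root = choose (decide-square h)
      where
      P = proj₁ has-root
      h = proj₂ has-root
      k = proj₁ quotient
      e = proj₂ (proj₂ quotient)
      G∣ : ∀ P → φ * φ ∣ comp ψ P → φ * φ ∣ comp G P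
      G∣ P d = ∣-trans d (comp k P , ≈-trans (comp-cong G (ψ * k) P e) (comp-* ψ k P))
      decide-square : ∀ {p} → φ ∣ p → Dec (φ * φ ∣ p)
      decide-square {p} (s , e) with ∣? iφ s
      ... | yes (t , e′) = yes (t , ≈-trans e (≈-trans (*-cong ≈-refl e′) (≈-sym (*-assoc φ φ t))))
      ... | no n = no λ { (t , e′) → n (t , monic-cancel (proj₁ iφ) (≈-trans (≈-sym e) (≈-trans e′ (*-assoc φ φ t)))) }
      shifted-root : φ ∣ comp ψ (P + φ)
      shifted-root with comp-congruent ψ P φ [ 1F ]
      ... | t , e′ = ∣-resp (≈-trans (≈-sym e′) (comp-arg ψ (+-cong ≈-refl (*-identityʳ φ)))) (∣-+ h (t , ≈-refl))
      choose : Dec (φ * φ ∣ comp ψ P) → ∃ λ P → φ ∣ comp ψ P × ¬ (φ * φ ∣ comp ψ P)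
      choose (no n) = P , h , n
      choose (yes d) = P + φ , shifted-root , λ d′ → not-both P (G∣ P d) (G∣ (P + φ) d′)

  chinese-remainder : ∀ (E : List (Poly × Poly)) → AllPairs (λ e f → Coprime (proj₁ e) (proj₁ f)) E →
    ∃ λ P → All (λ e → proj₁ e ∣ P + neg1 * proj₂ e) E
  chinese-remainder [] _ = [] , []
  chinese-remainder ((m , t) ∷ E) (c ∷ cs) with chinese-remainder E cs | product-coprime E c
    where
    product-coprime : ∀ E → All (λ f → Coprime m (proj₁ f)) E → ∃ λ M → Coprime m M × All (λ e → proj₁ e ∣ M) E
    product-coprime [] [] = [ 1F ] , coprime-sym coprime-1 , []
    product-coprime ((n , _) ∷ E) (c ∷ cs) with product-coprime E cs
    ... | M , cM , ds = n * M , coprime-sym (coprime-* (coprime-sym c) (coprime-sym cM)) ,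
          (M , ≈-refl) ∷ All.map (∣-*ˡ n) ds
  ... | P , hs | M , (u , v , e) , ds = Q , head ∷ All.zipWith tail (hs , ds)
    where
    open ≈R
    -- By the identity `u * m + v * M ≈ [ 1F ]`, the factor `v * M` is 1 modulo `m` and 0 modulo
    -- every later modulus, while `u * m` is the other way round.
    Q = t * (v * M) + P * (u * m)
    head : m ∣ Q + neg1 * t
    head = P * u + neg1 * t * u , (begin
      t * (v * M) + P * (u * m) + neg1 * t ≈⟨ +-cong ≈-refl (≈-trans (*-cong ≈-refl e) (*-identityʳ _)) ⟨
      t * (v * M) + P * (u * m) + neg1 * t * (u * m + v * M)
        ≈⟨ solve 7 (λ t v M P u m n → t :* (v :* M) :+ P :* (u :* m) :+ n :* t :* (u :* m :+ v :* M) := (v :* M) :* (t :+ n :* t) :+ m :* (P :* u :+ n :* t :* u)) ≈-refl t v M P u m neg1 ⟩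
      (v * M) * (t + neg1 * t) + m * (P * u + neg1 * t * u) ≈⟨ +-cong (≈-trans (*-cong ≈-refl (neg1-cancel t)) (zeroʳ _)) ≈-refl ⟩
      [] + m * (P * u + neg1 * t * u) ≈⟨ ℙ.+-identityˡ _ ⟩
      m * (P * u + neg1 * t * u) ∎)
    tail : ∀ {e} → (proj₁ e ∣ P + neg1 * proj₂ e) × proj₁ e ∣ M → proj₁ e ∣ Q + neg1 * proj₂ e
    tail {n , s} (h , d) = ∣-resp (begin
        (P + neg1 * s) + M * (t * v + neg1 * (P * v))
          ≈⟨ solve 6 (λ P n s M t v → (P :+ n :* s) :+ M :* (t :* v :+ n :* (P :* v)) := (t :* (v :* M) :+ n :* s) :+ (P :+ n :* (P :* (v :* M)))) ≈-refl P neg1 s M t v ⟩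
        (t * (v * M) + neg1 * s) + (P + neg1 * (P * (v * M))) ≈⟨ +-cong ≈-refl (≈-sym (subtract (begin
            P * (v * M) + P * (u * m) ≈⟨ solve 5 (λ P v M u m → P :* (v :* M) :+ P :* (u :* m) := P :* (u :* m :+ v :* M)) ≈-refl P v M u m ⟩
            P * (u * m + v * M) ≈⟨ *-cong ≈-refl e ⟩
            P * [ 1F ] ≈⟨ *-identityʳ P ⟩
            P ∎))) ⟩
        (t * (v * M) + neg1 * s) + P * (u * m) ≈⟨ solve 3 (λ a b c → (a :+ b) :+ c := (a :+ c) :+ b) ≈-refl (t * (v * M)) (neg1 * s) (P * (u * m)) ⟩
        t * (v * M) + P * (u * m) + neg1 * s ∎)
      (∣-+ h (∣-*ʳ _ d))

-- Linear algebra over a finite field and block diagonal matrices.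

module Lin {q : ℕ} (F : FiniteField q) where
  open import Data.Nat.Base using (zero; suc; _^_)
  import Data.Nat.Properties as ℕP
  open import Data.Bool.Base using (if_then_else_)
  open import Data.Fin.Base using (Fin; zero; suc; toℕ)
  open import Data.Fin.Properties using () renaming (_≟_ to _≟F_)
  open import Data.Vec.Base as Vec using (Vec; []; _∷_; lookup; tabulate; transpose; replicate; _⊛_)
  open import Data.Vec.Properties as VecP using (lookup∘tabulate; lookup-zipWith; lookup-map; lookup-replicate)
  open import Data.Vec.Relation.Binary.Pointwise.Extensional using (ext; extensional⇒inductive)
  import Data.Vec.Relation.Binary.Pointwise.Inductive as PW
  open import Data.List.Base as List using ([])
  open import Data.List.Relation.Unary.Any using (here)
  open import Data.List.Relation.Unary.All using ([])
  open import Data.List.Relation.Unary.AllPairs using ([]; _∷_)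
  open import Data.Product using (∃; _×_; _,_; proj₁; proj₂)
  open import Data.Unit using (⊤; tt)
  open import Relation.Nullary
  open import Relation.Nullary.Decidable using (dec-true; dec-false)
  open import Relation.Binary using (DecidableEquality)
  open import Relation.Binary.PropositionalEquality hiding ([_])
  open Counting
  open PolyRing F using (module 𝔽; module 𝔽Solver; _+F_; _*F_; -F_; 0F; 1F)
  open Roots F using (size-K)
  open LinAlg F

  V : ℕ → Set
  V n = Vec K n

  vec-ext : ∀ {A : Set} {n} {u v : Vec A n} → (∀ i → lookup u i ≡ lookup v i) → u ≡ v
  vec-ext e = PW.Pointwise-≡⇒≡ (extensional⇒inductive (ext e))

  infix 4 _≟V_ _≟M_

  _≟V_ : ∀ {n} → DecidableEquality (V n)
  _≟V_ = VecP.≡-dec _≟F_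

  _≟M_ : ∀ {n} → DecidableEquality (Mat n)
  _≟M_ = VecP.≡-dec _≟V_

  size-Vec : ∀ {A : Set} {k} → HasSize {A} (λ _ → ⊤) k → ∀ n → HasSize {Vec A n} (λ _ → ⊤) (k ^ n)
  size-Vec h zero = List.[ [] ] , ([] ∷ []) , (λ _ _ → tt) , (λ { [] _ → here refl }) , refl
  size-Vec h (suc n) = size-corr {R = λ p ys → ys ≡ proj₁ p ∷ proj₂ p}
    (record { total = λ { (y , ys) _ → y ∷ ys , tt , refl }
            ; onto = λ { (y ∷ ys) _ → (y , ys) , (tt , tt) , refl }
            ; inj = λ { _ _ _ _ _ refl refl → refl }
            ; fun = λ { _ _ _ _ _ _ refl refl → refl } })
    (size-× h (λ _ _ → size-Vec h n))

  size-V : ∀ n → HasSize {V n} (λ _ → ⊤) (q ^ n)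
  size-V = size-Vec size-K

  size-Mat : ∀ n → HasSize {Mat n} (λ _ → ⊤) ((q ^ n) ^ n)
  size-Mat n = size-Vec (size-V n) n

  module _ {n : ℕ} where
    ⊕-assoc : (u v w : V n) → (u ⊕ v) ⊕ w ≡ u ⊕ (v ⊕ w)
    ⊕-assoc = VecP.zipWith-assoc 𝔽.+-assoc

    ⊕-comm : (u v : V n) → u ⊕ v ≡ v ⊕ u
    ⊕-comm = VecP.zipWith-comm 𝔽.+-comm

    ⊕-identityˡ : (v : V n) → 0v ⊕ v ≡ v
    ⊕-identityˡ = VecP.zipWith-identityˡ 𝔽.+-identityˡ

    ⊕-identityʳ : (v : V n) → v ⊕ 0v ≡ v
    ⊕-identityʳ = VecP.zipWith-identityʳ 𝔽.+-identityʳ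

    lookup-⊕ : ∀ (u v : V n) i → lookup (u ⊕ v) i ≡ lookup u i +F lookup v i
    lookup-⊕ u v i = lookup-zipWith _+F_ i u v

    lookup-scale : ∀ c (v : V n) i → lookup (scale c v) i ≡ c *F lookup v i
    lookup-scale c v i = lookup-map i (c *F_) v

    lookup-0v : ∀ (i : Fin n) → lookup (0v {n}) i ≡ 0F
    lookup-0v i = lookup-replicate i 0F

    scale-⊕ : ∀ c (u v : V n) → scale c (u ⊕ v) ≡ scale c u ⊕ scale c v
    scale-⊕ c u v = vec-ext λ i → begin
      lookup (scale c (u ⊕ v)) i ≡⟨ lookup-scale c (u ⊕ v) i ⟩
      c *F lookup (u ⊕ v) i ≡⟨ cong (c *F_) (lookup-⊕ u v i) ⟩
      c *F (lookup u i +F lookup v i) ≡⟨ 𝔽.distribˡ c _ _ ⟩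
      c *F lookup u i +F c *F lookup v i ≡⟨ cong₂ _+F_ (lookup-scale c u i) (lookup-scale c v i) ⟨
      lookup (scale c u) i +F lookup (scale c v) i ≡⟨ lookup-⊕ (scale c u) (scale c v) i ⟨
      lookup (scale c u ⊕ scale c v) i ∎
      where open ≡-Reasoning

    scale-+F : ∀ c d (v : V n) → scale (c +F d) v ≡ scale c v ⊕ scale d v
    scale-+F c d v = vec-ext λ i → begin
      lookup (scale (c +F d) v) i ≡⟨ lookup-scale (c +F d) v i ⟩
      (c +F d) *F lookup v i ≡⟨ 𝔽.distribʳ _ c d ⟩
      c *F lookup v i +F d *F lookup v i ≡⟨ cong₂ _+F_ (lookup-scale c v i) (lookup-scale d v i) ⟨
      lookup (scale c v) i +F lookup (scale d v) i ≡⟨ lookup-⊕ (scale c v) (scale d v) i ⟨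
      lookup (scale c v ⊕ scale d v) i ∎
      where open ≡-Reasoning

    scale-scale : ∀ c d (v : V n) → scale c (scale d v) ≡ scale (c *F d) v
    scale-scale c d v = vec-ext λ i → trans (lookup-scale c (scale d v) i) (trans (cong (c *F_) (lookup-scale d v i))
      (trans (sym (𝔽.*-assoc c d _)) (sym (lookup-scale (c *F d) v i))))

    scale-1 : (v : V n) → scale 1F v ≡ v
    scale-1 v = vec-ext λ i → trans (lookup-scale 1F v i) (𝔽.*-identityˡ _)

    scale-0 : (v : V n) → scale 0F v ≡ 0v
    scale-0 v = vec-ext λ i → trans (lookup-scale 0F v i) (trans (𝔽.zeroˡ _) (sym (lookup-0v i)))

    scale-0v : ∀ c → scale c (0v {n}) ≡ 0v
    scale-0v c = vec-ext λ i → trans (lookup-scale c 0v i) (trans (cong (c *F_) (lookup-0v i)) (trans (𝔽.zeroʳ c) (sym (lookup-0v i))))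

    ⊕-inverseʳ : (v : V n) → v ⊕ scale (-F 1F) v ≡ 0v
    ⊕-inverseʳ v = trans (cong (_⊕ scale (-F 1F) v) (sym (scale-1 v))) (trans (sym (scale-+F 1F (-F 1F) v)) (trans (cong (λ z → scale z v) (𝔽.-‿inverseʳ 1F)) (scale-0 v)))

    ⊕-cancelˡ : (u : V n) {v w : V n} → u ⊕ v ≡ u ⊕ w → v ≡ w
    ⊕-cancelˡ u {v} {w} e = begin
      v ≡⟨ ⊕-identityˡ v ⟨
      0v ⊕ v ≡⟨ cong (_⊕ v) (trans (sym (⊕-inverseʳ u)) (⊕-comm u _)) ⟩
      (scale (-F 1F) u ⊕ u) ⊕ v ≡⟨ ⊕-assoc _ u v ⟩
      scale (-F 1F) u ⊕ (u ⊕ v) ≡⟨ cong (scale (-F 1F) u ⊕_) e ⟩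
      scale (-F 1F) u ⊕ (u ⊕ w) ≡⟨ ⊕-assoc _ u w ⟨
      (scale (-F 1F) u ⊕ u) ⊕ w ≡⟨ cong (_⊕ w) (trans (sym (⊕-inverseʳ u)) (⊕-comm u _)) ⟨
      0v ⊕ w ≡⟨ ⊕-identityˡ w ⟩
      w ∎
      where open ≡-Reasoning

    difference-zero : (u v : V n) → u ⊕ scale (-F 1F) v ≡ 0v → u ≡ v
    difference-zero u v e = sym (⊕-cancelˡ (scale (-F 1F) v) (trans (trans (⊕-comm _ v) (⊕-inverseʳ v)) (trans (sym e) (⊕-comm u _))))

    ⊕-interchange : (a b c d : V n) → (a ⊕ b) ⊕ (c ⊕ d) ≡ (a ⊕ c) ⊕ (b ⊕ d)
    ⊕-interchange a b c d = begin
      (a ⊕ b) ⊕ (c ⊕ d) ≡⟨ ⊕-assoc a b _ ⟩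
      a ⊕ (b ⊕ (c ⊕ d)) ≡⟨ cong (a ⊕_) (trans (sym (⊕-assoc b c d)) (trans (cong (_⊕ d) (⊕-comm b c)) (⊕-assoc c b d))) ⟩
      a ⊕ (c ⊕ (b ⊕ d)) ≡⟨ ⊕-assoc a c _ ⟨
      (a ⊕ c) ⊕ (b ⊕ d) ∎
      where open ≡-Reasoning

  dot-⊕ʳ : ∀ {n} (u v w : V n) → dot u (v ⊕ w) ≡ dot u v +F dot u w
  dot-⊕ʳ [] [] [] = sym (𝔽.+-identityʳ 0F)
  dot-⊕ʳ (a ∷ u) (b ∷ v) (c ∷ w) = trans (cong₂ _+F_ (𝔽.distribˡ a b c) (dot-⊕ʳ u v w)) (interchange (a *F b) (a *F c) _ _)
    where
    interchange : ∀ a b c d → (a +F b) +F (c +F d) ≡ (a +F c) +F (b +F d)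
    interchange = 𝔽Solver.solve 4 (λ a b c d → (a :+ b) :+ (c :+ d) := (a :+ c) :+ (b :+ d)) refl
      where open 𝔽Solver using (_:+_; _:=_)

  dot-comm : ∀ {n} (u v : V n) → dot u v ≡ dot v u
  dot-comm [] [] = refl
  dot-comm (a ∷ u) (b ∷ v) = cong₂ _+F_ (𝔽.*-comm a b) (dot-comm u v)

  dot-scaleʳ : ∀ {n} c (u v : V n) → dot u (scale c v) ≡ c *F dot u v
  dot-scaleʳ c [] [] = sym (𝔽.zeroʳ c)
  dot-scaleʳ c (a ∷ u) (b ∷ v) = trans (cong₂ _+F_ (swap-mul a c b) (dot-scaleʳ c u v)) (sym (𝔽.distribˡ c _ _))
    where
    swap-mul : ∀ a c b → a *F (c *F b) ≡ c *F (a *F b)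
    swap-mul a c b = trans (sym (𝔽.*-assoc a c b)) (trans (cong (_*F b) (𝔽.*-comm a c)) (𝔽.*-assoc c a b))

  dot-⊕ˡ : ∀ {n} (u v w : V n) → dot (u ⊕ v) w ≡ dot u w +F dot v w
  dot-⊕ˡ u v w = trans (dot-comm (u ⊕ v) w) (trans (dot-⊕ʳ w u v) (cong₂ _+F_ (dot-comm w u) (dot-comm w v)))

  dot-scaleˡ : ∀ {n} c (u v : V n) → dot (scale c u) v ≡ c *F dot u v
  dot-scaleˡ c u v = trans (dot-comm (scale c u) v) (trans (dot-scaleʳ c v u) (cong (c *F_) (dot-comm v u)))

  dot-cong : ∀ {n} (r u v : V n) → (∀ j → lookup r j *F lookup u j ≡ lookup r j *F lookup v j) → dot r u ≡ dot r v
  dot-cong [] [] [] e = refl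
  dot-cong (x ∷ r) (y ∷ u) (z ∷ v) e = cong₂ _+F_ (e zero) (dot-cong r u v λ j → e (suc j))

  dot-0ʳ : ∀ {n} (u : V n) → dot u 0v ≡ 0F
  dot-0ʳ [] = refl
  dot-0ʳ (a ∷ u) = trans (cong₂ _+F_ (𝔽.zeroʳ a) (dot-0ʳ u)) (𝔽.+-identityʳ 0F)

  unit : ∀ {n} → Fin n → V n
  unit i = tabulate λ j → if does (i ≟F j) then 1F else 0F

  tabulate-0 : ∀ n → tabulate {n = n} (λ _ → 0F) ≡ 0v
  tabulate-0 n = vec-ext λ i → trans (lookup∘tabulate (λ _ → 0F) i) (sym (lookup-0v i))

  dot-unitˡ : ∀ {n} (i : Fin n) (v : V n) → dot (unit i) v ≡ lookup v i
  dot-unitˡ zero (b ∷ v) = trans (cong₂ _+F_ (𝔽.*-identityˡ b) (trans (cong (λ z → dot z v) (tabulate-0 _)) (trans (dot-comm 0v v) (dot-0ʳ v)))) (𝔽.+-identityʳ b)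
  dot-unitˡ (suc i) (b ∷ v) = trans (cong₂ _+F_ (𝔽.zeroˡ b) (dot-unitˡ i v)) (𝔽.+-identityˡ _)

  module _ {n : ℕ} where
    lookup-▹ : ∀ (A : Mat n) v i → lookup (A ▹ v) i ≡ dot (lookup A i) v
    lookup-▹ A v i = lookup-map i (λ row → dot row v) A

    ▹-⊕ : ∀ (A : Mat n) u v → A ▹ (u ⊕ v) ≡ (A ▹ u) ⊕ (A ▹ v)
    ▹-⊕ A u v = vec-ext λ i → trans (lookup-▹ A (u ⊕ v) i) (trans (dot-⊕ʳ (lookup A i) u v)
      (sym (trans (lookup-⊕ (A ▹ u) (A ▹ v) i) (cong₂ _+F_ (lookup-▹ A u i) (lookup-▹ A v i)))))

    ▹-scale : ∀ (A : Mat n) c v → A ▹ scale c v ≡ scale c (A ▹ v)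
    ▹-scale A c v = vec-ext λ i → trans (lookup-▹ A (scale c v) i) (trans (dot-scaleʳ c (lookup A i) v)
      (sym (trans (lookup-scale c (A ▹ v) i) (cong (c *F_) (lookup-▹ A v i)))))

    ▹-0v : ∀ (A : Mat n) → A ▹ 0v ≡ 0v
    ▹-0v A = trans (cong (A ▹_) (sym (scale-0 0v))) (trans (▹-scale A 0F 0v) (scale-0 (A ▹ 0v)))

    I-▹ : ∀ (v : V n) → I ▹ v ≡ v
    I-▹ v = vec-ext λ i → trans (lookup-▹ I v i) (trans (cong (λ z → dot z v) (lookup∘tabulate unit i)) (dot-unitˡ i v))

    lookup-unit : ∀ (A : Mat n) i j → lookup (lookup A i) j ≡ lookup (A ▹ unit j) i
    lookup-unit A i j = sym (trans (lookup-▹ A (unit j) i) (trans (dot-comm (lookup A i) (unit j)) (dot-unitˡ j (lookup A i))))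

    -- Reduces matrix identities to identities of maps on vectors: associativity of `_·_`, for
    -- instance, becomes that of composition.
    mat-ext : {A B : Mat n} → (∀ v → A ▹ v ≡ B ▹ v) → A ≡ B
    mat-ext {A} {B} e = vec-ext λ i → vec-ext λ j → trans (lookup-unit A i j) (trans (cong (λ z → lookup z i) (e (unit j))) (sym (lookup-unit B i j)))

  -- Associativity of row times matrix times column, the fact about `transpose` from which `·-▹`
  -- follows. The matrix is rectangular because the induction removes one row at a time.
  dot-transpose : ∀ {m n} (x : V m) (B : Vec (V n) m) v →
    dot (Vec.map (dot x) (transpose B)) v ≡ dot x (Vec.map (λ row → dot row v) B)
  dot-transpose {n = n} [] [] v = trans (cong (λ z → dot z v) (zero-row n)) (trans (dot-comm 0v v) (dot-0ʳ v))
    where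
    zero-row : ∀ n → Vec.map (dot []) (replicate n []) ≡ 0v
    zero-row zero = refl
    zero-row (suc n) = cong (0F ∷_) (zero-row n)
  dot-transpose (a ∷ x) (b ∷ B) v = begin
    dot (Vec.map (dot (a ∷ x)) (transpose (b ∷ B))) v ≡⟨ cong (λ z → dot z v) (rows b (transpose B)) ⟩
    dot (scale a b ⊕ Vec.map (dot x) (transpose B)) v ≡⟨ dot-⊕ˡ (scale a b) _ v ⟩
    dot (scale a b) v +F dot (Vec.map (dot x) (transpose B)) v ≡⟨ cong₂ _+F_ (dot-scaleˡ a b v) (dot-transpose x B v) ⟩
    dot (a ∷ x) (Vec.map (λ row → dot row v) (b ∷ B)) ∎
    where
    open ≡-Reasoning
    rows : ∀ {n} (b : V n) (T : Vec (V _) n) → Vec.map (dot (a ∷ x)) ((replicate n _∷_ ⊛ b) ⊛ T) ≡ scale a b ⊕ Vec.map (dot x) T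
    rows [] [] = refl
    rows (b ∷ bs) (t ∷ T) = cong (_ ∷_) (rows bs T)

  record Linear {n} (f : V n → V n) : Set where
    field
      additive : ∀ u v → f (u ⊕ v) ≡ f u ⊕ f v
      homogeneous : ∀ c v → f (scale c v) ≡ scale c (f v)

    zero-preserving : f 0v ≡ 0v
    zero-preserving = trans (cong f (sym (scale-0 0v))) (trans (homogeneous 0F 0v) (scale-0 (f 0v)))
  open Linear public

  module _ {n : ℕ} where
    ▹-linear : (A : Mat n) → Linear (A ▹_)
    ▹-linear A = record { additive = ▹-⊕ A ; homogeneous = ▹-scale A }

    ·-▹ : ∀ (A B : Mat n) v → (A · B) ▹ v ≡ A ▹ (B ▹ v)
    ·-▹ A B v = vec-ext λ i → trans (lookup-▹ (A · B) v i) (trans (cong (λ z → dot z v) (lookup-map i _ A))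
      (trans (dot-transpose (lookup A i) B v) (sym (lookup-▹ A (B ▹ v) i))))

    mat : (V n → V n) → Mat n
    mat f = tabulate λ i → tabulate λ j → lookup (f (unit j)) i

  combine : ∀ {m n} → Vec (V n) m → V m → V n
  combine [] [] = 0v
  combine (b ∷ bs) (c ∷ cs) = scale c b ⊕ combine bs cs

  lookup-combine : ∀ {m n} (bs : Vec (V n) m) cs i → lookup (combine bs cs) i ≡ dot (Vec.map (λ b → lookup b i) bs) cs
  lookup-combine [] [] i = lookup-0v i
  lookup-combine (b ∷ bs) (c ∷ cs) i = trans (lookup-⊕ (scale c b) _ i) (cong₂ _+F_ (trans (lookup-scale c b i) (𝔽.*-comm c _)) (lookup-combine bs cs i))

  combine-linear : ∀ {m n} {f : V n → V n} → Linear f → (bs : Vec (V n) m) (cs : V m) → f (combine bs cs) ≡ combine (Vec.map f bs) cs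
  combine-linear l [] [] = zero-preserving l
  combine-linear {f = f} l (b ∷ bs) (c ∷ cs) = trans (additive l _ _) (cong₂ _⊕_ (homogeneous l c b) (combine-linear l bs cs))

  module _ {n : ℕ} where
    combine-units : (v : V n) → combine (tabulate unit) v ≡ v
    combine-units v = vec-ext λ i → trans (lookup-combine (tabulate unit) v i)
      (trans (cong (λ z → dot z v) (vec-ext {u = Vec.map (λ b → lookup b i) (tabulate unit)} {v = unit i} λ j → trans (lookup-map j (λ b → lookup b i) (tabulate unit)) (trans (cong (λ z → lookup z i) (lookup∘tabulate unit j)) (symmetric i j)))) (dot-unitˡ i v))
      where
      δ : ∀ {n} → Fin n → Fin n → K
      δ i j = if does (i ≟F j) then 1F else 0F
      δ-sym : ∀ {n} (i j : Fin n) → δ j i ≡ δ i j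
      δ-sym zero zero = refl
      δ-sym zero (suc j) = refl
      δ-sym (suc i) zero = refl
      δ-sym (suc i) (suc j) = δ-sym i j
      symmetric : ∀ i j → lookup (unit j) i ≡ lookup (unit i) j
      symmetric i j = trans (lookup∘tabulate (δ j) i) (trans (δ-sym i j) (sym (lookup∘tabulate (δ i) j)))

    mat-▹ : {f : V n → V n} → Linear f → ∀ v → mat f ▹ v ≡ f v
    mat-▹ {f} l v = vec-ext λ i → begin
      lookup (mat f ▹ v) i ≡⟨ lookup-▹ (mat f) v i ⟩
      dot (lookup (mat f) i) v ≡⟨ cong (λ z → dot z v) (lookup∘tabulate _ i) ⟩
      dot (tabulate λ j → lookup (f (unit j)) i) v ≡⟨ cong (λ z → dot z v) (vec-ext {u = tabulate λ j → lookup (f (unit j)) i} {v = Vec.map (λ b → lookup b i) (Vec.map f (tabulate unit))} λ j → trans (lookup∘tabulate (λ j → lookup (f (unit j)) i) j)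
         (sym (trans (lookup-map j (λ b → lookup b i) (Vec.map f (tabulate unit))) (cong (λ z → lookup z i) (trans (lookup-map j f (tabulate unit)) (cong f (lookup∘tabulate unit j))))))) ⟩
      dot (Vec.map (λ b → lookup b i) (Vec.map f (tabulate unit))) v ≡⟨ lookup-combine (Vec.map f (tabulate unit)) v i ⟨
      lookup (combine (Vec.map f (tabulate unit)) v) i ≡⟨ cong (λ z → lookup z i) (combine-linear l (tabulate unit) v) ⟨
      lookup (f (combine (tabulate unit) v)) i ≡⟨ cong (λ z → lookup (f z) i) (combine-units v) ⟩
      lookup (f v) i ∎
      where open ≡-Reasoning

    ·-assoc : (A B C : Mat n) → (A · B) · C ≡ A · (B · C)
    ·-assoc A B C = mat-ext λ v → trans (·-▹ (A · B) C v) (trans (·-▹ A B (C ▹ v)) (sym (trans (·-▹ A (B · C) v) (cong (A ▹_) (·-▹ B C v)))))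

    ·-identityˡ : (A : Mat n) → I · A ≡ A
    ·-identityˡ A = mat-ext λ v → trans (·-▹ I A v) (I-▹ (A ▹ v))

    ·-identityʳ : (A : Mat n) → A · I ≡ A
    ·-identityʳ A = mat-ext λ v → trans (·-▹ A I v) (cong (A ▹_) (I-▹ v))

    GL-inv : {A : Mat n} (g : GL n A) → GL n (proj₁ g)
    GL-inv {A} (B , e , f) = A , f , e

    cancel-invˡ : (A B : Mat n) → B · A ≡ I → ∀ C → B · (A · C) ≡ C
    cancel-invˡ A B e C = trans (sym (·-assoc B A C)) (trans (cong (_· C) e) (·-identityˡ C))

    cancel-invʳ : (A B : Mat n) → A · B ≡ I → ∀ C → (C · A) · B ≡ C
    cancel-invʳ A B e C = trans (·-assoc C A B) (trans (cong (C ·_) e) (·-identityʳ C))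

    GL-· : {A B : Mat n} → GL n A → GL n B → GL n (A · B)
    GL-· {A} {B} (A′ , e , f) (B′ , e′ , f′) = B′ · A′ ,
      trans (sym (·-assoc (A · B) B′ A′)) (trans (cong (_· A′) (cancel-invʳ B B′ e′ A)) e) ,
      trans (sym (·-assoc (B′ · A′) A B)) (trans (cong (_· B) (cancel-invʳ A′ A f B′)) f′)

    GL-injective : {A : Mat n} → GL n A → ∀ u v → A ▹ u ≡ A ▹ v → u ≡ v
    GL-injective {A} (B , _ , f) u v e = trans (sym (undo u)) (trans (cong (B ▹_) e) (undo v))
      where
      undo : ∀ u → B ▹ (A ▹ u) ≡ u
      undo u = trans (sym (·-▹ B A u)) (trans (cong (_▹ u) f) (I-▹ u))

    -- An injective self-map of the finite set `V n` is onto. Its inverse as a function is linear,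
    -- because `A` is linear and injective, and therefore comes from a matrix.
    injective-GL : {A : Mat n} → (∀ u v → A ▹ u ≡ A ▹ v → u ≡ v) → GL n A
    injective-GL {A} inj = mat g ,
      mat-ext (λ v → trans (·-▹ A (mat g) v) (trans (cong (A ▹_) (mat-▹ lin v)) (trans (eq v) (sym (I-▹ v))))) ,
      mat-ext (λ v → trans (·-▹ (mat g) A v) (trans (mat-▹ lin (A ▹ v)) (trans (inj _ _ (eq (A ▹ v))) (sym (I-▹ v)))))
      where
      pre : ∀ v → ∃ λ u → ⊤ × A ▹ u ≡ v
      pre v = injective⇒onto _≟V_ (size-V n) (size-V n) (A ▹_) (λ _ _ → tt) (λ x y _ _ → inj x y) v tt
      g : V n → V n
      g v = proj₁ (pre v)
      eq : ∀ v → A ▹ g v ≡ v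
      eq v = proj₂ (proj₂ (pre v))
      lin : Linear g
      lin = record
        { additive = λ u v → inj _ _ (trans (eq (u ⊕ v)) (sym (trans (▹-⊕ A (g u) (g v)) (cong₂ _⊕_ (eq u) (eq v)))))
        ; homogeneous = λ c v → inj _ _ (trans (eq (scale c v)) (sym (trans (▹-scale A c (g v)) (cong (scale c) (eq v))))) }

    GL? : (A : Mat n) → Dec (GL n A)
    GL? A with size-∃? {Q = λ B → A · B ≡ I × B · A ≡ I} (λ B → (A · B ≟M I) ×-dec (B · A ≟M I)) (size-Mat n)
    ... | yes (B , _ , h) = yes (B , h)
    ... | no none = no λ { (B , h) → none (B , tt , h) }

    Conj? : (A B : Mat n) → Dec (Conj A B)
    Conj? A B with size-∃? {Q = λ g → GL n g × g · A ≡ B · g} (λ g → GL? g ×-dec (g · A ≟M B · g)) (size-Mat n)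
    ... | yes (g , _ , h) = yes (g , h)
    ... | no none = no λ { (g , h) → none (g , tt , h) }

    Conj-sym : {A B : Mat n} → Conj A B → Conj B A
    Conj-sym {A} {B} (g , h@(g′ , e , f) , c) = g′ , GL-inv h , (begin
      g′ · B ≡⟨ cancel-invʳ g g′ e (g′ · B) ⟨
      ((g′ · B) · g) · g′ ≡⟨ cong (_· g′) (·-assoc g′ B g) ⟩
      (g′ · (B · g)) · g′ ≡⟨ cong (λ z → (g′ · z) · g′) c ⟨
      (g′ · (g · A)) · g′ ≡⟨ cong (_· g′) (cancel-invˡ g g′ f A) ⟩
      A · g′ ∎)
      where open ≡-Reasoning

    Conj-trans : {A B C : Mat n} → Conj A B → Conj B C → Conj A C
    Conj-trans {A} {B} {C} (g , hg , c) (h , hh , d) = h · g , GL-· hh hg , (begin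
      (h · g) · A ≡⟨ ·-assoc h g A ⟩
      h · (g · A) ≡⟨ cong (h ·_) c ⟩
      h · (B · g) ≡⟨ ·-assoc h B g ⟨
      (h · B) · g ≡⟨ cong (_· g) d ⟩
      (C · h) · g ≡⟨ ·-assoc C h g ⟩
      C · (h · g) ∎)
      where open ≡-Reasoning

    GL-Conj : {A B : Mat n} → GL n A → Conj A B → GL n B
    GL-Conj {A} {B} hA (g , hg@(g′ , e , f) , c) = subst (GL n) eq (GL-· (GL-· hg hA) (GL-inv hg))
      where
      eq : (g · A) · g′ ≡ B
      eq = trans (cong (_· g′) c) (cancel-invʳ g g′ e B)

  module _ {n : ℕ} (blk : Fin n → ℕ) where
    BlockDiagonal : Mat n → Set
    BlockDiagonal g = ∀ i j → blk i ≢ blk j → lookup (lookup g i) j ≡ 0F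

    -- Being block diagonal is commuting with the coordinate projections onto the blocks,
    -- a form in which it passes to products, inverses and polynomials.
    mask : ℕ → V n → V n
    mask b v = tabulate λ i → if does (blk i ℕP.≟ b) then lookup v i else 0F

    record Preserves (g : Mat n) : Set where
      constructor preserves
      field commutes : ∀ b v → g ▹ mask b v ≡ mask b (g ▹ v)
    open Preserves public

    mask-in : ∀ b v i → blk i ≡ b → lookup (mask b v) i ≡ lookup v i
    mask-in b v i e = trans (lookup∘tabulate _ i) (cong (λ z → if z then lookup v i else 0F) (dec-true (blk i ℕP.≟ b) e))

    mask-out : ∀ b v i → blk i ≢ b → lookup (mask b v) i ≡ 0F
    mask-out b v i e = trans (lookup∘tabulate _ i) (cong (λ z → if z then lookup v i else 0F) (dec-false (blk i ℕP.≟ b) e))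

    mask-linear : ∀ b → Linear (mask b)
    mask-linear b = record
      { additive = λ u v → vec-ext λ i → add u v i (blk i ℕP.≟ b)
      ; homogeneous = λ c v → vec-ext λ i → hom c v i (blk i ℕP.≟ b) }
      where
      add : ∀ u v i → Dec (blk i ≡ b) → lookup (mask b (u ⊕ v)) i ≡ lookup (mask b u ⊕ mask b v) i
      add u v i (yes e) = trans (mask-in b (u ⊕ v) i e) (trans (lookup-⊕ u v i) (sym (trans (lookup-⊕ (mask b u) (mask b v) i) (cong₂ _+F_ (mask-in b u i e) (mask-in b v i e)))))
      add u v i (no e) = trans (mask-out b (u ⊕ v) i e) (sym (trans (lookup-⊕ (mask b u) (mask b v) i) (trans (cong₂ _+F_ (mask-out b u i e) (mask-out b v i e)) (𝔽.+-identityʳ 0F))))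
      hom : ∀ c v i → Dec (blk i ≡ b) → lookup (mask b (scale c v)) i ≡ lookup (scale c (mask b v)) i
      hom c v i (yes e) = trans (mask-in b (scale c v) i e) (trans (lookup-scale c v i) (sym (trans (lookup-scale c (mask b v) i) (cong (c *F_) (mask-in b v i e)))))
      hom c v i (no e) = trans (mask-out b (scale c v) i e) (sym (trans (lookup-scale c (mask b v) i) (trans (cong (c *F_) (mask-out b v i e)) (𝔽.zeroʳ c))))

    BlockDiagonal⇒Preserves : ∀ g → BlockDiagonal g → Preserves g
    BlockDiagonal⇒Preserves g d = preserves λ b v → vec-ext λ i → trans (lookup-▹ g (mask b v) i) (row b v i (blk i ℕP.≟ b))
      where
      row : ∀ b v i → Dec (blk i ≡ b) → dot (lookup g i) (mask b v) ≡ lookup (mask b (g ▹ v)) i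
      row b v i (yes e) = trans (dot-cong (lookup g i) (mask b v) v λ j → entry j (blk j ℕP.≟ b)) (trans (sym (lookup-▹ g v i)) (sym (mask-in b (g ▹ v) i e)))
        where
        entry : ∀ j → Dec (blk j ≡ b) → lookup (lookup g i) j *F lookup (mask b v) j ≡ lookup (lookup g i) j *F lookup v j
        entry j (yes e′) = cong (lookup (lookup g i) j *F_) (mask-in b v j e′)
        entry j (no e′) = trans (cong (_*F lookup (mask b v) j) gij) (trans (𝔽.zeroˡ _) (sym (trans (cong (_*F lookup v j) gij) (𝔽.zeroˡ _))))
          where gij = d i j λ eq → e′ (trans (sym eq) e)
      row b v i (no e) = trans (dot-cong (lookup g i) (mask b v) 0v λ j → entry j (blk j ℕP.≟ b)) (trans (dot-0ʳ (lookup g i)) (sym (mask-out b (g ▹ v) i e)))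
        where
        entry : ∀ j → Dec (blk j ≡ b) → lookup (lookup g i) j *F lookup (mask b v) j ≡ lookup (lookup g i) j *F lookup (0v {n}) j
        entry j (yes e′) = trans (cong (_*F lookup (mask b v) j) gij) (trans (𝔽.zeroˡ _) (sym (trans (cong (_*F lookup (0v {n}) j) gij) (𝔽.zeroˡ _))))
          where gij = d i j λ eq → e (trans eq e′)
        entry j (no e′) = cong (lookup (lookup g i) j *F_) (trans (mask-out b v j e′) (sym (lookup-0v j)))

    -- Column `j` is `g ▹ unit j`, and `unit j` is fixed by the mask of its own block; commuting
    -- with that mask forces the column to vanish outside the block.
    Preserves⇒BlockDiagonal : ∀ g → Preserves g → BlockDiagonal g
    Preserves⇒BlockDiagonal g p i j ne = begin
      lookup (lookup g i) j ≡⟨ lookup-unit g i j ⟩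
      lookup (g ▹ unit j) i ≡⟨ cong (λ z → lookup (g ▹ z) i) (vec-ext λ k → fix k (blk k ℕP.≟ blk j)) ⟨
      lookup (g ▹ mask (blk j) (unit j)) i ≡⟨ cong (λ z → lookup z i) (commutes p (blk j) (unit j)) ⟩
      lookup (mask (blk j) (g ▹ unit j)) i ≡⟨ mask-out (blk j) (g ▹ unit j) i ne ⟩
      0F ∎
      where
      open ≡-Reasoning
      fix : ∀ k → Dec (blk k ≡ blk j) → lookup (mask (blk j) (unit j)) k ≡ lookup (unit j) k
      fix k (yes e) = mask-in (blk j) (unit j) k e
      fix k (no e) = trans (mask-out (blk j) (unit j) k e) (sym (trans (lookup∘tabulate _ k) (cong (λ z → if z then 1F else 0F) (dec-false (j ≟F k) λ { refl → e refl }))))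

    Preserves-· : ∀ {g h} → Preserves g → Preserves h → Preserves (g · h)
    Preserves-· {g} {h} p r = preserves λ b v → trans (·-▹ g h (mask b v)) (trans (cong (g ▹_) (commutes r b v)) (trans (commutes p b (h ▹ v)) (cong (mask b) (sym (·-▹ g h v)))))

    Preserves-inv : ∀ {g} (hg : GL n g) → Preserves g → Preserves (proj₁ hg)
    Preserves-inv {g} hg@(g′ , e , f) p = preserves λ b v → GL-injective hg _ _ (trans (undo (mask b v)) (sym (trans (commutes p b (g′ ▹ v)) (cong (mask b) (undo v)))))
      where
      undo : ∀ u → g ▹ (g′ ▹ u) ≡ u
      undo u = trans (sym (·-▹ g g′ u)) (trans (cong (_▹ u) e) (I-▹ u))

  module _ {n : ℕ} (ν : List.List ℕ) where
    private blk = λ (i : Fin n) → blockOf ν (toℕ i)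

    GLν-· : {g h : Mat n} → GLν n ν g → GLν n ν h → GLν n ν (g · h)
    GLν-· {g} {h} (a , b) (c , d) = GL-· a c , Preserves⇒BlockDiagonal blk (g · h)
      (Preserves-· blk (BlockDiagonal⇒Preserves blk g b) (BlockDiagonal⇒Preserves blk h d))

    GLν-inv : {g : Mat n} (h : GLν n ν g) → GLν n ν (proj₁ (proj₁ h))
    GLν-inv {g} (a , b) = GL-inv a , Preserves⇒BlockDiagonal blk (proj₁ a) (Preserves-inv blk a (BlockDiagonal⇒Preserves blk g b))

-- The polynomial module of a matrix and its cyclic decompositions.

module Action {q : ℕ} (F : FiniteField q) where
  open import Data.Nat.Base as ℕ using (zero; suc)
  import Data.Nat.Properties as ℕP
  open import Data.Nat.ListAction using (sum)
  open import Data.Nat.ListAction.Properties using (sum-↭)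
  open import Data.Vec.Base using ([]; _∷_)
  open import Data.List.Base using (List; []; _∷_; _++_; length; map; [_]; zipWith; replicate)
  open import Data.List.Properties using (length-map; length-zipWith; length-replicate)
  open import Data.List.Relation.Unary.All using ([]; _∷_)
  open import Data.List.Relation.Binary.Pointwise using (Pointwise; []; _∷_; Pointwise-length)
  open import Data.List.Relation.Binary.Permutation.Propositional using (_↭_; refl; prep; swap; trans)
  open import Data.List.Relation.Binary.Permutation.Propositional.Properties using (map⁺)
  open import Data.Product using (∃; _×_; _,_; proj₁; proj₂)
  open import Relation.Nullary
  open import Relation.Binary.PropositionalEquality as ≡ using (_≡_; cong; cong₂; sym)
  open Counting
  open PolyRing F
  open PolyArith F
  open Lin F
  open LinAlg F
  open ℙ using (+-cong; *-comm; +-identityʳ)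

  modulus : Poly × ℕ → Poly
  modulus s = polyPow (proj₁ s) (proj₂ s)

  dim : Poly × ℕ → ℕ
  dim s = deg (proj₁ s) ℕ.* proj₂ s

  modulus-monic : ∀ s → Monic (proj₁ s) → ∃ λ m → modulus s ≡ m ++ [ 1F ] × length m ≡ dim s
  modulus-monic (_ , l) (φ₀ , ≡.refl) with pow-monic φ₀ l
  ... | m , e , len = m , e , ≡.trans len (cong (ℕ._* l) (sym (deg-snoc φ₀ 1F)))

  module Act {n : ℕ} (A : Mat n) where
    infixr 30 _•_
    -- Opaque, since `polyApply` would unfold on every cons and goals would lose the form `p • v` in
    -- which the module laws are stated.
    opaque
      _•_ : Poly → V n → V n
      p • v = polyApply p A v

      •-def : ∀ p v → p • v ≡ polyApply p A v
      •-def p v = ≡.refl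

      []-• : ∀ v → [] • v ≡ 0v
      []-• v = ≡.refl

      ∷-• : ∀ a p v → (a ∷ p) • v ≡ scale a v ⊕ (A ▹ (p • v))
      ∷-• a p v = ≡.refl

    •-⊕ : ∀ p u v → p • (u ⊕ v) ≡ (p • u) ⊕ (p • v)
    •-⊕ [] u v = ≡.trans ([]-• _) (sym (≡.trans (cong₂ _⊕_ ([]-• u) ([]-• v)) (⊕-identityˡ 0v)))
    •-⊕ (a ∷ p) u v = begin
      (a ∷ p) • (u ⊕ v) ≡⟨ ∷-• a p (u ⊕ v) ⟩
      scale a (u ⊕ v) ⊕ (A ▹ (p • (u ⊕ v))) ≡⟨ cong₂ _⊕_ (scale-⊕ a u v) (≡.trans (cong (A ▹_) (•-⊕ p u v)) (▹-⊕ A (p • u) (p • v))) ⟩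
      (scale a u ⊕ scale a v) ⊕ ((A ▹ (p • u)) ⊕ (A ▹ (p • v))) ≡⟨ ⊕-interchange _ _ _ _ ⟩
      (scale a u ⊕ (A ▹ (p • u))) ⊕ (scale a v ⊕ (A ▹ (p • v))) ≡⟨ cong₂ _⊕_ (∷-• a p u) (∷-• a p v) ⟨
      ((a ∷ p) • u) ⊕ ((a ∷ p) • v) ∎
      where open ≡.≡-Reasoning

    scale-comm : ∀ c d (v : V n) → scale c (scale d v) ≡ scale d (scale c v)
    scale-comm c d v = ≡.trans (scale-scale c d v) (≡.trans (cong (λ z → scale z v) (𝔽.*-comm c d)) (sym (scale-scale d c v)))

    •-scale : ∀ p c v → p • scale c v ≡ scale c (p • v)
    •-scale [] c v = ≡.trans ([]-• _) (sym (≡.trans (cong (scale c) ([]-• v)) (scale-0v c)))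
    •-scale (a ∷ p) c v = begin
      (a ∷ p) • scale c v ≡⟨ ∷-• a p _ ⟩
      scale a (scale c v) ⊕ (A ▹ (p • scale c v)) ≡⟨ cong₂ _⊕_ (scale-comm a c v) (≡.trans (cong (A ▹_) (•-scale p c v)) (▹-scale A c (p • v))) ⟩
      scale c (scale a v) ⊕ scale c (A ▹ (p • v)) ≡⟨ scale-⊕ c _ _ ⟨
      scale c (scale a v ⊕ (A ▹ (p • v))) ≡⟨ cong (scale c) (∷-• a p v) ⟨
      scale c ((a ∷ p) • v) ∎
      where open ≡.≡-Reasoning

    •-linear : ∀ p → Linear (p •_)
    •-linear p = record { additive = •-⊕ p ; homogeneous = •-scale p }

    •-0v : ∀ p → p • 0v ≡ 0v
    •-0v p = zero-preserving (•-linear p)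

    zero-• : ∀ {p} → p ≈ [] → ∀ v → p • v ≡ 0v
    zero-• {[]} e v = []-• v
    zero-• {a ∷ p} e v = ≡.trans (∷-• a p v) (≡.trans (cong₂ _⊕_ (≡.trans (cong (λ z → scale z v) (at e 0)) (scale-0 v))
      (≡.trans (cong (A ▹_) (zero-• {p} (coefs λ i → at e (suc i)) v)) (▹-0v A))) (⊕-identityˡ 0v))

    ≈-• : ∀ {p r} → p ≈ r → ∀ v → p • v ≡ r • v
    ≈-• {[]} e v = ≡.trans ([]-• v) (sym (zero-• (≈-sym e) v))
    ≈-• {a ∷ p} {[]} e v = ≡.trans (zero-• e v) (sym ([]-• v))
    ≈-• {a ∷ p} {b ∷ r} e v = ≡.trans (∷-• a p v) (≡.trans (cong₂ _⊕_ (cong (λ z → scale z v) (at e 0)) (cong (A ▹_) (≈-• (coefs λ i → at e (suc i)) v))) (sym (∷-• b r v)))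

    polyAdd-• : ∀ p r v → polyAdd p r • v ≡ (p • v) ⊕ (r • v)
    polyAdd-• [] r v = sym (≡.trans (cong (_⊕ (r • v)) ([]-• v)) (⊕-identityˡ _))
    polyAdd-• (a ∷ p) [] v = sym (≡.trans (cong (((a ∷ p) • v) ⊕_) ([]-• v)) (⊕-identityʳ _))
    polyAdd-• (a ∷ p) (b ∷ r) v = begin
      ((a +F b) ∷ polyAdd p r) • v ≡⟨ ∷-• _ _ v ⟩
      scale (a +F b) v ⊕ (A ▹ (polyAdd p r • v)) ≡⟨ cong₂ _⊕_ (scale-+F a b v) (≡.trans (cong (A ▹_) (polyAdd-• p r v)) (▹-⊕ A (p • v) (r • v))) ⟩
      (scale a v ⊕ scale b v) ⊕ ((A ▹ (p • v)) ⊕ (A ▹ (r • v))) ≡⟨ ⊕-interchange _ _ _ _ ⟩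
      (scale a v ⊕ (A ▹ (p • v))) ⊕ (scale b v ⊕ (A ▹ (r • v))) ≡⟨ cong₂ _⊕_ (∷-• a p v) (∷-• b r v) ⟨
      ((a ∷ p) • v) ⊕ ((b ∷ r) • v) ∎
      where open ≡.≡-Reasoning

    +-• : ∀ p r v → (p + r) • v ≡ (p • v) ⊕ (r • v)
    +-• p r v = ≡.trans (cong (_• v) (+-def p r)) (polyAdd-• p r v)

    scaleP-• : ∀ a p v → scaleP a p • v ≡ scale a (p • v)
    scaleP-• a [] v = ≡.trans ([]-• v) (sym (≡.trans (cong (scale a) ([]-• v)) (scale-0v a)))
    scaleP-• a (b ∷ p) v = begin
      (a *F b ∷ scaleP a p) • v ≡⟨ ∷-• _ _ v ⟩
      scale (a *F b) v ⊕ (A ▹ (scaleP a p • v)) ≡⟨ cong₂ _⊕_ (sym (scale-scale a b v)) (≡.trans (cong (A ▹_) (scaleP-• a p v)) (▹-scale A a (p • v))) ⟩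
      scale a (scale b v) ⊕ scale a (A ▹ (p • v)) ≡⟨ scale-⊕ a _ _ ⟨
      scale a (scale b v ⊕ (A ▹ (p • v))) ≡⟨ cong (scale a) (∷-• b p v) ⟨
      scale a ((b ∷ p) • v) ∎
      where open ≡.≡-Reasoning

    shift-• : ∀ p v → (0F ∷ p) • v ≡ A ▹ (p • v)
    shift-• p v = ≡.trans (∷-• 0F p v) (≡.trans (cong (_⊕ (A ▹ (p • v))) (scale-0 v)) (⊕-identityˡ _))

    polyMul-• : ∀ p r v → polyMul p r • v ≡ p • (r • v)
    polyMul-• [] r v = ≡.trans ([]-• v) (sym ([]-• _))
    polyMul-• (a ∷ p) r v = begin
      polyAdd (scaleP a r) (0F ∷ polyMul p r) • v ≡⟨ polyAdd-• (scaleP a r) (0F ∷ polyMul p r) v ⟩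
      (scaleP a r • v) ⊕ ((0F ∷ polyMul p r) • v) ≡⟨ cong₂ _⊕_ (scaleP-• a r v) (≡.trans (shift-• (polyMul p r) v) (cong (A ▹_) (polyMul-• p r v))) ⟩
      scale a (r • v) ⊕ (A ▹ (p • (r • v))) ≡⟨ ∷-• a p (r • v) ⟨
      (a ∷ p) • (r • v) ∎
      where open ≡.≡-Reasoning

    *-• : ∀ p r v → (p * r) • v ≡ p • (r • v)
    *-• p r v = ≡.trans (cong (_• v) (*-def p r)) (polyMul-• p r v)

    •-comm : ∀ p r v → p • (r • v) ≡ r • (p • v)
    •-comm p r v = ≡.trans (sym (*-• p r v)) (≡.trans (≈-• (*-comm p r) v) (*-• r p v))

    const-• : ∀ a v → [ a ] • v ≡ scale a v
    const-• a v = ≡.trans (∷-• a [] v) (≡.trans (cong (scale a v ⊕_) (≡.trans (cong (A ▹_) ([]-• v)) (▹-0v A))) (⊕-identityʳ _))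

    1-• : ∀ v → [ 1F ] • v ≡ v
    1-• v = ≡.trans (const-• 1F v) (scale-1 v)

    neg1-• : ∀ v → v ⊕ (neg1 • v) ≡ 0v
    neg1-• v = ≡.trans (cong (_⊕ (neg1 • v)) (sym (1-• v))) (≡.trans (sym (+-• [ 1F ] neg1 v)) (zero-• (ℙ.-‿inverseʳ [ 1F ]) v))

    X-• : ∀ v → Xpoly • v ≡ A ▹ v
    X-• v = ≡.trans (shift-• [ 1F ] v) (cong (A ▹_) (1-• v))

    A-•-comm : ∀ p v → A ▹ (p • v) ≡ p • (A ▹ v)
    A-•-comm p v = ≡.trans (sym (X-• (p • v))) (≡.trans (•-comm Xpoly p v) (cong (p •_) (X-• v)))

    ∣-• : ∀ {m p} → m ∣ p → ∀ {v} → m • v ≡ 0v → p • v ≡ 0v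
    ∣-• {m} {p} (s , e) {v} z = ≡.trans (≈-• (≈-trans e (*-comm m s)) v) (≡.trans (*-• s m v) (≡.trans (cong (s •_) z) (•-0v s)))

    comb : List Poly → List (V n) → V n
    comb [] _ = 0v
    comb (c ∷ cs) [] = 0v
    comb (c ∷ cs) (v ∷ vs) = (c • v) ⊕ comb cs vs

    comb-∣ : ∀ cs {vs ss} → Pointwise (λ v s → modulus s • v ≡ 0v) vs ss → Pointwise (λ c s → modulus s ∣ c) cs ss → comb cs vs ≡ 0v
    comb-∣ _ [] [] = ≡.refl
    comb-∣ _ (a ∷ as) (d ∷ ds) = ≡.trans (cong₂ _⊕_ (∣-• d a) (comb-∣ _ as ds)) (⊕-identityˡ 0v)

    comb-zeros : ∀ k vs → comb (replicate k []) vs ≡ 0v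
    comb-zeros zero vs = ≡.refl
    comb-zeros (suc k) [] = ≡.refl
    comb-zeros (suc k) (v ∷ vs) = ≡.trans (cong₂ _⊕_ ([]-• v) (comb-zeros k vs)) (⊕-identityˡ 0v)

    comb-*ˡ : ∀ p cs vs → comb (map (p *_) cs) vs ≡ p • comb cs vs
    comb-*ˡ p [] vs = sym (•-0v p)
    comb-*ˡ p (c ∷ cs) [] = sym (•-0v p)
    comb-*ˡ p (c ∷ cs) (v ∷ vs) = ≡.trans (cong₂ _⊕_ (*-• p c v) (comb-*ˡ p cs vs)) (sym (•-⊕ p _ _))

    comb-+ : ∀ cs ds vs → length cs ≡ length ds → comb (zipWith _+_ cs ds) vs ≡ comb cs vs ⊕ comb ds vs
    comb-+ [] [] vs l = sym (⊕-identityˡ 0v)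
    comb-+ (c ∷ cs) (d ∷ ds) [] l = sym (⊕-identityˡ 0v)
    comb-+ (c ∷ cs) (d ∷ ds) (v ∷ vs) l = ≡.trans (cong₂ _⊕_ (+-• c d v) (comb-+ cs ds vs (ℕP.suc-injective l))) (⊕-interchange _ _ _ _)

    minus : List Poly → List Poly → List Poly
    minus = zipWith (λ c d → c + neg1 * d)

    comb-minus : ∀ cs ds vs → length cs ≡ length ds → comb cs vs ≡ comb ds vs → comb (minus cs ds) vs ≡ 0v
    comb-minus cs ds vs l e = ≡.trans (go cs ds vs l) (≡.trans (cong (_⊕ (neg1 • comb ds vs)) e) (neg1-• _))
      where
      go : ∀ cs ds vs → length cs ≡ length ds → comb (minus cs ds) vs ≡ comb cs vs ⊕ (neg1 • comb ds vs)
      go [] [] vs l = sym (≡.trans (⊕-identityˡ _) (•-0v neg1))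
      go (c ∷ cs) (d ∷ ds) [] l = sym (≡.trans (⊕-identityˡ _) (•-0v neg1))
      go (c ∷ cs) (d ∷ ds) (v ∷ vs) l = ≡.trans (cong₂ _⊕_ (≡.trans (+-• c (neg1 * d) v) (cong ((c • v) ⊕_) (*-• neg1 d v))) (go cs ds vs (ℕP.suc-injective l)))
        (≡.trans (⊕-interchange _ _ _ _) (cong (((c • v) ⊕ comb cs vs) ⊕_) (sym (•-⊕ neg1 _ _))))

    comb-minus⁻ : ∀ cs ds vs → length cs ≡ length ds → comb (minus cs ds) vs ≡ 0v → comb cs vs ≡ comb ds vs
    comb-minus⁻ cs ds vs l e = ≡.trans (sym (≡.trans (sym (comb-+ (minus cs ds) ds vs (≡.trans (length-zipWith _ cs ds) (≡.trans (cong (ℕ._⊓ length ds) l) (ℕP.⊓-idem _))))) (restore cs ds vs l)))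
        (≡.trans (cong (_⊕ comb ds vs) e) (⊕-identityˡ _))
      where
      restore : ∀ cs ds vs → length cs ≡ length ds → comb (zipWith _+_ (minus cs ds) ds) vs ≡ comb cs vs
      restore [] [] vs l = ≡.refl
      restore (c ∷ cs) (d ∷ ds) [] l = ≡.refl
      restore (c ∷ cs) (d ∷ ds) (v ∷ vs) l = cong₂ _⊕_ (≈-• (≈-trans (ℙ.+-assoc c _ d) (≈-trans (+-cong ≈-refl (≈-trans (ℙ.+-comm _ d) (neg1-cancel d))) (+-identityʳ c))) v) (restore cs ds vs (ℕP.suc-injective l))

  -- The space as the direct sum of the modules K[X]/(modulus s): with polynomial coefficients, the
  -- only relations among the generators are those of the individual annihilators. This is the
  -- coordinate-free counterpart of the basis condition in `InClass`.
  record Decomp {n : ℕ} (A : Mat n) (vs : List (V n)) (ss : List (Poly × ℕ)) : Set where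
    open Act A
    field
      annihilated : Pointwise (λ v s → modulus s • v ≡ 0v) vs ss
      spanning : ∀ x → ∃ λ cs → length cs ≡ length ss × comb cs vs ≡ x
      independent : ∀ cs → length cs ≡ length ss → comb cs vs ≡ 0v → Pointwise (λ c s → modulus s ∣ c) cs ss
      dimension : sum (map dim ss) ≡ n

  •-hom : ∀ {n} {A B : Mat n} {f : V n → V n} → Linear f → (∀ v → f (A ▹ v) ≡ B ▹ f v) →
    ∀ p v → f (Act._•_ A p v) ≡ Act._•_ B p (f v)
  •-hom {A = A} {B} {f} l c [] v = ≡.trans (cong f (Act.[]-• A v)) (≡.trans (zero-preserving l) (sym (Act.[]-• B (f v))))
  •-hom {A = A} {B} {f} l c (a ∷ p) v = ≡.trans (cong f (Act.∷-• A a p v)) (≡.trans (additive l _ _)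
    (≡.trans (cong₂ _⊕_ (homogeneous l a v) (≡.trans (c _) (cong (B ▹_) (•-hom {A = A} {B} l c p v)))) (sym (Act.∷-• B a p (f v)))))

  map-comb : ∀ {n} {A B : Mat n} {f : V n → V n} → Linear f → (∀ v → f (A ▹ v) ≡ B ▹ f v) →
    ∀ cs vs → f (Act.comb A cs vs) ≡ Act.comb B cs (map f vs)
  map-comb l c [] vs = zero-preserving l
  map-comb l c (p ∷ cs) [] = zero-preserving l
  map-comb {A = A} {B} l c (p ∷ cs) (v ∷ vs) = ≡.trans (additive l _ _) (cong₂ _⊕_ (•-hom {A = A} {B} l c p v) (map-comb {A = A} {B} l c cs vs))

  comb-separates : ∀ {n} (A : Mat n) (vs ws : List (V n)) → length vs ≡ length ws →
    (∀ cs → length cs ≡ length vs → Act.comb A cs vs ≡ Act.comb A cs ws) → vs ≡ ws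
  comb-separates A [] [] l e = ≡.refl
  comb-separates A (v ∷ vs) (w ∷ ws) l e = cong₂ _∷_
      (≡.trans (sym (first v vs)) (≡.trans (e ([ 1F ] ∷ zeros) (cong suc (length-replicate (length vs)))) (first w ws)))
      (comb-separates A vs ws (ℕP.suc-injective l) λ cs lc → ≡.trans (sym (rest v cs vs)) (≡.trans (e ([] ∷ cs) (cong suc lc)) (rest w cs ws)))
    where
    open Act A
    zeros = replicate (length vs) []
    first : ∀ u us → comb ([ 1F ] ∷ zeros) (u ∷ us) ≡ u
    first u us = ≡.trans (cong₂ _⊕_ (1-• u) (comb-zeros (length vs) us)) (⊕-identityʳ u)
    rest : ∀ u cs us → comb ([] ∷ cs) (u ∷ us) ≡ comb cs us
    rest u cs us = ≡.trans (cong (_⊕ comb cs us) ([]-• u)) (⊕-identityˡ _)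

  module _ {n : ℕ} {A : Mat n} {vs : List (V n)} {ss : List (Poly × ℕ)} (D : Decomp A vs ss)
           {B : Mat n} {ws : List (V n)} (ann : Pointwise (λ w s → Act._•_ B (modulus s) w ≡ 0v) ws ss) where
    open Decomp D
    private
      module 𝔸 = Act A
      module 𝔹 = Act B

      coeffs : V n → List Poly
      coeffs x = proj₁ (spanning x)

      g : V n → V n
      g x = 𝔹.comb (coeffs x) ws

      len-minus : ∀ (cs ds : List Poly) → length cs ≡ length ss → length ds ≡ length ss → length (𝔹.minus cs ds) ≡ length ss
      len-minus cs ds lc ld = ≡.trans (length-zipWith _ cs ds) (≡.trans (cong₂ ℕ._⊓_ lc ld) (ℕP.⊓-idem _))

      -- Well-definedness of `g`: the coefficients picked by `spanning` and the given ones differ by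
      -- multiples of the moduli, and these annihilate `ws` too.
      g-comb : ∀ cs → length cs ≡ length ss → g (𝔸.comb cs vs) ≡ 𝔹.comb cs ws
      g-comb cs l = 𝔹.comb-minus⁻ ds cs ws (≡.trans ld (sym l)) (𝔹.comb-∣ (𝔹.minus ds cs) ann (independent (𝔸.minus ds cs) (len-minus ds cs ld l)
          (𝔸.comb-minus ds cs vs (≡.trans ld (sym l)) (proj₂ (proj₂ (spanning (𝔸.comb cs vs)))))))
        where
        ds = coeffs (𝔸.comb cs vs)
        ld = proj₁ (proj₂ (spanning (𝔸.comb cs vs)))

      length-coeffs : ∀ x → length (coeffs x) ≡ length ss
      length-coeffs x = proj₁ (proj₂ (spanning x))

      comb-coeffs : ∀ x → 𝔸.comb (coeffs x) vs ≡ x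
      comb-coeffs x = proj₂ (proj₂ (spanning x))

      g-• : ∀ p x → g (p 𝔸.• x) ≡ p 𝔹.• g x
      g-• p x = ≡.trans (cong g (≡.trans (cong (p 𝔸.•_) (sym (comb-coeffs x))) (sym (𝔸.comb-*ˡ p (coeffs x) vs))))
        (≡.trans (g-comb (map (p *_) (coeffs x)) (≡.trans (length-map _ (coeffs x)) (length-coeffs x))) (𝔹.comb-*ˡ p (coeffs x) ws))

      g-linear : Linear g
      g-linear = record
        { additive = λ u v → ≡.trans (cong g (≡.trans (cong₂ _⊕_ (sym (comb-coeffs u)) (sym (comb-coeffs v))) (sym (𝔸.comb-+ (coeffs u) (coeffs v) vs (same u v)))))
            (≡.trans (g-comb (zipWith _+_ (coeffs u) (coeffs v)) (≡.trans (length-zipWith _+_ (coeffs u) (coeffs v)) (≡.trans (cong₂ ℕ._⊓_ (length-coeffs u) (length-coeffs v)) (ℕP.⊓-idem _))))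
              (𝔹.comb-+ (coeffs u) (coeffs v) ws (same u v)))
        ; homogeneous = λ c v → ≡.trans (cong g (sym (𝔸.const-• c v))) (≡.trans (g-• [ c ] v) (𝔹.const-• c _)) }
        where
        same : ∀ u v → length (coeffs u) ≡ length (coeffs v)
        same u v = ≡.trans (length-coeffs u) (sym (length-coeffs v))

    -- The universal property of the direct sum: generators may be sent to any vectors killed by the
    -- same moduli. Linearity and compatibility with the two matrices both come from compatibility
    -- with every polynomial.
    extend : ∃ λ (G : Mat n) → (∀ cs → length cs ≡ length ss → G ▹ 𝔸.comb cs vs ≡ 𝔹.comb cs ws) × G · A ≡ B · G
    extend = mat g , (λ cs l → ≡.trans (mat-▹ g-linear _) (g-comb cs l)) ,
      mat-ext λ v → ≡.trans (·-▹ (mat g) A v) (≡.trans (mat-▹ g-linear (A ▹ v)) (≡.trans (cong g (sym (𝔸.X-• v)))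
        (≡.trans (g-• Xpoly v) (≡.trans (𝔹.X-• (g v)) (≡.trans (cong (B ▹_) (sym (mat-▹ g-linear v))) (sym (·-▹ B (mat g) v)))))))

    extend-injective : (∀ cs → length cs ≡ length ss → 𝔹.comb cs ws ≡ 0v → Pointwise (λ c s → modulus s ∣ c) cs ss) → GL n (proj₁ extend)
    extend-injective ind = injective-GL λ u v e → ≡.trans (sym (comb-coeffs u)) (≡.trans
        (𝔸.comb-minus⁻ (coeffs u) (coeffs v) vs (≡.trans (length-coeffs u) (sym (length-coeffs v)))
          (𝔸.comb-∣ (𝔸.minus (coeffs u) (coeffs v)) annihilated (ind (𝔹.minus (coeffs u) (coeffs v)) (len-minus (coeffs u) (coeffs v) (length-coeffs u) (length-coeffs v))
            (𝔹.comb-minus (coeffs u) (coeffs v) ws (≡.trans (length-coeffs u) (sym (length-coeffs v)))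
              (≡.trans (sym (mat-▹ g-linear u)) (≡.trans e (mat-▹ g-linear v)))))))
        (comb-coeffs v))

  same-summands⇒Conj : ∀ {n} {A B : Mat n} {vs ws ss} → Decomp A vs ss → Decomp B ws ss → Conj A B
  same-summands⇒Conj D E = proj₁ (extend D (Decomp.annihilated E)) , extend-injective D (Decomp.annihilated E) (Decomp.independent E) , proj₂ (proj₂ (extend D (Decomp.annihilated E)))

  -- What a permutation of the summands must carry along. The relations are arbitrary because
  -- annihilation, between vectors and summands, and divisibility, between coefficients and
  -- summands, have to follow the same permutation, the latter backwards.
  record Reordering {n : ℕ} (A : Mat n) (vs : List (V n)) (ss : List (Poly × ℕ)) (vs′ : List (V n)) (ss′ : List (Poly × ℕ)) : Set₁ where
    open Act A
    field
      carry : {R : V n → Poly × ℕ → Set} → Pointwise R vs ss → Pointwise R vs′ ss′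
      forth : ∀ cs → length cs ≡ length ss → ∃ λ cs′ → length cs′ ≡ length ss′ × comb cs′ vs′ ≡ comb cs vs
      back  : ∀ cs′ → length cs′ ≡ length ss′ → ∃ λ cs → length cs ≡ length ss × comb cs vs ≡ comb cs′ vs′ ×
              ({R : Poly → Poly × ℕ → Set} → Pointwise R cs ss → Pointwise R cs′ ss′)
  open Reordering

  reorder : ∀ {n} (A : Mat n) vs {ss ss′} → length vs ≡ length ss → ss ↭ ss′ → ∃ λ vs′ → length vs′ ≡ length ss′ × Reordering A vs ss vs′ ss′
  reorder A vs l refl = vs , l , record { carry = λ p → p ; forth = λ cs l → cs , l , ≡.refl ; back = λ cs l → cs , l , ≡.refl , λ p → p }
  reorder A (v ∷ vs) l (prep s p) with reorder A vs (ℕP.suc-injective l) p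
  ... | vs′ , l′ , r = v ∷ vs′ , cong suc l′ , record
    { carry = λ { (x ∷ xs) → x ∷ carry r xs }
    ; forth = λ { (c ∷ cs) lc → let cs′ , lc′ , e = forth r cs (ℕP.suc-injective lc) in c ∷ cs′ , cong suc lc′ , cong ((c • v) ⊕_) e }
    ; back = λ { (c ∷ cs) lc → let cs′ , lc′ , e , k = back r cs (ℕP.suc-injective lc) in c ∷ cs′ , cong suc lc′ , cong ((c • v) ⊕_) e , λ { (x ∷ xs) → x ∷ k xs } } }
    where open Act A
  reorder A (v ∷ w ∷ vs) l (swap s t p) with reorder A vs (ℕP.suc-injective (ℕP.suc-injective l)) p
  ... | vs′ , l′ , r = w ∷ v ∷ vs′ , cong (λ z → suc (suc z)) l′ , record
    { carry = λ { (x ∷ y ∷ xs) → y ∷ x ∷ carry r xs }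
    ; forth = λ { (c ∷ d ∷ cs) lc → let cs′ , lc′ , e = forth r cs (ℕP.suc-injective (ℕP.suc-injective lc)) in
        d ∷ c ∷ cs′ , cong (λ z → suc (suc z)) lc′ , exchange _ _ _ _ e }
    ; back = λ { (c ∷ d ∷ cs) lc → let cs′ , lc′ , e , k = back r cs (ℕP.suc-injective (ℕP.suc-injective lc)) in
        d ∷ c ∷ cs′ , cong (λ z → suc (suc z)) lc′ , exchange _ _ _ _ e , λ { (x ∷ y ∷ xs) → y ∷ x ∷ k xs } } }
    where
    exchange : ∀ (a b x y : V _) → x ≡ y → a ⊕ (b ⊕ x) ≡ b ⊕ (a ⊕ y)
    exchange a b x y e = ≡.trans (sym (⊕-assoc a b x)) (≡.trans (cong₂ _⊕_ (⊕-comm a b) e) (⊕-assoc b a y))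
  reorder A vs l (trans p p′) with reorder A vs l p
  ... | vs₁ , l₁ , r₁ with reorder A vs₁ l₁ p′
  ... | vs₂ , l₂ , r₂ = vs₂ , l₂ , record
    { carry = λ x → carry r₂ (carry r₁ x)
    ; forth = λ cs lc → let cs₁ , lc₁ , e₁ = forth r₁ cs lc ; cs₂ , lc₂ , e₂ = forth r₂ cs₁ lc₁ in cs₂ , lc₂ , ≡.trans e₂ e₁
    ; back = λ cs lc → let cs₁ , lc₁ , e₁ , k₁ = back r₂ cs lc ; cs₂ , lc₂ , e₂ , k₂ = back r₁ cs₁ lc₁ in cs₂ , lc₂ , ≡.trans e₂ e₁ , λ x → k₁ (k₂ x) }

  Decomp-↭ : ∀ {n} {A : Mat n} {vs ss ss′} → ss ↭ ss′ → Decomp A vs ss → ∃ λ vs′ → Decomp A vs′ ss′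
  Decomp-↭ {A = A} {vs} p D with reorder A vs (Pointwise-length (Decomp.annihilated D)) p
  ... | vs′ , l , r = vs′ , record
    { annihilated = carry r annihilated
    ; spanning = λ x → let cs , lc , e = spanning x ; cs′ , lc′ , e′ = forth r cs lc in cs′ , lc′ , ≡.trans e′ e
    ; independent = λ cs lc e → let cs′ , lc′ , e′ , k = back r cs lc in k (independent cs′ lc′ (≡.trans e′ e))
    ; dimension = ≡.trans (sym (sum-↭ (map⁺ dim p))) dimension }
    where open Decomp D

-- Cyclic bases versus module decompositions, and passing from A to P(A).

module Basis {q : ℕ} (F : FiniteField q) where
  open import Data.Nat.Base as ℕ using (zero; suc; _≤_)
  import Data.Nat.Properties as ℕP
  open import Data.Nat.ListAction using (sum)
  open import Data.Vec.Base using (Vec; []; _∷_; toList)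
  open import Data.Vec.Properties using (length-toList)
  open import Data.List.Base using (List; []; _∷_; _++_; length; map; [_]; concat; zip; applyUpTo; upTo; take; drop)
  open import Data.List.Properties using (length-++; length-map; map-applyUpTo; length-applyUpTo; take++drop≡id; length-take; length-drop; ∷-injective)
  open import Data.List.Relation.Unary.All as All using (All; []; _∷_)
  import Data.List.Relation.Unary.All.Properties as AllP
  open import Data.List.Relation.Unary.AllPairs using (AllPairs; []; _∷_)
  open import Data.List.Relation.Binary.Pointwise as Pointwise using (Pointwise; []; _∷_; Pointwise-length; ++⁺)
  open import Data.List.Relation.Binary.Permutation.Propositional using (_↭_; refl; prep; swap; trans; ↭-sym; ↭-trans; ↭-refl)
  open import Data.List.Relation.Binary.Permutation.Propositional.Properties using (↭-map-inv; All-resp-↭; ++⁺ˡ; shifts)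
  open import Data.Product using (∃; _×_; _,_; proj₁; proj₂)
  open import Data.Sum using (inj₁; inj₂)
  open import Data.Unit using (tt)
  open import Data.Empty using (⊥-elim)
  open import Relation.Nullary
  open import Relation.Binary.PropositionalEquality as ≡ using (_≡_; _≢_; cong; cong₂; subst; sym)
  open Counting
  open PolyRing F
  open PolyArith F
  open Roots F
  open Lin F
  open Action F
  open LinAlg F
  open ℙ using (+-cong; *-cong; *-comm; *-assoc; +-identityʳ; *-identityˡ)
  open ℙSolver using (solve; _:=_; _:*_)
  import Relation.Binary.Reasoning.Setoid ℙ.setoid as ≈R

  HasDim : Poly → Poly × ℕ → Set
  HasDim c s = length c ≡ dim s

  linComb-++ : ∀ {n} cs (bs : List (V n)) {cs′ bs′} → length cs ≡ length bs →
    linComb (cs ++ cs′) (bs ++ bs′) ≡ linComb cs bs ⊕ linComb cs′ bs′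
  linComb-++ [] [] l = sym (⊕-identityˡ _)
  linComb-++ (c ∷ cs) (b ∷ bs) l = ≡.trans (cong (scale c b ⊕_) (linComb-++ cs bs (ℕP.suc-injective l))) (sym (⊕-assoc _ _ _))

  linComb-toList : ∀ {m n} (bs : Vec (V n) m) (x : V m) → linComb (toList x) (toList bs) ≡ combine bs x
  linComb-toList [] [] = ≡.refl
  linComb-toList (b ∷ bs) (c ∷ x) = cong (scale c b ⊕_) (linComb-toList bs x)

  combine-⊕ : ∀ {m n} (bs : Vec (V n) m) x y → combine bs (x ⊕ y) ≡ combine bs x ⊕ combine bs y
  combine-⊕ [] [] [] = sym (⊕-identityˡ 0v)
  combine-⊕ (b ∷ bs) (c ∷ x) (d ∷ y) = ≡.trans (cong₂ _⊕_ (scale-+F c d b) (combine-⊕ bs x y)) (⊕-interchange _ _ _ _)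

  combine-scale : ∀ {m n} (bs : Vec (V n) m) c x → combine bs (scale c x) ≡ scale c (combine bs x)
  combine-scale [] c [] = sym (scale-0v c)
  combine-scale (b ∷ bs) c (d ∷ x) = ≡.trans (cong₂ _⊕_ (sym (scale-scale c d b)) (combine-scale bs c x)) (sym (scale-⊕ c _ _))

  vectorise : ∀ {A : Set} {n} (xs : List A) → length xs ≡ n → ∃ λ (v : Vec A n) → toList v ≡ xs
  vectorise [] ≡.refl = [] , ≡.refl
  vectorise (x ∷ xs) ≡.refl = let v , e = vectorise xs ≡.refl in x ∷ v , cong (x ∷_) e

  -- For n independent vectors, forming combinations is an injective map from the finite set `V n`
  -- to itself, hence onto.
  basis-spans : ∀ {n} (bs : List (V n)) → IsBasis n bs → ∀ x → ∃ λ ks → length ks ≡ n × linComb ks bs ≡ x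
  basis-spans {n} bs (ind , len) x with vectorise bs len
  ... | v , e with injective⇒onto _≟V_ (size-V n) (size-V n) (combine v) (λ _ _ → tt) (λ x y _ _ → inj x y) x tt
    where
    zeros : ∀ {n} (x : V n) → All (_≡ 0F) (toList x) → x ≡ 0v
    zeros [] [] = ≡.refl
    zeros (_ ∷ x) (≡.refl ∷ z) = cong (0F ∷_) (zeros x z)
    inj : ∀ x y → combine v x ≡ combine v y → x ≡ y
    inj x y eq = difference-zero x y (zeros _ (ind (toList (x ⊕ scale (-F 1F) y)) (≡.trans (length-toList (x ⊕ scale (-F 1F) y)) (sym len)) (begin
      linComb (toList (x ⊕ scale (-F 1F) y)) bs ≡⟨ cong (linComb (toList (x ⊕ scale (-F 1F) y))) (sym e) ⟩
      linComb (toList (x ⊕ scale (-F 1F) y)) (toList v) ≡⟨ linComb-toList v _ ⟩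
      combine v (x ⊕ scale (-F 1F) y) ≡⟨ combine-⊕ v x _ ⟩
      combine v x ⊕ combine v (scale (-F 1F) y) ≡⟨ cong₂ _⊕_ eq (combine-scale v _ y) ⟩
      combine v y ⊕ scale (-F 1F) (combine v y) ≡⟨ ⊕-inverseʳ _ ⟩
      0v ∎)))
      where open ≡.≡-Reasoning
  ... | y , _ , eq = toList y , length-toList y , ≡.trans (cong (linComb (toList y)) (sym e)) (≡.trans (linComb-toList v y) eq)

  -- Cuts the scalars in front of the cyclic basis into one polynomial per generator; this is the
  -- passage from linear to polynomial combinations.
  chunk : ∀ ss (ks : List K) → length ks ≡ sum (map dim ss) → ∃ λ cs → concat cs ≡ ks × Pointwise HasDim cs ss
  chunk [] [] l = [] , ≡.refl , []
  chunk (s ∷ ss) ks l with chunk ss (drop (dim s) ks) (≡.trans (length-drop (dim s) ks) (≡.trans (cong (ℕ._∸ dim s) l) (ℕP.m+n∸m≡n (dim s) _)))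
  ... | cs , e , p = take (dim s) ks ∷ cs , ≡.trans (cong (take (dim s) ks ++_) e) (take++drop≡id (dim s) ks) ,
        ≡.trans (length-take (dim s) ks) (ℕP.m≤n⇒m⊓n≡m (subst (dim s ≤_) (sym l) (ℕP.m≤m+n (dim s) _))) ∷ p

  Reduction : Poly → Poly × ℕ → Poly → Set
  Reduction c s r = HasDim r s × ∃ λ t → c ≈ modulus s * t + r

  reduction : ∀ c s → Monic (proj₁ s) → ∃ λ r → Reduction c s r
  reduction c s m with modulus-monic s m
  ... | m₀ , em , lm = let t , r , lr , _ , e = divMod m₀ c in
        r , ≡.trans lr lm , t , ≈-trans e (+-cong (*-cong (ℙ.reflexive (sym em)) ≈-refl) ≈-refl)

  module _ {n : ℕ} (A : Mat n) where
    open Act A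

    -- Stated for any orbit `g` of `A`, so that the induction can continue with the orbit starting
    -- at `g 1`.
    powers-• : ∀ cs (g : ℕ → V n) → (∀ i → g (suc i) ≡ A ▹ g i) → linComb cs (applyUpTo g (length cs)) ≡ cs • g 0
    powers-• [] g h = sym ([]-• _)
    powers-• (c ∷ cs) g h = ≡.trans (cong (scale c (g 0) ⊕_) (≡.trans (powers-• cs (λ i → g (suc i)) (λ i → h (suc i)))
      (≡.trans (cong (cs •_) (h 0)) (sym (A-•-comm cs (g 0)))))) (sym (∷-• c cs (g 0)))

    powerList : V n → ℕ → List (V n)
    powerList v k = map (λ i → powApply A i v) (upTo k)

    length-powerList : ∀ v k → length (powerList v k) ≡ k
    length-powerList v k = ≡.trans (length-map _ (upTo k)) (length-applyUpTo (λ i → i) k)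

    powerList-• : ∀ cs v → linComb cs (powerList v (length cs)) ≡ cs • v
    powerList-• cs v = ≡.trans (cong (linComb cs) (map-applyUpTo (λ i → i) (λ i → powApply A i v) (length cs))) (powers-• cs (λ i → powApply A i v) (λ _ → ≡.refl))

    cyclic-comb : ∀ {cs} vs {ss} → length vs ≡ length ss → Pointwise HasDim cs ss →
      linComb (concat cs) (cyclicBasis A (zip vs ss)) ≡ comb cs vs
    cyclic-comb [] l [] = ≡.refl
    cyclic-comb {c ∷ cs} (v ∷ vs) {s ∷ ss} l (h ∷ hs) = ≡.trans
      (linComb-++ c (powerList v (dim s)) (≡.trans h (sym (length-powerList v (dim s)))))
      (cong₂ _⊕_ (subst (λ k → linComb c (powerList v k) ≡ c • v) h (powerList-• c v)) (cyclic-comb vs (ℕP.suc-injective l) hs))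

    length-cyclicBasis : ∀ vs ss → length vs ≡ length ss → length (cyclicBasis A (zip vs ss)) ≡ sum (map dim ss)
    length-cyclicBasis [] [] l = ≡.refl
    length-cyclicBasis (v ∷ vs) (s ∷ ss) l = ≡.trans (length-++ (powerList v (dim s)))
      (cong₂ ℕ._+_ (length-powerList v (dim s)) (length-cyclicBasis vs ss (ℕP.suc-injective l)))

    Independent : List (V n) → List (Poly × ℕ) → Set
    Independent vs ss = ∀ cs → length cs ≡ length ss → comb cs vs ≡ 0v → Pointwise (λ c s → modulus s ∣ c) cs ss

    Annihilated : List (V n) → List (Poly × ℕ) → Set
    Annihilated = Pointwise (λ v s → modulus s • v ≡ 0v)

    zero-coeffs : ∀ p → p ≈ [] → All (_≡ 0F) p
    zero-coeffs [] e = []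
    zero-coeffs (a ∷ p) e = at e 0 ∷ zero-coeffs p (coefs λ i → at e (suc i))

    coeffs-zero : ∀ {p} → All (_≡ 0F) p → p ≈ []
    coeffs-zero [] = ≈-refl
    coeffs-zero (e ∷ es) = cons≈[] e (coeffs-zero es)

    -- The polynomials formed from the scalars are shorter than the monic moduli, so divisibility by
    -- the moduli forces every scalar to be zero.
    Independent⇒LinIndep : ∀ {vs ss} → All (λ s → Monic (proj₁ s)) ss → length vs ≡ length ss → Independent vs ss → LinIndep (cyclicBasis A (zip vs ss))
    Independent⇒LinIndep {vs} {ss} mon l ind ks lk e with chunk ss ks (≡.trans lk (length-cyclicBasis vs ss l))
    ... | cs , ≡.refl , p = AllP.concat⁺ (vanish mon p (ind cs (Pointwise-length p) (≡.trans (sym (cyclic-comb vs l p)) e)))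
      where
      vanish : ∀ {cs ss} → All (λ s → Monic (proj₁ s)) ss → Pointwise HasDim cs ss → Pointwise (λ c s → modulus s ∣ c) cs ss → All (All (_≡ 0F)) cs
      vanish [] [] [] = []
      vanish {c ∷ _} {s ∷ _} (m ∷ ms) (h ∷ hs) (d ∷ ds) with modulus-monic s m
      ... | m₀ , em , lm = zero-coeffs c (monic-∣-short m₀ (ℕP.≤-reflexive (≡.trans h (sym lm))) (∣-respˡ (ℙ.reflexive em) d)) ∷ vanish ms hs ds

    -- Since the moduli annihilate the generators, coefficients can be cut down to the lengths that
    -- occur in scalar combinations of the cyclic basis; a zero remainder then means divisibility.
    reduce : ∀ cs {vs ss} → All (λ s → Monic (proj₁ s)) ss → length cs ≡ length ss → Annihilated vs ss →
      ∃ λ rs → Pointwise HasDim rs ss × comb rs vs ≡ comb cs vs × (All (All (_≡ 0F)) rs → Pointwise (λ c s → modulus s ∣ c) cs ss)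
    reduce [] [] l [] = [] , [] , ≡.refl , λ _ → []
    reduce (c ∷ cs) {v ∷ vs} {s ∷ ss} (m ∷ ms) l (a ∷ as) with reduction c s m | reduce cs ms (ℕP.suc-injective l) as
    ... | r , lr , t , e | rs , lrs , ers , k = r ∷ rs , lr ∷ lrs ,
        cong₂ _⊕_ (sym (≡.trans (≈-• e v) (≡.trans (+-• _ r v) (≡.trans (cong (_⊕ (r • v)) (∣-• (t , ≈-refl) a)) (⊕-identityˡ _))))) ers ,
        λ { (z ∷ zs) → (t , ≈-trans e (≈-trans (+-cong ≈-refl (coeffs-zero z)) (+-identityʳ _))) ∷ k zs }

    LinIndep⇒Independent : ∀ {vs ss} → All (λ s → Monic (proj₁ s)) ss → Annihilated vs ss → LinIndep (cyclicBasis A (zip vs ss)) → Independent vs ss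
    LinIndep⇒Independent {vs} {ss} mon ann li cs lc e with reduce cs mon lc ann
    ... | rs , lr , er , k = k (AllP.concat⁻ (li (concat rs) (≡.trans (len lr) (sym (length-cyclicBasis vs ss (Pointwise-length ann))))
          (≡.trans (cyclic-comb vs (Pointwise-length ann) lr) (≡.trans er e))))
      where
      len : ∀ {rs ss} → Pointwise HasDim rs ss → length (concat rs) ≡ sum (map dim ss)
      len [] = ≡.refl
      len {r ∷ rs} (h ∷ hs) = ≡.trans (length-++ r) (cong₂ ℕ._+_ h (len hs))

    basis⇒Decomp : ∀ {vs ss} → All (λ s → Monic (proj₁ s)) ss → Annihilated vs ss → IsBasis n (cyclicBasis A (zip vs ss)) → Decomp A vs ss
    basis⇒Decomp {vs} {ss} mon ann b@(li , ln) = record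
      { annihilated = ann
      ; spanning = λ x → let ks , lk , e = basis-spans (cyclicBasis A (zip vs ss)) b x
                             cs , ec , p = chunk ss ks (≡.trans lk dims)
                         in cs , Pointwise-length p , ≡.trans (sym (cyclic-comb vs l p)) (≡.trans (cong (λ z → linComb z (cyclicBasis A (zip vs ss))) ec) e)
      ; independent = LinIndep⇒Independent mon ann li
      ; dimension = sym dims }
      where
      l = Pointwise-length ann
      dims : n ≡ sum (map dim ss)
      dims = ≡.trans (sym ln) (length-cyclicBasis vs ss l)

    -- Spanning follows by counting: independence together with the dimension formula makes the
    -- cyclic vectors a basis.
    independent⇒Decomp : ∀ {vs ss} → All (λ s → Monic (proj₁ s)) ss → Annihilated vs ss → Independent vs ss → sum (map dim ss) ≡ n → Decomp A vs ss
    independent⇒Decomp {vs} {ss} mon ann ind e = basis⇒Decomp mon ann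
      (Independent⇒LinIndep mon (Pointwise-length ann) ind , ≡.trans (length-cyclicBasis vs ss (Pointwise-length ann)) e)

  All-summands : ∀ {P : Poly × ℕ → Set} {D} → All (λ e → ∀ l → P (proj₁ e , l)) D → All P (summands D)
  All-summands h = AllP.concat⁺ (AllP.map⁺ (All.map (λ {e} p → AllP.map⁺ (All.universal p (proj₂ e))) h))

  InClass⇒Decomp : ∀ {n} {A : Mat n} {D} → InClass n A D → ∃ λ vs → Decomp A vs (summands D)
  InClass⇒Decomp {A = A} {D} ((valid , _) , vs , ann , b) = vs , basis⇒Decomp A
    (All-summands (All.map (λ h _ → proj₁ (proj₁ h)) valid))
    (Pointwise.map (λ {v} {s} e → ≡.trans (Act.•-def A (modulus s) v) e) ann) b

  opaque
    pmat : ∀ {n} → Poly → Mat n → Mat n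
    pmat P A = mat (Act._•_ A P)

    pmat-▹ : ∀ {n} (A : Mat n) P v → pmat P A ▹ v ≡ Act._•_ A P v
    pmat-▹ A P = mat-▹ (Act.•-linear A P)

  module _ {n : ℕ} (A : Mat n) (P : Poly) where
    private
      module 𝔸 = Act A
      module ℚ = Act (pmat P A)

    pmat-• : ∀ p v → p ℚ.• v ≡ comp p P 𝔸.• v
    pmat-• [] v = ≡.trans (ℚ.[]-• v) (sym (𝔸.[]-• v))
    pmat-• (c ∷ p) v = ≡.trans (ℚ.∷-• c p v) (sym (≡.trans (𝔸.+-• [ c ] _ v) (cong₂ _⊕_ (𝔸.const-• c v)
      (≡.trans (𝔸.*-• P _ v) (≡.trans (cong (P 𝔸.•_) (sym (pmat-• p v))) (sym (pmat-▹ A P (p ℚ.• v))))))))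

    pmat-comb : ∀ cs vs → ℚ.comb cs vs ≡ 𝔸.comb (map (λ c → comp c P) cs) vs
    pmat-comb [] vs = ≡.refl
    pmat-comb (c ∷ cs) [] = ≡.refl
    pmat-comb (c ∷ cs) (v ∷ vs) = cong₂ _⊕_ (pmat-• c v) (pmat-comb cs vs)

  -- `φ` divides `comp ψ P` exactly once. Then K[X]/(φ^l), with X acting as multiplication by `P`,
  -- is K[X]/(ψ^l) for every l.
  record RootLink (P : Poly) (s s′ : Poly × ℕ) : Set where
    field
      irrˢ : MonicIrreducible (proj₁ s)
      irrˢ′ : MonicIrreducible (proj₁ s′)
      same-degree : deg (proj₁ s) ≡ deg (proj₁ s′)
      same-exponent : proj₂ s ≡ proj₂ s′
      root : proj₁ s ∣ comp (proj₁ s′) P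
      simple : ¬ (proj₁ s * proj₁ s ∣ comp (proj₁ s′) P)

  module _ {P : Poly} {φ ψ : Poly} (iφ : MonicIrreducible φ) (iψ : MonicIrreducible ψ)
           (root : φ ∣ comp ψ P) (simple : ¬ (φ * φ ∣ comp ψ P)) where
    private
      u = proj₁ root
      φ∤u : ¬ (φ ∣ u)
      φ∤u (t , e) = simple (t , ≈-trans (proj₂ root) (≈-trans (*-cong ≈-refl e) (≈-sym (*-assoc φ φ t))))

      -- Were `r` prime to `ψ`, their Bezout identity composed with `P` would make `φ` divide 1, as
      -- `φ` divides both `comp r P` and `comp ψ P`.
      φ∣comp : ∀ r → φ ∣ comp r P → ψ ∣ r
      φ∣comp r h with bezout iψ r
      ... | inj₁ d = d
      ... | inj₂ (a , b , e) = ⊥-elim (irreducible-∤1 iφ (∣-resp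
            (≈-trans (≈-sym (≈-trans (comp-+ (a * r) (b * ψ) P) (+-cong (comp-* a r P) (comp-* b ψ P)))) (≈-trans (comp-cong _ [ 1F ] P e) (comp-const 1F P)))
            (∣-+ (∣-*ˡ (comp a P) h) (∣-*ˡ (comp b P) root))))

      strip : ∀ l r → φ ∣ polyPow u l * r → φ ∣ r
      strip zero r h = ∣-resp (*-identityˡ r) h
      strip (suc l) r h with irreducible-prime iφ (∣-resp (≈-trans (*-cong (ℙ.reflexive (pow-suc u l)) ≈-refl) (*-assoc u _ r)) h)
      ... | inj₁ d = ⊥-elim (φ∤u d)
      ... | inj₂ d = strip l r d

      comp-power : ∀ l → comp (polyPow ψ l) P ≈ polyPow φ l * polyPow u l
      comp-power l = ≈-trans (comp-pow ψ l P) (≈-trans (pow-cong l (proj₂ root)) (pow-* l))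
        where
        pow-* : ∀ l → polyPow (φ * u) l ≈ polyPow φ l * polyPow u l
        pow-* zero = ≈-sym (*-identityˡ _)
        pow-* (suc l) = begin
          polyPow (φ * u) (suc l) ≡⟨ pow-suc (φ * u) l ⟩
          φ * u * polyPow (φ * u) l ≈⟨ *-cong ≈-refl (pow-* l) ⟩
          φ * u * (polyPow φ l * polyPow u l) ≈⟨ solve 4 (λ a b c d → a :* b :* (c :* d) := (a :* c) :* (b :* d)) ≈-refl φ u (polyPow φ l) (polyPow u l) ⟩
          φ * polyPow φ l * (u * polyPow u l) ≡⟨ cong₂ _*_ (pow-suc φ l) (pow-suc u l) ⟨
          polyPow φ (suc l) * polyPow u (suc l) ∎
          where open ≈R

    pow-∣-comp : ∀ l → polyPow φ l ∣ comp (polyPow ψ l) P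
    pow-∣-comp l = polyPow u l , comp-power l

    -- Inductively c = ψ^l r, and composing with `P` gives c(P) = φ^l u^l r(P). After cancelling φ^l
    -- one more factor `φ` divides u^l r(P); by simplicity it does not divide `u`, so it divides
    -- r(P), and `ψ` divides `r`.
    pow-pullback : ∀ l c → polyPow φ l ∣ comp c P → polyPow ψ l ∣ c
    pow-pullback zero c h = c , ≈-sym (*-identityˡ c)
    pow-pullback (suc l) c (t , e) with pow-pullback l c (φ * t , ≈-trans e (≈-trans (*-cong (≈-trans (ℙ.reflexive (pow-suc φ l)) (*-comm φ _)) ≈-refl) (*-assoc _ φ t)))
    ... | r , er with φ∣comp r (strip l (comp r P) (t , monic-cancel pow-is-monic (begin
          polyPow φ l * (polyPow u l * comp r P) ≈⟨ *-assoc _ _ _ ⟨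
          polyPow φ l * polyPow u l * comp r P ≈⟨ *-cong (comp-power l) ≈-refl ⟨
          comp (polyPow ψ l) P * comp r P ≈⟨ comp-* (polyPow ψ l) r P ⟨
          comp (polyPow ψ l * r) P ≈⟨ comp-cong c (polyPow ψ l * r) P er ⟨
          comp c P ≈⟨ e ⟩
          polyPow φ (suc l) * t ≈⟨ *-cong (≈-trans (ℙ.reflexive (pow-suc φ l)) (*-comm φ _)) ≈-refl ⟩
          polyPow φ l * φ * t ≈⟨ *-assoc _ φ t ⟩
          polyPow φ l * (φ * t) ∎)))
      where
      open ≈R
      pow-is-monic : Monic (polyPow φ l)
      pow-is-monic with modulus-monic (φ , l) (proj₁ iφ)
      ... | m , em , _ = m , em
    ... | w , ew = w , ≈-trans er (≈-trans (*-cong ≈-refl ew) (≈-trans (≈-sym (*-assoc _ ψ w)) (*-cong (≈-trans (*-comm _ ψ) (ℙ.reflexive (sym (pow-suc ψ l)))) ≈-refl)))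

  -- The generators stay the same: a polynomial `c` acts through P(A) as `comp c P` acts through A,
  -- so annihilation and independence are translated by `pow-∣-comp` and `pow-pullback`.
  transfer : ∀ {n} {A : Mat n} {P vs ss ss′} → Pointwise (RootLink P) ss ss′ → Decomp A vs ss → Decomp (pmat P A) vs ss′
  transfer {A = A} {P} {vs} {ss} {ss′} lk D = independent⇒Decomp (pmat P A) (monic lk) (ann lk annihilated)
    (λ cs lc e → pull lk (independent (map (λ c → comp c P) cs) (≡.trans (length-map _ cs) (≡.trans lc (sym (Pointwise-length lk)))) (≡.trans (sym (pmat-comb A P cs vs)) e)))
    (≡.trans (sym (dims lk)) dimension)
    where
    open Decomp D
    open RootLink
    monic : ∀ {ss ss′} → Pointwise (RootLink P) ss ss′ → All (λ s → Monic (proj₁ s)) ss′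
    monic [] = []
    monic (l ∷ ls) = proj₁ (irrˢ′ l) ∷ monic ls
    ann : ∀ {vs ss ss′} → Pointwise (RootLink P) ss ss′ → Annihilated A vs ss → Annihilated (pmat P A) vs ss′
    ann [] [] = []
    ann {v ∷ _} {(φ , l) ∷ _} {(ψ , l′) ∷ _} (x ∷ xs) (a ∷ as) with same-exponent x
    ... | ≡.refl = ≡.trans (pmat-• A P (polyPow ψ l) v) (Act.∣-• A (pow-∣-comp (irrˢ x) (irrˢ′ x) (root x) (simple x) l) a) ∷ ann xs as
    pull : ∀ {cs ss ss′} → Pointwise (RootLink P) ss ss′ → Pointwise (λ c s → modulus s ∣ c) (map (λ c → comp c P) cs) ss → Pointwise (λ c s → modulus s ∣ c) cs ss′
    pull {[]} [] [] = []
    pull {c ∷ _} {(φ , l) ∷ _} {(ψ , l′) ∷ _} (x ∷ xs) (d ∷ ds) with same-exponent x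
    ... | ≡.refl = pow-pullback (irrˢ x) (irrˢ′ x) (root x) (simple x) l c d ∷ pull xs ds
    dims : ∀ {ss ss′} → Pointwise (RootLink P) ss ss′ → sum (map dim ss) ≡ sum (map dim ss′)
    dims [] = ≡.refl
    dims (x ∷ xs) = cong₂ ℕ._+_ (cong₂ ℕ._*_ (same-degree x) (same-exponent x)) (dims xs)

  summands-↭ : ∀ {D D′} → D ↭ D′ → summands D ↭ summands D′
  summands-↭ refl = ↭-refl
  summands-↭ (prep e p) = ++⁺ˡ (map (λ l → (proj₁ e , l)) (proj₂ e)) (summands-↭ p)
  summands-↭ (swap e f p) = ↭-trans (shifts (map (λ l → (proj₁ e , l)) (proj₂ e)) (map (λ l → (proj₁ f , l)) (proj₂ f)))
    (++⁺ˡ (map (λ l → (proj₁ f , l)) (proj₂ f)) (++⁺ˡ (map (λ l → (proj₁ e , l)) (proj₂ e)) (summands-↭ p)))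
  summands-↭ (trans p r) = ↭-trans (summands-↭ p) (summands-↭ r)

  entryType : Poly × List ℕ → ℕ × List ℕ
  entryType e = deg (proj₁ e) , proj₂ e

  -- Chinese remaindering prescribes `P` only modulo the squares of the irreducibles: whether `φ`
  -- divides `comp ψ P` exactly once is decided modulo φ², whatever the parts of the partition are.
  linking-polynomial : ∀ D D′ → All (λ e → MonicIrreducible (proj₁ e)) D → All (λ e → MonicIrreducible (proj₁ e)) D′ →
    AllPairs (λ e f → proj₁ e ≢ proj₁ f) D → typeOf D ≡ typeOf D′ → ∃ λ P → Pointwise (RootLink P) (summands D) (summands D′)
  linking-polynomial D D′ irr irr′ dist eq = P , links D D′ irr irr′ eq (proj₂ (chinese-remainder (targets D D′ irr irr′ eq) (coprime D D′ irr irr′ dist eq)))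
    where
    head-degree : ∀ {e e′ : Poly × List ℕ} {D D′} → typeOf (e ∷ D) ≡ typeOf (e′ ∷ D′) → deg (proj₁ e) ≡ deg (proj₁ e′)
    head-degree eq = cong proj₁ (proj₁ (∷-injective eq))
    tail-types : ∀ {e e′ : Poly × List ℕ} {D D′} → typeOf (e ∷ D) ≡ typeOf (e′ ∷ D′) → typeOf D ≡ typeOf D′
    tail-types eq = proj₂ (∷-injective eq)
    targets : ∀ D D′ → All (λ e → MonicIrreducible (proj₁ e)) D → All (λ e → MonicIrreducible (proj₁ e)) D′ → typeOf D ≡ typeOf D′ → List (Poly × Poly)
    targets [] _ _ _ _ = []
    targets (e ∷ D) (e′ ∷ D′) (i ∷ is) (i′ ∷ is′) eq = (polyPow (proj₁ e) 2 , proj₁ (simple-root i i′ (head-degree {e} {e′} {D} {D′} eq))) ∷ targets D D′ is is′ (tail-types {e} {e′} eq)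
    coprime : ∀ D D′ (is : All (λ e → MonicIrreducible (proj₁ e)) D) (is′ : All (λ e → MonicIrreducible (proj₁ e)) D′) → AllPairs (λ e f → proj₁ e ≢ proj₁ f) D →
      (eq : typeOf D ≡ typeOf D′) → AllPairs (λ e f → Coprime (proj₁ e) (proj₁ f)) (targets D D′ is is′ eq)
    coprime [] _ _ _ _ _ = []
    coprime (e ∷ D) (e′ ∷ D′) (i ∷ is) (i′ ∷ is′) (n ∷ ns) eq = all D D′ is is′ n (tail-types {e} {e′} eq) ∷ coprime D D′ is is′ ns (tail-types {e} {e′} eq)
      where
      all : ∀ D D′ is is′ → All (λ f → proj₁ e ≢ proj₁ f) D → (eq : typeOf D ≡ typeOf D′) → All (λ f → Coprime (polyPow (proj₁ e) 2) (proj₁ f)) (targets D D′ is is′ eq)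
      all [] _ _ _ _ _ = []
      all (f ∷ D) (f′ ∷ D′) (j ∷ is) (_ ∷ is′) (n ∷ ns) eq = coprime-pows 2 2 (distinct-coprime i j n) ∷ all D D′ is is′ ns (tail-types {f} {f′} eq)
    P = proj₁ (chinese-remainder (targets D D′ irr irr′ eq) (coprime D D′ irr irr′ dist eq))
    square : ∀ φ → polyPow φ 2 ≈ φ * φ
    square φ = ≈-trans (ℙ.reflexive (pow-suc φ 1)) (*-cong ≈-refl (pow-1 φ))
    link : ∀ {φ ψ} l (i : MonicIrreducible φ) (i′ : MonicIrreducible ψ) (d : deg φ ≡ deg ψ) → polyPow φ 2 ∣ P + neg1 * proj₁ (simple-root i i′ d) → RootLink P (φ , l) (ψ , l)
    link {φ} {ψ} l i i′ d (s , e) with simple-root i i′ d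
    ... | P₀ , r , ns with comp-congruent ψ P₀ (φ * φ) s
    ... | t , et = record { irrˢ = i ; irrˢ′ = i′ ; same-degree = d ; same-exponent = ≡.refl
        ; root = ∣-resp (≈-sym expand) (∣-+ r (φ * t , *-assoc φ φ t))
        ; simple = λ h → ns (∣-cancel (∣-resp (≈-trans expand (ℙ.+-comm _ _)) h) (t , ≈-refl)) }
      where
      expand : comp ψ P ≈ comp ψ P₀ + φ * φ * t
      expand = ≈-trans (comp-arg ψ (≈-trans (≈-sym (add-back P₀ P)) (+-cong ≈-refl (≈-trans e (*-cong (square φ) ≈-refl))))) et
    links : ∀ D D′ is is′ eq → All (λ e → proj₁ e ∣ P + neg1 * proj₂ e) (targets D D′ is is′ eq) → Pointwise (RootLink P) (summands D) (summands D′)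
    links [] [] _ _ _ _ = []
    links (e ∷ D) (e′ ∷ D′) (i ∷ is) (i′ ∷ is′) eq (h ∷ hs) = ++⁺ (block (proj₂ e) (proj₂ e′) (cong proj₂ (proj₁ (∷-injective eq)))) (links D D′ is is′ (tail-types {e} {e′} eq) hs)
      where
      block : ∀ κ κ′ → κ ≡ κ′ → Pointwise (RootLink P) (map (proj₁ e ,_) κ) (map (proj₁ e′ ,_) κ′)
      block [] _ ≡.refl = []
      block (l ∷ κ) _ ≡.refl = link l i i′ (head-degree {e} {e′} {D} {D′} eq) h ∷ block κ κ ≡.refl

  -- Two data of one type agree only up to permutation, so the data of `B` are first reordered to
  -- match those of `A` entry by entry. P(A) and B then have the same summands.
  polynomial-conjugate : ∀ {n} {A B : Mat n} {t} → HasType n A t → HasType n B t → ∃ λ P → Conj (pmat P A) B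
  polynomial-conjugate {A = A} {B} (D , inA , tA) (D′ , inB , tB) with ↭-map-inv entryType {xs = D′} (trans tB (↭-sym tA))
  ... | D″ , eq , p with InClass⇒Decomp inA | InClass⇒Decomp inB
  ... | vs , dA | ws , dB with linking-polynomial D D″ (All.map proj₁ (proj₁ (proj₁ inA))) (All-resp-↭ p (All.map proj₁ (proj₁ (proj₁ inB)))) (proj₂ (proj₁ inA)) eq
  ... | P , lk = P , same-summands⇒Conj (transfer lk dA) (proj₂ (Decomp-↭ (summands-↭ p) dB))

-- Conjugacy classes of one type meet the block diagonal matrices equally often.

module TypeCount {q : ℕ} (F : FiniteField q) where
  open import Data.Nat.Base using (_≤_)
  import Data.Nat.Properties as ℕP
  open import Data.Fin.Base using (toℕ)
  open import Data.Product using (∃; _×_; _,_; proj₁; proj₂)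
  open import Relation.Nullary
  open import Relation.Binary.PropositionalEquality
  open Counting
  open PolyRing F
  open PolyArith F
  open Roots F
  open Lin F
  open Action F
  open Basis F
  open LinAlg F

  module _ {n : ℕ} where
    •-Conj : ∀ P {g x y : Mat n} → g · x ≡ y · g → g · pmat P x ≡ pmat P y · g
    •-Conj P {g} {x} {y} c = mat-ext λ v → begin
      (g · pmat P x) ▹ v ≡⟨ ·-▹ g (pmat P x) v ⟩
      g ▹ (pmat P x ▹ v) ≡⟨ cong (g ▹_) (pmat-▹ x P v) ⟩
      g ▹ (Act._•_ x P v) ≡⟨ •-hom {A = x} {y} (▹-linear g) (λ v → trans (sym (·-▹ g x v)) (trans (cong (_▹ v) c) (·-▹ y g v))) P v ⟩
      Act._•_ y P (g ▹ v) ≡⟨ pmat-▹ y P (g ▹ v) ⟨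
      pmat P y ▹ (g ▹ v) ≡⟨ ·-▹ (pmat P y) g v ⟨
      (pmat P y · g) ▹ v ∎
      where open ≡-Reasoning

    class-size : (A : Mat n) → ∃ λ k → HasSize (Conj A) k
    class-size A = size-⊤-filter (size-Mat n) (Conj? A)

    module _ {A B : Mat n} (P : Poly) (PA~B : Conj (pmat P A) B) where
      pmat-class : ∀ x → Conj A x → Conj B (pmat P x)
      pmat-class x (g , hg , c) = Conj-trans {A = B} {pmat P A} {pmat P x} (Conj-sym {A = pmat P A} {B} PA~B) (g , hg , •-Conj P {g} {A} {x} c)

      -- Polynomials commute with conjugation: if `k` conjugates P(A) to `y`, then `y` is P of the
      -- conjugate of A by `k`.
      pmat-class-onto : ∀ y → Conj B y → ∃ λ x → Conj A x × pmat P x ≡ y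
      pmat-class-onto y B~y with Conj-trans {A = pmat P A} {B} {y} PA~B B~y
      ... | k , hk@(k′ , e , f) , c = x , (k , hk , sym c′) , (begin
          pmat P x ≡⟨ cancel-invʳ k k′ e (pmat P x) ⟨
          (pmat P x · k) · k′ ≡⟨ cong (_· k′) (trans (sym (•-Conj P {k} {A} {x} (sym c′))) c) ⟩
          (y · k) · k′ ≡⟨ cancel-invʳ k k′ e y ⟩
          y ∎)
        where
        open ≡-Reasoning
        x = (k · A) · k′
        c′ : x · k ≡ k · A
        c′ = cancel-invʳ k′ k f (k · A)

      class-size-≥ : ∀ {k l} → HasSize (Conj A) k → HasSize (Conj B) l → l ≤ k
      class-size-≥ hk hl = size-≤ {R = λ y x → pmat P x ≡ y} (λ y B~y → pmat-class-onto y B~y)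
        (λ { _ _ _ _ _ refl refl → refl }) hl hk

      -- Invertibility is inherited from `B`, to which the image is conjugate; the block shape
      -- survives because a matrix commuting with the masks passes this on to all its polynomials.
      pmat-GLν : ∀ ν x → GL n B → Conj A x → GLν n ν x → GLν n ν (pmat P x)
      pmat-GLν ν x hB c (_ , d) = GL-Conj {A = B} {pmat P x} hB (pmat-class x c) , Preserves⇒BlockDiagonal blk (pmat P x)
        (preserves λ b v → trans (pmat-▹ x P _) (trans (sym (•-hom {A = x} {x} (mask-linear blk b) (λ v → sym (commutes p b v)) P v)) (cong (mask blk b) (sym (pmat-▹ x P v)))))
        where
        blk = λ i → blockOf ν (toℕ i)
        p = BlockDiagonal⇒Preserves blk x d

      -- A surjection between finite sets of equal size is injective, so no inverse of P is needed.
      count-≤ : ∀ {m ν k l} → HasSize (Conj A) m → HasSize (Conj B) m → GL n B →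
        HasSize (λ g → GLν n ν g × Conj A g) k → HasSize (λ g → GLν n ν g × Conj B g) l → k ≤ l
      count-≤ {ν = ν} hA hB gB = size-≤ {R = λ x y → pmat P x ≡ y}
        (λ x h → pmat P x , (pmat-GLν ν x gB (proj₂ h) (proj₁ h) , pmat-class x (proj₂ h)) , refl)
        (λ x x′ y h h′ e e′ → onto⇒injective _≟M_ hA hB (pmat P) pmat-class-onto x x′ (proj₂ h) (proj₂ h′) (trans e (sym e′)))

    same-type-count : ∀ {A B : Mat n} {t ν k l} → GL n A → GL n B → HasType n A t → HasType n B t →
      CountInClass n ν A k → CountInClass n ν B l → k ≡ l
    same-type-count {A} {B} {ν = ν} {k} {l} gA gB tA tB hk hl = compare (polynomial-conjugate tA tB) (polynomial-conjugate tB tA) (class-size A) (class-size B)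
      where
      compare : (∃ λ P → Conj (pmat P A) B) → (∃ λ P → Conj (pmat P B) A) → (∃ λ a → HasSize (Conj A) a) → (∃ λ b → HasSize (Conj B) b) → k ≡ l
      compare (P , p) (Q , r) (a , hA) (b , hB) with ℕP.≤-antisym (class-size-≥ Q r hB hA) (class-size-≥ P p hA hB)
      ... | refl = ℕP.≤-antisym (count-≤ P p {ν = ν} hA hB gB hk hl) (count-≤ Q r {ν = ν} hB hA gA hl hk)

-- Kernels of powers of irreducibles; the type as a conjugacy invariant.

module Kernel {q : ℕ} (F : FiniteField q) where
  open import Data.Nat.Base as ℕ using (zero; suc; _≤_; _<_; z≤n; s≤s; _^_; _⊓_; _∸_)
  import Data.Nat.Properties as ℕP
  open import Data.Nat.ListAction using (product)
  open import Data.Nat.ListAction.Properties using (product-++)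
  open import Data.List.Base using (List; []; _∷_; length; map; [_])
  open import Data.List.Properties using (length-map; length-zipWith; map-++)
  open import Data.List.Relation.Unary.All as All using (All; []; _∷_)
  open import Data.List.Relation.Unary.AllPairs as AllPairs using (AllPairs; []; _∷_)
  open import Data.List.Relation.Unary.Any using (here; there; any?)
  open import Data.List.Relation.Unary.Linked as Linked using (Linked; []; [-]; _∷_)
  open import Data.List.Relation.Unary.Unique.Propositional using (Unique)
  open import Data.List.Membership.Propositional using (_∈_; find)
  open import Data.List.Relation.Binary.Pointwise using (Pointwise; []; _∷_; Pointwise-length)
  open import Data.List.Relation.Binary.Permutation.Propositional using (_↭_; ↭-sym; ↭-trans)
  open import Data.List.Relation.Binary.Permutation.Propositional.Properties using (map⁺)
  open import Data.Fin.Base using (Fin)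
  open import Data.List.Relation.Unary.All.Properties using (¬Any⇒All¬)
  open import Data.Product using (∃; _×_; _,_; proj₁; proj₂)
  open import Data.Empty using (⊥; ⊥-elim)
  open import Relation.Nullary
  open import Relation.Binary.Definitions using (tri<; tri≈; tri>)
  open import Relation.Binary.PropositionalEquality as ≡ using (_≡_; _≢_; cong; cong₂; subst; subst₂; sym)
  open Counting
  open PolyRing F
  open PolyArith F
  open Roots F
  open Lin F
  open Action F
  open Basis F
  open LinAlg F
  open ℙ using (+-cong; *-cong; *-assoc; +-identityʳ; *-identityˡ)
  open ℙSolver using (solve; _:=_; _:+_; _:*_)
  import Relation.Binary.Reasoning.Setoid ℙ.setoid as ≈R

  Cong : Poly → Poly → Poly → Set
  Cong m x y = m ∣ x + neg1 * y

  cong-sym : ∀ {m} x y → Cong m x y → Cong m y x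
  cong-sym x y h = ∣-cancel (∣-resp (≈-sym (begin
      (x + neg1 * y) + (y + neg1 * x) ≈⟨ solve 3 (λ x y n → (x :+ n :* y) :+ (y :+ n :* x) := (x :+ n :* x) :+ (y :+ n :* y)) ≈-refl x y neg1 ⟩
      (x + neg1 * x) + (y + neg1 * y) ≈⟨ +-cong (neg1-cancel x) (neg1-cancel y) ⟩
      [] + [] ≈⟨ +-identityʳ [] ⟩
      [] ∎)) ∣-zero) h
    where open ≈R

  cong-trans : ∀ {m} x y z → Cong m x y → Cong m y z → Cong m x z
  cong-trans x y z h k = ∣-resp (begin
      (x + neg1 * y) + (y + neg1 * z) ≈⟨ solve 4 (λ x y z n → (x :+ n :* y) :+ (y :+ n :* z) := (x :+ n :* z) :+ (y :+ n :* y)) ≈-refl x y z neg1 ⟩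
      (x + neg1 * z) + (y + neg1 * y) ≈⟨ +-cong ≈-refl (neg1-cancel y) ⟩
      (x + neg1 * z) + [] ≈⟨ +-identityʳ _ ⟩
      x + neg1 * z ∎) (∣-+ h k)
    where open ≈R

  cong-∣ : ∀ {m} f x y → Cong m x y → m ∣ f * y → m ∣ f * x
  cong-∣ f x y h k = ∣-resp (≈-trans (≈-sym (ℙ.distribˡ f y _)) (*-cong ≈-refl (add-back y x))) (∣-+ k (∣-*ˡ f h))

  cong-*ˡ : ∀ {m} p x y → Cong m x y → Cong (p * m) (p * x) (p * y)
  cong-*ˡ {m} p x y (s , e) = s , ≈-trans (solve 4 (λ p x y n → p :* x :+ n :* (p :* y) := p :* (x :+ n :* y)) ≈-refl p x y neg1)
    (≈-trans (*-cong ≈-refl e) (≈-sym (*-assoc p m s)))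

  cong-cancel : ∀ {p m} x y → Monic p → Cong (p * m) (p * x) (p * y) → Cong m x y
  cong-cancel {p} {m} x y mon (s , e) = s , monic-cancel mon (begin
      p * (x + neg1 * y) ≈⟨ solve 4 (λ p x y n → p :* (x :+ n :* y) := p :* x :+ n :* (p :* y)) ≈-refl p x y neg1 ⟩
      p * x + neg1 * (p * y) ≈⟨ e ⟩
      p * m * s ≈⟨ *-assoc p m s ⟩
      p * (m * s) ∎)
    where open ≈R

  reduced-unique : ∀ s → Monic (proj₁ s) → ∀ c c′ → HasDim c s → HasDim c′ s → Cong (modulus s) c′ c → c ≡ c′
  reduced-unique s mon c c′ h h′ d with modulus-monic s mon
  ... | m , em , lm = difference-short (m , em) c c′ (≡.trans h (sym deg-m)) (≡.trans h′ (sym deg-m)) d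
    where
    deg-m : deg (modulus s) ≡ dim s
    deg-m = ≡.trans (cong deg em) (≡.trans (deg-snoc m 1F) lm)

  reduction-cong : ∀ {c s r} → Reduction c s r → Cong (modulus s) r c
  reduction-cong {c} {s} {r} (_ , t , e) = cong-sym c r (t , ≈-trans (+-cong e ≈-refl)
    (≈-trans (ℙ.+-assoc _ r _) (≈-trans (+-cong ≈-refl (neg1-cancel r)) (+-identityʳ _))))

  -- Canonical representatives of the kernel of `f` on the cyclic module K[X]/(modulus s).
  Killed : Poly → Poly × ℕ → Poly → Set
  Killed f s c = HasDim c s × modulus s ∣ f * c

  pow-is-monic : ∀ {φ} → Monic φ → ∀ k → Monic (polyPow φ k)
  pow-is-monic {φ} mon k with modulus-monic (φ , k) mon
  ... | m , e , _ = m , e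

  -- The kernel of φ^k on K[X]/(φ^l) consists of the multiples of φ^(l ∸ k), and multiplication by
  -- this power identifies it with the residues modulo φ^(l ⊓ k). Truncated subtraction covers k >
  -- l, where everything is killed.
  killed-size-same : ∀ {φ} → Monic φ → ∀ k l → HasSize (Killed (polyPow φ k) (φ , l)) (q ^ (deg φ ℕ.* (l ⊓ k)))
  killed-size-same {φ} mon k l = size-corr {R = λ e c → Cong (polyPow φ l) c (p * e)}
    (record
      { total = λ e le → let r , red = reduction (p * e) (φ , l) mon in
          r , (proj₁ red , cong-∣ (polyPow φ k) r (p * e) (reduction-cong {p * e} {φ , l} red) (killed-p e)) , reduction-cong {p * e} {φ , l} red
      ; onto = λ c h → onto c (p∣ c (proj₂ h))
      ; inj = λ e e′ c le le′ x y → reduced-unique (φ , m) mon e e′ le le′ (cong-cancel e′ e (pow-is-monic mon (l ∸ k))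
          (∣-respˡ split (cong-trans (p * e′) c (p * e) (cong-sym c (p * e′) y) x)))
      ; fun = λ e c c′ _ h h′ x y → reduced-unique (φ , l) mon c c′ (proj₁ h) (proj₁ h′) (cong-trans c′ (p * e) c y (cong-sym c (p * e) x)) })
    (size-length (deg φ ℕ.* m))
    where
    m = l ⊓ k
    p = polyPow φ (l ∸ k)
    split : polyPow φ l ≈ p * polyPow φ m
    split = ≈-trans (ℙ.reflexive (cong (polyPow φ) (sym (≡.trans (ℕP.+-comm (l ∸ k) m) (≡.trans (cong (ℕ._+ (l ∸ k)) (ℕP.⊓-comm l k)) (ℕP.m⊓n+n∸m≡n k l)))))) (pow-+ φ (l ∸ k) m)
    killed-p : ∀ e → polyPow φ l ∣ polyPow φ k * (p * e)
    killed-p e = ∣-resp (*-assoc (polyPow φ k) p e) (∣-*ʳ e (∣-resp (pow-+ φ k (l ∸ k)) (pow-∣ φ (ℕP.m≤n+m∸n l k))))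
    p∣ : ∀ c → polyPow φ l ∣ polyPow φ k * c → p ∣ c
    p∣ c h with k ℕP.≤? l
    ... | yes k≤l = let s , e = ∣-respˡ (≈-trans (ℙ.reflexive (cong (polyPow φ) (sym (ℕP.m+[n∸m]≡n k≤l)))) (pow-+ φ k (l ∸ k))) h
                    in s , monic-cancel (pow-is-monic mon k) (≈-trans e (*-assoc (polyPow φ k) p s))
    ... | no k≰l = subst (λ z → polyPow φ z ∣ c) (sym (ℕP.m≤n⇒m∸n≡0 (ℕP.≰⇒≥ k≰l))) (c , ≈-sym (*-identityˡ c))
    onto : ∀ c → p ∣ c → ∃ λ e → length e ≡ deg φ ℕ.* m × Cong (polyPow φ l) c (p * e)
    onto c (s , e) = let r , red = reduction s (φ , m) mon in r , proj₁ red ,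
      ∣-respˡ (≈-sym split) (∣-resp (+-cong (≈-sym e) ≈-refl) (cong-*ˡ p s r (cong-sym r s (reduction-cong {s} {φ , m} red))))

  zero-of-length : ∀ d → length (pad d []) ≡ d
  zero-of-length d = length-pad d [] z≤n

  killed-size-coprime : ∀ {f} s → Monic (proj₁ s) → Coprime f (modulus s) → HasSize (Killed f s) 1
  killed-size-coprime {f} s mon cop = [ pad (dim s) [] ] , ([] ∷ []) ,
    (λ { _ (here ≡.refl) → zero-of-length (dim s) , ∣-*ˡ f (∣-resp (pad-≈ (dim s) []) ∣-zero) }) ,
    (λ { c (h , d) → here (≈⇒≡ c _ (≡.trans h (sym (zero-of-length (dim s)))) (≈-trans (short c h (coprime-∣ cop d)) (pad-≈ (dim s) []))) }) , ≡.refl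
    where
    short : ∀ c → HasDim c s → modulus s ∣ c → c ≈ []
    short c h d with modulus-monic s mon
    ... | m , em , lm = monic-∣-short m (ℕP.≤-reflexive (≡.trans h (sym lm))) (∣-respˡ (ℙ.reflexive em) d)

  module _ {n : ℕ} {A : Mat n} {vs ss} (D : Decomp A vs ss) (mon : All (λ s → Monic (proj₁ s)) ss) where
    open Decomp D
    open Act A

    -- `f` acts on each cyclic summand by itself, so a kernel vector amounts to one killed residue
    -- per summand; independence makes the reduced coefficients unique.
    kernel-size : ∀ f (m : Poly × ℕ → ℕ) → All (λ s → HasSize (Killed f s) (m s)) ss → HasSize (λ x → f • x ≡ 0v) (product (map m ss))
    kernel-size f m sizes = size-corr {R = λ cs x → comb cs vs ≡ x}
      (record
        { total = λ cs ks → comb cs vs , ≡.trans (sym (comb-*ˡ f cs vs)) (comb-∣ (map (f *_) cs) annihilated (mapped ks)) , ≡.refl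
        ; onto = λ x h → onto x h (spanning x)
        ; inj = λ cs cs′ x ks ks′ e e′ → unique mon cs cs′ (dims ks) (dims ks′)
            (independent (minus cs′ cs) (≡.trans (length-minus cs′ cs (≡.trans (lengths ks′) (sym (lengths ks)))) (lengths ks′))
              (comb-minus cs′ cs vs (≡.trans (lengths ks′) (sym (lengths ks))) (≡.trans e′ (sym e))))
        ; fun = λ { _ _ _ _ _ _ ≡.refl ≡.refl → ≡.refl } })
      (size-pointwise ss sizes)
      where
      lengths : ∀ {cs ss} → Pointwise (Killed f) ss cs → length cs ≡ length ss
      lengths p = sym (Pointwise-length p)
      length-minus : ∀ (cs ds : List Poly) → length cs ≡ length ds → length (minus cs ds) ≡ length cs
      length-minus cs ds e = ≡.trans (length-zipWith _ cs ds) (≡.trans (cong (length cs ⊓_) (sym e)) (ℕP.⊓-idem _))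
      mapped : ∀ {cs ss} → Pointwise (Killed f) ss cs → Pointwise (λ c s → modulus s ∣ c) (map (f *_) cs) ss
      mapped [] = []
      mapped ((_ , d) ∷ ks) = d ∷ mapped ks
      dims : ∀ {cs ss} → Pointwise (Killed f) ss cs → Pointwise HasDim cs ss
      dims [] = []
      dims ((h , _) ∷ ks) = h ∷ dims ks
      unique : ∀ {ss} → All (λ s → Monic (proj₁ s)) ss → ∀ cs cs′ → Pointwise HasDim cs ss → Pointwise HasDim cs′ ss → Pointwise (λ c s → modulus s ∣ c) (minus cs′ cs) ss → cs ≡ cs′
      unique [] [] [] [] [] [] = ≡.refl
      unique {s ∷ _} (m ∷ ms) (c ∷ cs) (c′ ∷ cs′) (h ∷ hs) (h′ ∷ hs′) (d ∷ ds) = cong₂ _∷_ (reduced-unique s m c c′ h h′ d) (unique ms cs cs′ hs hs′ ds)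
      rebuild : ∀ {cs ss} → Pointwise HasDim cs ss → Pointwise (λ c s → modulus s ∣ c) (map (f *_) cs) ss → Pointwise (Killed f) ss cs
      rebuild [] [] = []
      rebuild (h ∷ hs) (d ∷ ds) = (h , d) ∷ rebuild hs ds
      onto : ∀ x → f • x ≡ 0v → (∃ λ cs → length cs ≡ length ss × comb cs vs ≡ x) → ∃ λ cs → Pointwise (Killed f) ss cs × comb cs vs ≡ x
      onto x h (cs , lc , e) with reduce A cs mon lc annihilated
      ... | rs , hs , er , _ = rs , rebuild hs (independent (map (f *_) rs) (≡.trans (length-map _ rs) (Pointwise-length hs))
            (≡.trans (comb-*ˡ f rs vs) (≡.trans (cong (f •_) (≡.trans er e)) h))) , ≡.trans er e

  Valid : ClassData → Set
  Valid = All (λ e → MonicIrreducible (proj₁ e) × proj₁ e ≢ Xpoly × IsPartition (proj₂ e) × proj₂ e ≢ [])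

  Distinct : ClassData → Set
  Distinct = AllPairs (λ e f → proj₁ e ≢ proj₁ f)

  block : Poly × List ℕ → List (Poly × ℕ)
  block e = map (λ l → (proj₁ e , l)) (proj₂ e)

  monic-summands : ∀ {D} → Valid D → All (λ s → Monic (proj₁ s)) (summands D)
  monic-summands valid = All-summands (All.map (λ h _ → proj₁ (proj₁ h)) valid)

  q>1 : 1 < q
  q>1 = two 0F 1F 0≢1
    where
    two : ∀ {m} (i j : Fin m) → i ≢ j → 1 < m
    two {suc zero} Fin.zero Fin.zero ne = ⊥-elim (ne ≡.refl)
    two {suc (suc m)} _ _ _ = s≤s (s≤s z≤n)

  module _ (φ : Poly) (k : ℕ) where
    -- The size of the kernel of φ^k on K[X]/(ψ^l): a different irreducible `φ` acts there
    -- invertibly.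
    factor : Poly × ℕ → ℕ
    factor (ψ , l) with ψ ≟P φ
    ... | yes _ = q ^ (deg φ ℕ.* (l ⊓ k))
    ... | no _ = 1

    factor-same : ∀ l → factor (φ , l) ≡ q ^ (deg φ ℕ.* (l ⊓ k))
    factor-same l with φ ≟P φ
    ... | yes _ = ≡.refl
    ... | no n = ⊥-elim (n ≡.refl)

    factor-other : ∀ {ψ} l → ψ ≢ φ → factor (ψ , l) ≡ 1
    factor-other {ψ} l ne with ψ ≟P φ
    ... | yes e = ⊥-elim (ne e)
    ... | no _ = ≡.refl

    factor-size : MonicIrreducible φ → ∀ {ψ} → MonicIrreducible ψ → ∀ l → HasSize (Killed (polyPow φ k) (ψ , l)) (factor (ψ , l))
    factor-size iφ {ψ} iψ l with ψ ≟P φ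
    ... | yes ≡.refl = killed-size-same (proj₁ iφ) k l
    ... | no ne = killed-size-coprime (ψ , l) (proj₁ iψ) (coprime-pows k l (distinct-coprime iφ iψ (λ e → ne (sym e))))

    product-same : ∀ κ → product (map factor (block (φ , κ))) ≡ q ^ (deg φ ℕ.* dk κ k)
    product-same [] = cong (q ^_) (sym (ℕP.*-zeroʳ (deg φ)))
    product-same (l ∷ κ) = ≡.trans (cong₂ ℕ._*_ (factor-same l) (product-same κ))
      (≡.trans (sym (ℕP.^-distribˡ-+-* q (deg φ ℕ.* (l ⊓ k)) _)) (cong (q ^_) (sym (ℕP.*-distribˡ-+ (deg φ) (l ⊓ k) _))))

    product-other : ∀ {ψ} κ → ψ ≢ φ → product (map factor (block (ψ , κ))) ≡ 1
    product-other [] ne = ≡.refl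
    product-other (l ∷ κ) ne = ≡.trans (cong₂ ℕ._*_ (factor-other l ne) (product-other κ ne)) ≡.refl

    product-cons : ∀ e D → product (map factor (summands (e ∷ D))) ≡ product (map factor (block e)) ℕ.* product (map factor (summands D))
    product-cons e D = ≡.trans (cong product (map-++ factor (block e) (summands D))) (product-++ (map factor (block e)) _)

    product-absent : ∀ {D} → All (λ e → proj₁ e ≢ φ) D → product (map factor (summands D)) ≡ 1
    product-absent [] = ≡.refl
    product-absent {e ∷ D} (n ∷ ns) = ≡.trans (product-cons e D) (cong₂ ℕ._*_ (product-other (proj₂ e) n) (product-absent ns))

    product-present : ∀ {κ D} → Distinct D → (φ , κ) ∈ D → product (map factor (summands D)) ≡ q ^ (deg φ ℕ.* dk κ k)
    product-present {κ} {e ∷ D} (n ∷ ns) (here ≡.refl) = ≡.trans (product-cons e D) (≡.trans (cong₂ ℕ._*_ (product-same κ) (product-absent (All.map (λ ne e → ne (sym e)) n))) (ℕP.*-identityʳ _))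
    product-present {κ} {e ∷ D} (n ∷ ns) (there i) = ≡.trans (product-cons e D) (≡.trans (cong₂ ℕ._*_ (product-other (proj₂ e) (All.lookup n i)) (product-present ns i)) (ℕP.+-identityʳ _))

    block-kernel-size : ∀ {n} {A : Mat n} {vs D} → MonicIrreducible φ → Valid D → Decomp A vs (summands D) →
      HasSize (λ x → Act._•_ A (polyPow φ k) x ≡ 0v) (product (map factor (summands D)))
    block-kernel-size iφ valid dec = kernel-size dec (monic-summands valid) (polyPow φ k) factor
      (All-summands (All.map (λ h l → factor-size iφ (proj₁ h) l) valid))

  -- The numbers dk κ k, read off from kernel sizes, determine κ: they stop growing exactly at the largest part.
  Decreasing : List ℕ → Set
  Decreasing = Linked (λ a b → b ≤ a)

  below-head : ∀ {a κ} → Decreasing (a ∷ κ) → All (_≤ a) κ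
  below-head [-] = []
  below-head (p ∷ [-]) = p ∷ []
  below-head (p ∷ ps@(_ ∷ _)) = p ∷ All.map (λ x → ℕP.≤-trans x p) (below-head ps)

  dk-stable : ∀ {a κ} → All (_≤ a) κ → dk κ (suc a) ≡ dk κ a
  dk-stable [] = ≡.refl
  dk-stable (p ∷ ps) = cong₂ ℕ._+_ (≡.trans (ℕP.m≤n⇒m⊓n≡m (ℕP.m≤n⇒m≤1+n p)) (sym (ℕP.m≤n⇒m⊓n≡m p))) (dk-stable ps)

  dk-mono : ∀ κ a → dk κ a ≤ dk κ (suc a)
  dk-mono [] a = z≤n
  dk-mono (p ∷ κ) a = ℕP.+-mono-≤ (ℕP.⊓-monoʳ-≤ p (ℕP.n≤1+n a)) (dk-mono κ a)

  dk-grows : ∀ {a b} κ → a < b → dk (b ∷ κ) a < dk (b ∷ κ) (suc a)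
  dk-grows {a} {b} κ lt = ℕP.+-mono-<-≤ (subst₂ _<_ (sym (ℕP.m≥n⇒m⊓n≡n (ℕP.<⇒≤ lt))) (sym (ℕP.m≥n⇒m⊓n≡n lt)) ℕP.≤-refl) (dk-mono κ a)

  dk-determines : ∀ κ κ′ → All (1 ≤_) κ → All (1 ≤_) κ′ → Decreasing κ → Decreasing κ′ → (∀ k → dk κ k ≡ dk κ′ k) → κ ≡ κ′
  dk-determines [] [] _ _ _ _ h = ≡.refl
  dk-determines [] (b ∷ κ′) _ (p ∷ _) _ _ h = ⊥-elim (ℕP.<-irrefl (h 1) (ℕP.≤-trans (subst (λ z → 1 ≤ z) (sym (ℕP.m≥n⇒m⊓n≡n p)) ℕP.≤-refl) (ℕP.m≤m+n (b ⊓ 1) _)))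
  dk-determines (b ∷ κ′) [] (p ∷ _) _ _ _ h = ⊥-elim (ℕP.<-irrefl (sym (h 1)) (ℕP.≤-trans (subst (λ z → 1 ≤ z) (sym (ℕP.m≥n⇒m⊓n≡n p)) ℕP.≤-refl) (ℕP.m≤m+n (b ⊓ 1) _)))
  dk-determines (a ∷ κ) (b ∷ κ′) (p ∷ ps) (p′ ∷ ps′) s s′ h with ℕP.<-cmp a b
  ... | tri< lt _ _ = ⊥-elim (ℕP.<-irrefl (≡.trans (sym (h a)) (≡.trans (sym (dk-stable (ℕP.≤-refl ∷ below-head s))) (h (suc a)))) (dk-grows κ′ lt))
  ... | tri> _ _ gt = ⊥-elim (ℕP.<-irrefl (≡.trans (h b) (≡.trans (sym (dk-stable (ℕP.≤-refl ∷ below-head s′))) (sym (h (suc b))))) (dk-grows κ gt))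
  ... | tri≈ _ ≡.refl _ = cong (a ∷_) (dk-determines κ κ′ ps ps′ (Linked.tail s) (Linked.tail s′) λ k → ℕP.+-cancelˡ-≡ (a ⊓ k) _ _ (h k))

  ^-injective : ∀ a b → q ^ a ≡ q ^ b → a ≡ b
  ^-injective a b e with ℕP.<-cmp a b
  ... | tri< lt _ _ = ⊥-elim (ℕP.<-irrefl e (ℕP.^-monoʳ-< q q>1 lt))
  ... | tri≈ _ eq _ = eq
  ... | tri> _ _ gt = ⊥-elim (ℕP.<-irrefl (sym e) (ℕP.^-monoʳ-< q q>1 gt))

  module _ {n : ℕ} {A B : Mat n} (c : Conj A B) {vs ws D D′} (vD : Valid D) (dD : Distinct D) (vD′ : Valid D′) (dD′ : Distinct D′)
    (decA : Decomp A vs (summands D)) (decB : Decomp B ws (summands D′)) where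
    private
      g = proj₁ c
      gGL = proj₁ (proj₂ c)
      g′ = proj₁ gGL

      intertwine : ∀ p v → g ▹ (Act._•_ A p v) ≡ Act._•_ B p (g ▹ v)
      intertwine = •-hom {A = A} {B} (▹-linear g) λ v → ≡.trans (sym (·-▹ g A v)) (≡.trans (cong (_▹ v) (proj₂ (proj₂ c))) (·-▹ B g v))

      -- A conjugating matrix carries the kernel of φ^k for `A` bijectively onto the one for `B`.
      same-products : ∀ φ k → MonicIrreducible φ → product (map (factor φ k) (summands D)) ≡ product (map (factor φ k) (summands D′))
      same-products φ k iφ = size-unique (size-corr {R = λ x y → g ▹ x ≡ y} (record
        { total = λ x h → g ▹ x , ≡.trans (sym (intertwine (polyPow φ k) x)) (≡.trans (cong (g ▹_) h) (▹-0v g)) , ≡.refl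
        ; onto = λ y h → g′ ▹ y , GL-injective {A = g} gGL _ _ (≡.trans (intertwine (polyPow φ k) (g′ ▹ y)) (≡.trans (cong (Act._•_ B (polyPow φ k)) (undo y)) (≡.trans h (sym (▹-0v g))))) , undo y
        ; inj = λ x x′ y _ _ e e′ → GL-injective {A = g} gGL x x′ (≡.trans e (sym e′))
        ; fun = λ { _ _ _ _ _ _ ≡.refl ≡.refl → ≡.refl } }) (block-kernel-size φ k iφ vD decA)) (block-kernel-size φ k iφ vD′ decB)
        where
        undo : ∀ y → g ▹ (g′ ▹ y) ≡ y
        undo y = ≡.trans (sym (·-▹ g g′ y)) (≡.trans (cong (_▹ y) (proj₁ (proj₂ gGL))) (I-▹ y))

    -- The case k = 1 shows that `φ` occurs in `D′`, since its kernel is nontrivial on the side of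
    -- `D`; all k together then give equal numbers `dk`, and these determine the partition.
    entry-shared : ∀ e → e ∈ D → e ∈ D′
    entry-shared (φ , κ) e∈ with All.lookup vD e∈ | any? (λ e → proj₁ e ≟P φ) D′
    ... | iφ , _ , (pos , dec) , κ≢[] | no none = ⊥-elim (empty κ pos κ≢[] (≡.trans (sym (product-present φ 1 dD e∈)) (≡.trans (same-products φ 1 iφ) (product-absent φ 1 (¬Any⇒All¬ D′ none)))))
      where
      empty : ∀ κ → All (1 ≤_) κ → κ ≢ [] → q ^ (deg φ ℕ.* dk κ 1) ≡ 1 → ⊥
      empty [] _ ne _ = ne ≡.refl
      empty (p ∷ κ) (le ∷ _) _ e = ℕP.<-irrefl (sym (^-injective _ 0 e)) (ℕP.*-mono-≤ (proj₁ (proj₂ iφ)) (ℕP.≤-trans (subst (1 ≤_) (sym (ℕP.m≥n⇒m⊓n≡n le)) ℕP.≤-refl) (ℕP.m≤m+n (p ⊓ 1) _)))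
    ... | iφ , _ , (pos , dec) , _ | yes a with find a
    ... | (φ , κ′) , e′∈ , ≡.refl with All.lookup vD′ e′∈
    ... | _ , _ , (pos′ , dec′) , _ = subst (λ z → (φ , z) ∈ D′) (sym (dk-determines κ κ′ pos pos′ dec dec′ λ k →
          ℕP.*-cancelˡ-≡ _ _ (deg φ) {{ℕ.>-nonZero (proj₁ (proj₂ iφ))}} (^-injective _ _ (≡.trans (sym (product-present φ k dD e∈)) (≡.trans (same-products φ k iφ) (product-present φ k dD′ e′∈)))))) e′∈

  -- Makes the type an invariant of the conjugacy class; otherwise representatives collected under
  -- different types could be conjugate and be counted twice.
  types-agree : ∀ {n} {A B : Mat n} {s t} → HasType n A s → HasType n B t → Conj A B → s ↭ t
  types-agree {A = A} {B} (D , inA , tA) (D′ , inB , tB) c with InClass⇒Decomp inA | InClass⇒Decomp inB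
  ... | vs , decA | ws , decB = ↭-trans (↭-sym tA) (↭-trans (map⁺ entryType (same-members⇒↭ (unique dD) (unique dD′)
        (entry-shared c vD dD vD′ dD′ decA decB) (entry-shared (Conj-sym {A = A} {B} c) vD′ dD′ vD dD decB decA))) tB)
    where
    vD = proj₁ (proj₁ inA)
    dD = proj₂ (proj₁ inA)
    vD′ = proj₁ (proj₁ inB)
    dD′ = proj₂ (proj₁ inB)
    unique : ∀ {D} → Distinct D → Unique D
    unique = AllPairs.map λ ne e → ne (cong proj₁ e)

-- Counting the automorphisms of the module of a matrix.

module Centralizer {q : ℕ} (F : FiniteField q) where
  open import Data.Nat.Base as ℕ using (zero; suc; _≤_; _^_; _⊓_; _∸_)
  import Data.Nat.Properties as ℕP
  open import Data.Nat.ListAction using (product)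
  open import Data.List.Base as List using (List; []; _∷_; _++_; length; map; [_]; replicate; concat; reverse; _ʳ++_)
  open import Data.List.Properties using (length-map; length-++; length-replicate; map-∘; map-cong; length-reverse; reverse-involutive; length-zipWith; ∷-injective)
  open import Data.List.Relation.Unary.All as All using (All; []; _∷_)
  import Data.List.Relation.Unary.All.Properties as AllP
  open import Data.List.Relation.Unary.AllPairs using ([]; _∷_)
  open import Data.List.Relation.Unary.Any using (here; there)
  open import Data.List.Relation.Unary.Linked using ([]; _∷_)
  open import Data.List.Membership.Propositional using (_∈_)
  open import Data.List.Relation.Binary.Pointwise using (Pointwise; []; _∷_; Pointwise-length; ++⁺)
  open import Data.List.Relation.Binary.Permutation.Propositional.Properties using (↭-reverse; All-resp-↭)
  open import Data.Product using (∃; _×_; _,_; proj₁; proj₂)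
  open import Data.Sum using (inj₁; inj₂)
  open import Data.Unit using (⊤; tt)
  open import Data.Empty using (⊥; ⊥-elim)
  open import Relation.Nullary
  open import Relation.Binary.PropositionalEquality as ≡ using (_≡_; _≢_; cong; cong₂; subst; sym)
  open Counting
  open PolyRing F
  open PolyArith F
  open Roots F
  open Lin F
  open Action F
  open Basis F
  open Kernel F
  open LinAlg F
  open ℙ using (*-cong; *-comm; *-assoc; *-identityˡ)

  module _ {n : ℕ} (A : Mat n) where
    open Act A

    -- For `w` of order φ^l with l at least 1, this generates the part of the cyclic submodule of
    -- `w` that `φ` kills.
    socle : Poly → ℕ → V n → V n
    socle φ l w = polyPow φ (l ∸ 1) • w

    socles : Poly → List ℕ → List (V n) → List (V n)
    socles φ (l ∷ κ) (w ∷ ws) = socle φ l w ∷ socles φ κ ws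
    socles φ _ _ = []

    -- Coefficients are polynomials; when the entries of `acc` are killed by `φ`, this is the span
    -- over the residue field modulo `φ`.
    Span : List (V n) → V n → Set
    Span acc x = ∃ λ cs → length cs ≡ length acc × comb cs acc ≡ x

    -- Images w of the generators of the φ-part, chosen one after the other, largest exponents first;
    -- acc holds the socle elements of the choices already made.
    Good : Poly → List (V n) → List ℕ → List (V n) → Set
    Good φ acc [] [] = ⊤
    Good φ acc [] (_ ∷ _) = ⊥
    Good φ acc (_ ∷ _) [] = ⊥
    Good φ acc (l ∷ κ) (w ∷ ws) = (polyPow φ l • w ≡ 0v × ¬ Span acc (socle φ l w)) × Good φ (socle φ l w ∷ acc) κ ws

    IndepMod : Poly → List (V n) → Set
    IndepMod φ acc = ∀ cs → length cs ≡ length acc → comb cs acc ≡ 0v → All (φ ∣_) cs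

    Killedᵛ : Poly → List (V n) → Set
    Killedᵛ φ = All (λ σ → φ • σ ≡ 0v)

    -- Ensures that every combination of `acc` is a value of φ^(l-1). This is the invariant by which
    -- the excluded choices can be counted at all.
    Images : Poly → ℕ → List (V n) → Set
    Images φ l acc = ∃ λ us → map (socle φ l) us ≡ acc

    pow-•-suc : ∀ φ l w → polyPow φ (suc l) • w ≡ φ • (polyPow φ l • w)
    pow-•-suc φ l w = ≡.trans (cong (_• w) (pow-suc φ l)) (*-• φ (polyPow φ l) w)

    killed-∣ : ∀ {φ cs acc} → Killedᵛ φ acc → All (φ ∣_) cs → comb cs acc ≡ 0v
    killed-∣ _ [] = ≡.refl
    killed-∣ [] (_ ∷ _) = ≡.refl
    killed-∣ (k ∷ ks) (d ∷ ds) = ≡.trans (cong₂ _⊕_ (∣-• d k) (killed-∣ ks ds)) (⊕-identityˡ 0v)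

    move : ∀ u v → u ⊕ v ≡ 0v → u ≡ neg1 • v
    move u v e = ⊕-cancelˡ v (≡.trans (⊕-comm v u) (≡.trans e (sym (neg1-• v))))

    module _ {φ : Poly} (iφ : MonicIrreducible φ) where

      -- A coefficient of `σ` that is prime to `φ` has an inverse modulo `φ`, and multiplying the
      -- relation by it would express `σ` through `acc`.
      IndepMod-∷ : ∀ {σ acc} → IndepMod φ acc → φ • σ ≡ 0v → ¬ Span acc σ → IndepMod φ (σ ∷ acc)
      IndepMod-∷ {σ} {acc} ind k ns (c ∷ cs) l e with bezout iφ c
      ... | inj₁ d = d ∷ ind cs (ℕP.suc-injective l) (≡.trans (sym (≡.trans (cong (_⊕ comb cs acc) (∣-• d k)) (⊕-identityˡ _))) e)
      ... | inj₂ (u , v , e′) = ⊥-elim (ns (map ((u * neg1) *_) cs , ≡.trans (length-map _ cs) (ℕP.suc-injective l) , sym (begin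
          σ ≡⟨ 1-• σ ⟨
          [ 1F ] • σ ≡⟨ ≈-• e′ σ ⟨
          (u * c + v * φ) • σ ≡⟨ +-• (u * c) (v * φ) σ ⟩
          ((u * c) • σ) ⊕ ((v * φ) • σ) ≡⟨ cong₂ _⊕_ (*-• u c σ) (∣-• (∣-*ˡ v ∣-refl) k) ⟩
          (u • (c • σ)) ⊕ 0v ≡⟨ ⊕-identityʳ _ ⟩
          u • (c • σ) ≡⟨ cong (u •_) (move (c • σ) (comb cs acc) e) ⟩
          u • (neg1 • comb cs acc) ≡⟨ *-• u neg1 _ ⟨
          (u * neg1) • comb cs acc ≡⟨ comb-*ˡ (u * neg1) cs acc ⟨
          comb (map ((u * neg1) *_) cs) acc ∎)))
        where open ≡.≡-Reasoning

      reduceφ : ∀ cs {acc} → length cs ≡ length acc → Killedᵛ φ acc → ∃ λ rs → (length rs ≡ length acc × All (λ r → length r ≡ deg φ) rs) × comb rs acc ≡ comb cs acc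
      reduceφ [] {[]} l [] = [] , (≡.refl , []) , ≡.refl
      reduceφ (c ∷ cs) {σ ∷ acc} l (k ∷ ks) with reduceφ cs (ℕP.suc-injective l) ks | reduction c (φ , 1) (proj₁ iφ)
      ... | rs , (lr , hs) , e | r , h , t , er = r ∷ rs , (cong suc lr , ≡.trans h (ℕP.*-identityʳ _) ∷ hs) ,
          cong₂ _⊕_ (sym (≡.trans (≈-• er σ) (≡.trans (+-• _ r σ) (≡.trans (cong (_⊕ (r • σ)) (∣-• (∣-*ʳ t (∣-resp (≈-sym (pow-1 φ)) ∣-refl)) k)) (⊕-identityˡ _))))) e

      comb-injective : ∀ {acc} → IndepMod φ acc → ∀ cs cs′ → length cs ≡ length acc × All (λ r → length r ≡ deg φ) cs → length cs′ ≡ length acc × All (λ r → length r ≡ deg φ) cs′ →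
        comb cs acc ≡ comb cs′ acc → cs ≡ cs′
      comb-injective {acc} ind cs cs′ (l , hs) (l′ , hs′) e = same cs cs′ hs hs′ (≡.trans l (sym l′))
          (ind (minus cs′ cs) (≡.trans (length-zipWith _ cs′ cs) (≡.trans (cong₂ _⊓_ l′ l) (ℕP.⊓-idem _))) (comb-minus cs′ cs acc (≡.trans l′ (sym l)) (sym e)))
        where
        same : ∀ cs cs′ → All (λ r → length r ≡ deg φ) cs → All (λ r → length r ≡ deg φ) cs′ → length cs ≡ length cs′ → All (φ ∣_) (minus cs′ cs) → cs ≡ cs′
        same [] [] _ _ _ _ = ≡.refl
        same (c ∷ cs) (c′ ∷ cs′) (h ∷ hs) (h′ ∷ hs′) l (d ∷ ds) = cong₂ _∷_ (difference-short (proj₁ iφ) c c′ h h′ d) (same cs cs′ hs hs′ (ℕP.suc-injective l) ds)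

      -- Here the decreasing order of the exponents enters: the surplus power of `φ` is moved into
      -- the preimages.
      Images-mono : ∀ {l l′ acc} → l′ ≤ l → Images φ l acc → Images φ l′ acc
      Images-mono {l} {l′} le (us , ≡.refl) = map (polyPow φ k •_) us , ≡.trans (sym (map-∘ us)) (map-cong (λ u → ≡.trans (sym (*-• _ _ u)) (≈-• (≈-trans (≈-sym (pow-+ φ (l′ ∸ 1) k)) (ℙ.reflexive (cong (polyPow φ) (ℕP.m+[n∸m]≡n (ℕP.∸-monoˡ-≤ 1 le))))) u)) us)
        where k = (l ∸ 1) ∸ (l′ ∸ 1)

      -- The excluded `w` are exactly the sums of a combination of the preimages `us`, with
      -- coefficients reduced modulo `φ`, and a vector killed by φ^l. Applying φ^l recovers the
      -- coefficients by independence of `acc`, so each excluded `w` arises once.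
      choices-size : ∀ {acc} l {a b} → Killedᵛ φ acc → IndepMod φ acc → Images φ (suc l) acc →
        HasSize (λ w → polyPow φ (suc l) • w ≡ 0v) a → HasSize (λ w → polyPow φ l • w ≡ 0v) b →
        HasSize (λ w → polyPow φ (suc l) • w ≡ 0v × ¬ Span acc (socle φ (suc l) w)) (a ∸ (q ^ deg φ) ^ length acc ℕ.* b)
      choices-size {acc} l {a} {b} ks ind (us , ≡.refl) ha hb = size-⇔ (λ w h → proj₁ h , λ s → proj₂ h (proj₁ h , s)) (λ w h → proj₁ h , λ s → proj₂ h (proj₂ s))
          (size-diff (size-dec _≟V_ bad) ha (size-⇔ (λ w h → proj₁ h , h) (λ w h → proj₂ h) bad))
        where
        p = polyPow φ l
        Residues : List Poly → Set
        Residues cs = length cs ≡ length acc × All (λ r → length r ≡ deg φ) cs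
        push : ∀ cs → p • comb cs us ≡ comb cs acc
        push cs = map-comb {A = A} {A} (•-linear p) (λ v → sym (A-•-comm p v)) cs us
        push-z : ∀ cs z → p • z ≡ 0v → p • (comb cs us ⊕ z) ≡ comb cs acc
        push-z cs z e = ≡.trans (•-⊕ p _ z) (≡.trans (cong₂ _⊕_ (push cs) e) (⊕-identityʳ _))
        φ-comb : ∀ cs → φ • comb cs acc ≡ 0v
        φ-comb cs = ≡.trans (sym (comb-*ˡ φ cs acc)) (killed-∣ {cs = map (φ *_) cs} ks (AllP.map⁺ (All.universal (λ c → ∣-*ʳ c ∣-refl) cs)))
        bad : HasSize (λ w → polyPow φ (suc l) • w ≡ 0v × Span acc (socle φ (suc l) w)) ((q ^ deg φ) ^ length acc ℕ.* b)
        bad = size-corr {R = λ cz w → w ≡ comb (proj₁ cz) us ⊕ proj₂ cz} (record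
          { total = λ { (cs , z) (r , e) → comb cs us ⊕ z ,
              (≡.trans (pow-•-suc φ l _) (≡.trans (cong (φ •_) (push-z cs z e)) (φ-comb cs)) , (cs , proj₁ r , sym (push-z cs z e))) , ≡.refl }
          ; onto = λ { w (_ , cs , lc , e) → onto w {cs} (reduceφ cs lc ks) e }
          ; inj = λ { (cs , z) (cs′ , z′) w (r , e) (r′ , e′) x y → inj cs z cs′ z′ r r′ e e′ (≡.trans (sym x) y) }
          ; fun = λ { _ _ _ _ _ _ ≡.refl ≡.refl → ≡.refl } })
          (size-× (size-lists (size-length (deg φ)) (length acc)) (λ _ _ → hb))
          where
          onto : ∀ w {cs} → (∃ λ rs → Residues rs × comb rs acc ≡ comb cs acc) → comb cs acc ≡ p • w →
            ∃ λ cz → (Residues (proj₁ cz) × p • proj₂ cz ≡ 0v) × w ≡ comb (proj₁ cz) us ⊕ proj₂ cz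
          onto w (rs , res , er) e = (rs , z) , (res , pz) , sym (≡.trans (⊕-comm x z) (≡.trans (⊕-assoc w _ x) (≡.trans (cong (w ⊕_) (≡.trans (⊕-comm _ x) (neg1-• x))) (⊕-identityʳ w))))
            where
            x = comb rs us
            z = w ⊕ (neg1 • x)
            pz : p • z ≡ 0v
            pz = ≡.trans (•-⊕ p w _) (≡.trans (cong ((p • w) ⊕_) (≡.trans (•-comm p neg1 x) (cong (neg1 •_) (≡.trans (push rs) (≡.trans er e))))) (neg1-• (p • w)))
          inj : ∀ cs z cs′ z′ → Residues cs → Residues cs′ → p • z ≡ 0v → p • z′ ≡ 0v → comb cs us ⊕ z ≡ comb cs′ us ⊕ z′ → (cs , z) ≡ (cs′ , z′)
          inj cs z cs′ z′ r r′ e e′ eq with comb-injective ind cs cs′ r r′ (≡.trans (sym (push-z cs z e)) (≡.trans (cong (p •_) eq) (push-z cs′ z′ e′)))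
          ... | ≡.refl = cong (cs ,_) (⊕-cancelˡ (comb cs us) eq)

      module _ (e : ℕ → ℕ) (kernels : ∀ k → HasSize (λ w → polyPow φ k • w ≡ 0v) (q ^ (deg φ ℕ.* e k))) where
        goodCount : ℕ → List ℕ → ℕ
        goodCount j [] = 1
        goodCount j (l ∷ κ) = (q ^ (deg φ ℕ.* e l) ∸ (q ^ deg φ) ^ j ℕ.* q ^ (deg φ ℕ.* e (l ∸ 1))) ℕ.* goodCount (suc j) κ

        -- `l₀` is the exponent of the preceding choice: `acc` consists of values of φ^(l₀ ∸ 1), and
        -- since the next part is no larger, also of values of the power required for it.
        good-size : ∀ l₀ κ acc → Decreasing (l₀ ∷ κ) → All (1 ≤_) κ → Killedᵛ φ acc → IndepMod φ acc → Images φ l₀ acc →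
          HasSize (Good φ acc κ) (goodCount (length acc) κ)
        good-size l₀ [] acc _ _ _ _ _ = [ [] ] , ([] ∷ []) , (λ { _ (here ≡.refl) → tt }) , (λ { [] _ → here ≡.refl ; (_ ∷ _) () }) , ≡.refl
        good-size l₀ (suc l ∷ κ) acc (le ∷ dec) (_ ∷ pos) ks ind im = size-corr {R = λ p ws → ws ≡ proj₁ p ∷ proj₂ p}
          (record { total = λ { (w , ws) h → w ∷ ws , h , ≡.refl }
                  ; onto = λ { (w ∷ ws) h → (w , ws) , h , ≡.refl ; [] () }
                  ; inj = λ { _ _ _ _ _ ≡.refl ≡.refl → ≡.refl }
                  ; fun = λ { _ _ _ _ _ _ ≡.refl ≡.refl → ≡.refl } })
          (size-× {Q = λ w → Good φ (socle φ (suc l) w ∷ acc) κ} (choices-size l ks ind im′ (kernels (suc l)) (kernels l))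
            λ { w (z , ns) → good-size (suc l) κ (socle φ (suc l) w ∷ acc) dec pos
                  (φσ w z ∷ ks) (IndepMod-∷ ind (φσ w z) ns) (w ∷ proj₁ im′ , cong (socle φ (suc l) w ∷_) (proj₂ im′)) })
          where
          im′ : Images φ (suc l) acc
          im′ = Images-mono le im
          φσ : ∀ w → polyPow φ (suc l) • w ≡ 0v → φ • socle φ (suc l) w ≡ 0v
          φσ w z = ≡.trans (sym (pow-•-suc φ l w)) z

      IndepMod-tail : ∀ xs {acc} → IndepMod φ (xs ʳ++ acc) → IndepMod φ acc
      IndepMod-tail [] ind = ind
      IndepMod-tail (x ∷ xs) {acc} ind cs l e with IndepMod-tail xs {x ∷ acc} ind ([] ∷ cs) (cong suc l) (≡.trans (cong (_⊕ comb cs acc) ([]-• x)) (≡.trans (⊕-identityˡ _) e))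
      ... | _ ∷ ds = ds

      IndepMod⇒∉Span : ∀ {σ acc} → IndepMod φ (σ ∷ acc) → ¬ Span acc σ
      IndepMod⇒∉Span {σ} {acc} ind (cs , l , e) with ind ([ 1F ] ∷ map (neg1 *_) cs) (cong suc (≡.trans (length-map _ cs) l))
          (≡.trans (cong₂ _⊕_ (1-• σ) (≡.trans (comb-*ˡ neg1 cs acc) (cong (neg1 •_) e))) (neg1-• σ))
      ... | d ∷ _ = irreducible-∤1 iφ d

      -- `Good` pushes the socle elements onto `acc` one by one, so the complete family appears in
      -- reverse order; this is the origin of `ʳ++` here and in the converse.
      IndepMod⇒Good : ∀ {κ ws} acc → Pointwise (λ w l → polyPow φ l • w ≡ 0v) ws κ → IndepMod φ (socles φ κ ws ʳ++ acc) → Good φ acc κ ws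
      IndepMod⇒Good acc [] ind = tt
      IndepMod⇒Good {l ∷ κ} {w ∷ ws} acc (k ∷ ks) ind = (k , IndepMod⇒∉Span (IndepMod-tail (socles φ κ ws) ind)) , IndepMod⇒Good (socle φ l w ∷ acc) ks ind

      Good⇒IndepMod : ∀ κ ws acc → All (1 ≤_) κ → IndepMod φ acc → Good φ acc κ ws → IndepMod φ (socles φ κ ws ʳ++ acc)
      Good⇒IndepMod [] [] acc _ ind _ = ind
      Good⇒IndepMod (suc l ∷ κ) (w ∷ ws) acc (_ ∷ pos) ind ((z , ns) , g) = Good⇒IndepMod κ ws (socle φ (suc l) w ∷ acc) pos
        (IndepMod-∷ ind (≡.trans (sym (pow-•-suc φ l w)) z) ns) g

    comb-ʳ++ : ∀ cs xs {ds ys} → length cs ≡ length xs → comb (cs ʳ++ ds) (xs ʳ++ ys) ≡ comb cs xs ⊕ comb ds ys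
    comb-ʳ++ [] [] l = sym (⊕-identityˡ _)
    comb-ʳ++ (c ∷ cs) (x ∷ xs) {ds} {ys} l = ≡.trans (comb-ʳ++ cs xs (ℕP.suc-injective l)) (≡.trans (sym (⊕-assoc _ (c • x) _)) (cong (_⊕ comb ds ys) (⊕-comm _ (c • x))))

    comb-reverse : ∀ cs xs → length cs ≡ length xs → comb (reverse cs) (reverse xs) ≡ comb cs xs
    comb-reverse cs xs l = ≡.trans (comb-ʳ++ cs xs l) (⊕-identityʳ _)

    IndepMod-reverse : ∀ {φ} xs → IndepMod φ xs → IndepMod φ (reverse xs)
    IndepMod-reverse xs ind cs l e = All-resp-↭ (↭-reverse cs) (ind (reverse cs) (≡.trans (length-reverse cs) (≡.trans l (length-reverse xs)))
      (≡.trans (cong (comb (reverse cs)) (sym (reverse-involutive xs))) (≡.trans (comb-reverse cs (reverse xs) l) e)))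

    comb-++ : ∀ cs xs {ds ys} → length cs ≡ length xs → comb (cs ++ ds) (xs ++ ys) ≡ comb cs xs ⊕ comb ds ys
    comb-++ [] [] l = sym (⊕-identityˡ _)
    comb-++ (c ∷ cs) (x ∷ xs) l = ≡.trans (cong ((c • x) ⊕_) (comb-++ cs xs (ℕP.suc-injective l))) (sym (⊕-assoc _ _ _))

    AllGood : ClassData → List (List (V n)) → Set
    AllGood = Pointwise (λ e ws → Good (proj₁ e) [] (proj₂ e) ws)

    Divides : List Poly → List (Poly × ℕ) → Set
    Divides = Pointwise (λ c s → modulus s ∣ c)

    good-annihilated : ∀ {φ} κ ws acc → Good φ acc κ ws → Annihilated A ws (block (φ , κ))
    good-annihilated [] [] acc _ = []
    good-annihilated (l ∷ κ) (w ∷ ws) acc ((z , _) , g) = z ∷ good-annihilated κ ws _ g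

    all-annihilated : ∀ {D wss} → AllGood D wss → Annihilated A (concat wss) (summands D)
    all-annihilated [] = []
    all-annihilated {e ∷ _} (g ∷ gs) = ++⁺ (good-annihilated (proj₂ e) _ [] g) (all-annihilated gs)

    Pointwise-++⁻ : ∀ {X Y : Set} {R : X → Y → Set} ys {zs xs} → Pointwise R xs (ys ++ zs) → ∃ λ xs₁ → ∃ λ xs₂ → xs ≡ xs₁ ++ xs₂ × Pointwise R xs₁ ys × Pointwise R xs₂ zs
    Pointwise-++⁻ [] p = [] , _ , ≡.refl , [] , p
    Pointwise-++⁻ (y ∷ ys) (r ∷ rs) with Pointwise-++⁻ ys rs
    ... | xs₁ , xs₂ , ≡.refl , p₁ , p₂ = _ ∷ xs₁ , xs₂ , ≡.refl , r ∷ p₁ , p₂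

    -- Coefficients es against the socle elements are the coefficients φ ^ (l - 1) * es against the generators.
    lift : Poly → List Poly → List ℕ → List Poly
    lift φ = List.zipWith (λ e l → polyPow φ (l ∸ 1) * e)

    comb-lift : ∀ φ es κ ws → length es ≡ length κ → length ws ≡ length κ → comb (lift φ es κ) ws ≡ comb es (socles φ κ ws)
    comb-lift φ [] [] [] _ _ = ≡.refl
    comb-lift φ (e ∷ es) (l ∷ κ) (w ∷ ws) le lw = cong₂ _⊕_ (≡.trans (≈-• (*-comm _ e) w) (*-• e _ w)) (comb-lift φ es κ ws (ℕP.suc-injective le) (ℕP.suc-injective lw))

    length-socles : ∀ φ κ ws → length ws ≡ length κ → length (socles φ κ ws) ≡ length κ
    length-socles φ [] [] _ = ≡.refl
    length-socles φ (l ∷ κ) (w ∷ ws) lw = cong suc (length-socles φ κ ws (ℕP.suc-injective lw))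

    module _ {φ : Poly} (iφ : MonicIrreducible φ) where
      lift-∣ : ∀ {es} κ → All (1 ≤_) κ → length es ≡ length κ → Divides (lift φ es κ) (block (φ , κ)) → All (φ ∣_) es
      lift-∣ {[]} [] _ _ _ = []
      lift-∣ {e ∷ es} (suc l ∷ κ) (_ ∷ pos) le ((s , d) ∷ ds) = (s , monic-cancel (pow-is-monic (proj₁ iφ) l)
          (≈-trans d (≈-trans (*-cong (≈-trans (ℙ.reflexive (pow-suc φ l)) (*-comm φ _)) ≈-refl) (*-assoc _ φ s)))) ∷ lift-∣ κ pos (ℕP.suc-injective le) ds

      -- A coefficient that `φ` sends to a multiple of φ^l is φ^(l-1) times some `e`. Relations with
      -- such coefficients are therefore relations among the socle elements, where independence
      -- modulo `φ` applies.
      unlift : ∀ {cs} κ → All (1 ≤_) κ → Pointwise (λ c s → modulus s ∣ φ * c) cs (block (φ , κ)) →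
        ∃ λ es → length es ≡ length κ × Pointwise _≈_ cs (lift φ es κ) × (All (φ ∣_) es → Divides cs (block (φ , κ)))
      unlift [] _ [] = [] , ≡.refl , [] , λ _ → []
      unlift {c ∷ _} (suc l ∷ κ) (_ ∷ pos) ((e , d) ∷ ds) with unlift κ pos ds
      ... | es , le , eqs , k = e ∷ es , cong suc le , eq ∷ eqs , λ { ((t , f) ∷ fs) →
            (t , ≈-trans eq (≈-trans (*-cong ≈-refl f) (≈-trans (≈-sym (*-assoc _ φ t)) (*-cong (≈-trans (*-comm _ φ) (ℙ.reflexive (sym (pow-suc φ l)))) ≈-refl)))) ∷ k fs }
        where
        eq : c ≈ polyPow φ l * e
        eq = monic-cancel (proj₁ iφ) (≈-trans d (≈-trans (*-cong (ℙ.reflexive (pow-suc φ l)) ≈-refl) (*-assoc φ _ e)))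

      comb-≈ : ∀ {cs ds} ws → Pointwise _≈_ cs ds → comb cs ws ≡ comb ds ws
      comb-≈ ws [] = ≡.refl
      comb-≈ [] (_ ∷ _) = ≡.refl
      comb-≈ (w ∷ ws) (e ∷ es) = cong₂ _⊕_ (≈-• e w) (comb-≈ ws es)

      good-block-∣ : ∀ {cs} κ ws → All (1 ≤_) κ → Good φ [] κ ws → Pointwise (λ c s → modulus s ∣ φ * c) cs (block (φ , κ)) → comb cs ws ≡ 0v → Divides cs (block (φ , κ))
      good-block-∣ {cs} κ ws pos g ds e with unlift κ pos ds
      ... | es , le , eqs , k = k (ind es (≡.trans le (sym (length-socles φ κ ws lw))) (≡.trans (sym (comb-lift φ es κ ws le lw)) (≡.trans (sym (comb-≈ ws eqs)) e)))
        where
        lw : length ws ≡ length κ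
        lw = ≡.trans (Pointwise-length (good-annihilated κ ws [] g)) (length-map _ κ)
        ind : IndepMod φ (socles φ κ ws)
        ind = subst (IndepMod φ) (reverse-involutive (socles φ κ ws)) (IndepMod-reverse _ (Good⇒IndepMod iφ κ ws [] pos (λ { [] _ _ → [] }) g))

      independent-block⇒Good : ∀ κ ws → All (1 ≤_) κ → Annihilated A ws (block (φ , κ)) → Independent A ws (block (φ , κ)) → Good φ [] κ ws
      independent-block⇒Good κ ws pos ann ind = IndepMod⇒Good iφ [] (strip κ ann) (IndepMod-reverse (socles φ κ ws) λ es le e →
          lift-∣ κ pos (≡.trans le (length-socles φ κ ws lw)) (ind (lift φ es κ) (≡.trans (length-zipWith _ es κ) (≡.trans (cong (_⊓ length κ) (≡.trans le (length-socles φ κ ws lw))) (≡.trans (ℕP.⊓-idem _) (sym (length-map _ κ)))))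
            (≡.trans (comb-lift φ es κ ws (≡.trans le (length-socles φ κ ws lw)) lw) e)))
        where
        lw : length ws ≡ length κ
        lw = ≡.trans (Pointwise-length ann) (length-map _ κ)
        strip : ∀ {ws} κ → Annihilated A ws (block (φ , κ)) → Pointwise (λ w l → polyPow φ l • w ≡ 0v) ws κ
        strip [] [] = []
        strip (l ∷ κ) (z ∷ zs) = z ∷ strip κ zs

    Divides-++⁻ˡ : ∀ cs {ds} bs {ss} → length cs ≡ length bs → Divides (cs ++ ds) (bs ++ ss) → Divides cs bs
    Divides-++⁻ˡ [] [] l _ = []
    Divides-++⁻ˡ (c ∷ cs) (b ∷ bs) l (d ∷ ds) = d ∷ Divides-++⁻ˡ cs bs (ℕP.suc-injective l) ds

    Divides-++⁻ʳ : ∀ cs {ds} bs {ss} → length cs ≡ length bs → Divides (cs ++ ds) (bs ++ ss) → Divides ds ss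
    Divides-++⁻ʳ [] [] l h = h
    Divides-++⁻ʳ (c ∷ cs) (b ∷ bs) l (d ∷ ds) = Divides-++⁻ʳ cs bs (ℕP.suc-injective l) ds

    -- Each block inherits independence from the whole family: a relation inside it is padded with
    -- zero coefficients in the other blocks.
    independent⇒AllGood : ∀ {ws} D → Valid D → Annihilated A ws (summands D) → Independent A ws (summands D) → ∃ λ wss → AllGood D wss × concat wss ≡ ws
    independent⇒AllGood [] _ [] _ = [] , [] , ≡.refl
    independent⇒AllGood (e ∷ D) (v ∷ vD) ann ind with Pointwise-++⁻ (block e) ann
    ... | ws₁ , ws₂ , ≡.refl , a₁ , a₂ with independent⇒AllGood D vD a₂ (λ cs lc z →
          Divides-++⁻ʳ (zeros (block e)) (block e) (length-replicate _) (ind (zeros (block e) ++ cs)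
            (≡.trans (length-++ (zeros (block e))) (≡.trans (cong₂ ℕ._+_ (length-replicate (length (block e))) lc) (sym (length-++ (block e)))))
            (≡.trans (comb-++ (zeros (block e)) ws₁ (≡.trans (length-replicate _) (sym (Pointwise-length a₁)))) (≡.trans (cong₂ _⊕_ (comb-zeros (length (block e)) ws₁) z) (⊕-identityˡ 0v)))))
      where
      zeros : List (Poly × ℕ) → List Poly
      zeros ss = replicate (length ss) []
    ... | wss , gs , ≡.refl = ws₁ ∷ wss , independent-block⇒Good (proj₁ v) (proj₂ e) ws₁ (proj₁ (proj₁ (proj₂ (proj₂ v)))) a₁ (λ cs lc z →
          Divides-++⁻ˡ cs (block e) lc (ind (cs ++ zeros) (≡.trans (length-++ cs) (≡.trans (cong₂ ℕ._+_ lc (length-replicate _)) (sym (length-++ (block e)))))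
            (≡.trans (comb-++ cs ws₁ (≡.trans lc (sym (Pointwise-length a₁)))) (≡.trans (cong₂ _⊕_ z (comb-zeros (length (summands D)) (concat wss))) (⊕-identityˡ 0v))))) ∷ gs , ≡.refl
      where
      zeros = replicate (length (summands D)) []

    -- `φ` is a unit modulo the powers of another irreducible, so there only the zero residue is
    -- killed by it.
    coprime-block : ∀ {φ ψ cs} κ → MonicIrreducible φ → MonicIrreducible ψ → φ ≢ ψ → Pointwise (λ c s → modulus s ∣ φ * c) cs (block (ψ , κ)) → Divides cs (block (ψ , κ))
    coprime-block [] _ _ _ [] = []
    coprime-block (l ∷ κ) iφ iψ ne (d ∷ ds) = coprime-∣ (coprime-sym (coprime-pow l (coprime-sym (distinct-coprime iφ iψ ne)))) d ∷ coprime-block κ iφ iψ ne ds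

    coprime-blocks : ∀ {φ cs} D → MonicIrreducible φ → Valid D → All (λ e → φ ≢ proj₁ e) D → Pointwise (λ c s → modulus s ∣ φ * c) cs (summands D) → Divides cs (summands D)
    coprime-blocks [] _ _ _ [] = []
    coprime-blocks (e ∷ D) iφ (v ∷ vD) (n ∷ ns) ds with Pointwise-++⁻ (block e) ds
    ... | _ , _ , ≡.refl , d₁ , d₂ = ++⁺ (coprime-block (proj₂ e) iφ (proj₁ v) n d₁) (coprime-blocks D iφ vD ns d₂)

    -- Coefficients killed by `φ` vanish in the blocks of the other irreducibles, so the relation is
    -- confined to the block of `φ`, where `good-block-∣` settles it.
    socle-independence : ∀ {φ κ cs wss} D → Valid D → Distinct D → (φ , κ) ∈ D → AllGood D wss →
      Pointwise (λ c s → modulus s ∣ φ * c) cs (summands D) → comb cs (concat wss) ≡ 0v → Divides cs (summands D)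
    socle-independence {φ} {κ} (e ∷ D) (v ∷ vD) (n ∷ ns) i (g ∷ gs) ds z with Pointwise-++⁻ (block e) ds
    socle-independence {φ} {κ} (e ∷ D) (v ∷ vD) (n ∷ ns) (here ≡.refl) (_∷_ {y = ws} {ys = wss} g gs) ds z | cs₁ , cs₂ , ≡.refl , d₁ , d₂ =
        ++⁺ (good-block-∣ (proj₁ v) κ ws (proj₁ (proj₁ (proj₂ (proj₂ v)))) g d₁ z₁) rest
      where
      rest = coprime-blocks D (proj₁ v) vD n d₂
      z₁ : comb cs₁ ws ≡ 0v
      z₁ = ≡.trans (sym (⊕-identityʳ _)) (≡.trans (cong (comb cs₁ ws ⊕_) (sym (comb-∣ cs₂ (all-annihilated gs) rest)))
        (≡.trans (sym (comb-++ cs₁ ws (≡.trans (Pointwise-length d₁) (sym (Pointwise-length (good-annihilated κ ws [] g)))))) z))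
    socle-independence {φ} {κ} (e ∷ D) (v ∷ vD) (n ∷ ns) (there i) (_∷_ {y = ws} {ys = wss} g gs) ds z | cs₁ , cs₂ , ≡.refl , d₁ , d₂ =
        ++⁺ first (socle-independence D vD ns i gs d₂ z₂)
      where
      first = coprime-block (proj₂ e) (proj₁ (All.lookup vD i)) (proj₁ v) (λ eq → All.lookup n i (sym eq)) d₁
      z₂ : comb cs₂ (concat wss) ≡ 0v
      z₂ = ≡.trans (sym (⊕-identityˡ _)) (≡.trans (cong (_⊕ comb cs₂ (concat wss)) (sym (comb-∣ cs₁ (good-annihilated (proj₂ e) ws [] g) first)))
        (≡.trans (sym (comb-++ cs₁ ws (≡.trans (Pointwise-length d₁) (sym (Pointwise-length (good-annihilated (proj₂ e) ws [] g)))))) z))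

    -- The product of all moduli written as a list of irreducibles: the product annihilates the
    -- whole space, and the list form lets one irreducible be removed at a time.
    killers : List (Poly × ℕ) → List Poly
    killers [] = []
    killers ((φ , l) ∷ ss) = replicate l φ ++ killers ss

    prodP-++ : ∀ xs ys → prodP (xs ++ ys) ≈ prodP xs * prodP ys
    prodP-++ [] ys = ≈-sym (*-identityˡ _)
    prodP-++ (x ∷ xs) ys = ≈-trans (*-cong ≈-refl (prodP-++ xs ys)) (≈-sym (*-assoc x _ _))

    prodP-replicate : ∀ l φ → prodP (replicate l φ) ≈ polyPow φ l
    prodP-replicate zero φ = ≈-refl
    prodP-replicate (suc l) φ = ≈-trans (*-cong ≈-refl (prodP-replicate l φ)) (ℙ.reflexive (sym (pow-suc φ l)))

    killers-∣ : ∀ ss → All (λ s → modulus s ∣ prodP (killers ss)) ss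
    killers-∣ [] = []
    killers-∣ ((φ , l) ∷ ss) = ∣-resp (≈-sym (prodP-++ (replicate l φ) _)) (∣-*ʳ _ (∣-resp (≈-sym (prodP-replicate l φ)) ∣-refl))
      ∷ All.map (λ d → ∣-resp (≈-sym (prodP-++ (replicate l φ) _)) (∣-*ˡ _ d)) (killers-∣ ss)

    killers-from : ∀ {P : Poly → Set} ss → All (λ s → P (proj₁ s)) ss → All P (killers ss)
    killers-from [] [] = []
    killers-from ((φ , l) ∷ ss) (p ∷ ps) = AllP.++⁺ (AllP.replicate⁺ l p) (killers-from ss ps)

    module _ {vs D} (vD : Valid D) (dD : Distinct D) (dec : Decomp A vs (summands D)) where
      open Decomp dec

      -- A relation among the images is a kernel vector of the homomorphism that sends the
      -- generators to them. Socle independence excludes nonzero kernel vectors killed by a single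
      -- irreducible, and `killers` reduces every kernel vector to that case.
      AllGood⇒independent : ∀ {wss} → AllGood D wss → Independent A (concat wss) (summands D)
      AllGood⇒independent {wss} gs cs lc z = independent cs lc (trivial-kernel (killers (summands D)) from-D (comb cs vs) (≡.trans (g-comb cs lc) z) (annihilates (comb cs vs)))
        where
        E = extend dec (all-annihilated gs)
        g = proj₁ E
        g-comb : ∀ cs → length cs ≡ length (summands D) → g ▹ comb cs vs ≡ comb cs (concat wss)
        g-comb = proj₁ (proj₂ E)
        g-• : ∀ p x → g ▹ (p • x) ≡ p • (g ▹ x)
        g-• = •-hom {A = A} {A} (▹-linear g) λ v → ≡.trans (sym (·-▹ g A v)) (≡.trans (cong (_▹ v) (proj₂ (proj₂ E))) (·-▹ A g v))
        annihilates : ∀ x → prodP (killers (summands D)) • x ≡ 0v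
        annihilates x with spanning x
        ... | ds , ld , ≡.refl = ≡.trans (sym (comb-*ˡ _ ds vs)) (comb-∣ (map (prodP (killers (summands D)) *_) ds) annihilated (divides ds ld (killers-∣ (summands D))))
          where
          divides : ∀ {p} ds {ss} → length ds ≡ length ss → All (λ s → modulus s ∣ p) ss → Divides (map (p *_) ds) ss
          divides [] {[]} _ [] = []
          divides (d ∷ ds) l (h ∷ hs) = ∣-*ʳ d h ∷ divides ds (ℕP.suc-injective l) hs
        InD : Poly → Set
        InD φ = ∃ λ κ → (φ , κ) ∈ D
        from-D : All InD (killers (summands D))
        from-D = killers-from (summands D) (All-summands (All.tabulate λ i _ → _ , i))
        socle-trivial : ∀ φ → InD φ → ∀ y → g ▹ y ≡ 0v → φ • y ≡ 0v → y ≡ 0v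
        socle-trivial φ (κ , i) y gy φy with spanning y
        ... | ds , ld , ≡.refl = comb-∣ ds annihilated (socle-independence D vD dD i gs
              (unmap (independent (map (φ *_) ds) (≡.trans (length-map _ ds) ld) (≡.trans (comb-*ˡ φ ds vs) φy))) (≡.trans (sym (g-comb ds ld)) gy))
          where
          unmap : ∀ {ds ss} → Divides (map (φ *_) ds) ss → Pointwise (λ c s → modulus s ∣ φ * c) ds ss
          unmap {[]} [] = []
          unmap {_ ∷ _} (h ∷ hs) = h ∷ unmap hs
        trivial-kernel : ∀ Φ → All InD Φ → ∀ x → g ▹ x ≡ 0v → prodP Φ • x ≡ 0v → x ≡ 0v
        trivial-kernel [] _ x _ px = ≡.trans (sym (1-• x)) px
        -- The vector `prodP Φ • x` is again in the kernel and is killed by `φ`, hence zero; so the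
        -- remaining irreducibles already kill `x`.
        trivial-kernel (φ ∷ Φ) (i ∷ is) x gx px = trivial-kernel Φ is x gx (socle-trivial φ i (prodP Φ • x)
          (≡.trans (g-• (prodP Φ) x) (≡.trans (cong (prodP Φ •_) gx) (•-0v (prodP Φ)))) (≡.trans (sym (*-• φ (prodP Φ) x)) px))

      Centralizes : Mat n → Set
      Centralizes g = GL n g × g · A ≡ A · g

      private
        commutes-▹ : ∀ g → g · A ≡ A · g → ∀ v → g ▹ (A ▹ v) ≡ A ▹ (g ▹ v)
        commutes-▹ g com v = ≡.trans (sym (·-▹ g A v)) (≡.trans (cong (_▹ v) com) (·-▹ A g v))
        g-comb : ∀ g → Centralizes g → ∀ cs → g ▹ comb cs vs ≡ comb cs (map (g ▹_) vs)
        g-comb g (_ , com) cs = map-comb {A = A} {A} (▹-linear g) (commutes-▹ g com) cs vs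

        found-onto : ∀ g → Centralizes g → ∃ λ wss → AllGood D wss × map (g ▹_) vs ≡ concat wss
        found-onto g h@(gGL , com) = let wss , gs , e = found in wss , gs , sym e
          where
          ann : ∀ {vs ss} → Annihilated A vs ss → Annihilated A (map (g ▹_) vs) ss
          ann [] = []
          ann {v ∷ _} {s ∷ _} (a ∷ as) = ≡.trans (sym (•-hom {A = A} {A} (▹-linear g) (commutes-▹ g com) (modulus s) v)) (≡.trans (cong (g ▹_) a) (▹-0v g)) ∷ ann as
          found : ∃ λ wss → AllGood D wss × concat wss ≡ map (g ▹_) vs
          found = independent⇒AllGood {map (g ▹_) vs} D vD (ann annihilated)
              (λ cs lc z → independent cs lc (GL-injective {A = g} gGL _ _ (≡.trans (g-comb g h cs) (≡.trans z (sym (▹-0v g))))))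
        agree : ∀ g g′ → Centralizes g → Centralizes g′ → map (g ▹_) vs ≡ map (g′ ▹_) vs → ∀ x → (∃ λ cs → length cs ≡ length (summands D) × comb cs vs ≡ x) → g ▹ x ≡ g′ ▹ x
        agree g g′ h h′ e _ (cs , _ , ≡.refl) = ≡.trans (g-comb g h cs) (≡.trans (cong (comb cs) e) (sym (g-comb g′ h′ cs)))
        split : ∀ {X : Set} (xs xs′ : List X) {ys ys′} → length xs ≡ length xs′ → xs ++ ys ≡ xs′ ++ ys′ → xs ≡ xs′ × ys ≡ ys′
        split [] [] _ e = ≡.refl , e
        split (x ∷ xs) (x′ ∷ xs′) l e with ∷-injective e
        ... | ≡.refl , e′ = let a , b = split xs xs′ (ℕP.suc-injective l) e′ in cong (x ∷_) a , b
        same-concat : ∀ {D wss wss′} → AllGood D wss → AllGood D wss′ → concat wss ≡ concat wss′ → wss ≡ wss′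
        same-concat [] [] _ = ≡.refl
        same-concat {e ∷ D} {ws ∷ wss} {ws′ ∷ wss′} (g ∷ gs) (g′ ∷ gs′) eq with split ws ws′ (≡.trans (Pointwise-length (good-annihilated (proj₂ e) ws [] g)) (sym (Pointwise-length (good-annihilated (proj₂ e) ws′ [] g′)))) eq
        ... | a , b = cong₂ _∷_ a (same-concat gs gs′ b)

        realise : ∀ {wss} → AllGood D wss → (E : ∃ λ (G : Mat n) → (∀ cs → length cs ≡ length (summands D) → G ▹ comb cs vs ≡ comb cs (concat wss)) × G · A ≡ A · G) →
          GL n (proj₁ E) → ∃ λ g → Centralizes g × map (g ▹_) vs ≡ concat wss
        realise {wss} gs (G , gc , com) gl = G , (gl , com) ,
          comb-separates A (map (G ▹_) vs) (concat wss) (≡.trans (length-map _ vs) (≡.trans (Pointwise-length annihilated) (sym (Pointwise-length (all-annihilated gs)))))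
            (λ cs lc → ≡.trans (sym (g-comb G (gl , com) cs)) (gc cs (≡.trans lc (≡.trans (length-map _ vs) (Pointwise-length annihilated)))))

      -- A centralizing matrix is determined by the images of the generators, cut into one list per
      -- irreducible, and every good family of images arises through `extend`.
      centralizer-size : ∀ m → All (λ e → HasSize (Good (proj₁ e) [] (proj₂ e)) (m e)) D → HasSize Centralizes (product (map m D))
      centralizer-size m sizes = size-corr {R = λ wss g → map (g ▹_) vs ≡ concat wss} (record
        { total = λ wss gs → realise gs (extend dec (all-annihilated gs)) (extend-injective dec (all-annihilated gs) (AllGood⇒independent gs))
        ; onto = found-onto
        ; inj = λ wss wss′ g gs gs′ e e′ → same-concat gs gs′ (≡.trans (sym e) e′)
        ; fun = λ wss g g′ _ h h′ e e′ → mat-ext {A = g} {g′} λ x → agree g g′ h h′ (≡.trans e (sym e′)) x (spanning x) })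
        (size-pointwise D sizes)

-- The order of the centralizer as a product of the c_d.

module Order {q : ℕ} (F : FiniteField q) where
  open import Data.Nat.Base as ℕ using (suc; _≤_; s≤s⁻¹; _+_; _*_; _^_; _⊓_; _∸_)
  open import Data.Nat.Properties
  open import Data.Nat.ListAction using (sum; product)
  open import Data.Nat.ListAction.Properties using (product-++; product-↭)
  open import Data.Bool.Base using (true; false)
  open import Data.List.Base using (List; []; _∷_; _++_; length; map; [_]; upTo)
  open import Data.List.Properties using (map-++; length-++; map-∘; upTo-∷ʳ; ++-assoc)
  open import Data.List.Relation.Unary.All as All using (All; []; _∷_)
  import Data.List.Relation.Unary.All.Properties as AllP
  open import Data.List.Relation.Unary.AllPairs using ([]; _∷_)
  open import Data.List.Relation.Unary.Any using (here; there)
  open import Data.List.Relation.Unary.Linked as Linked using ([]; [-]; _∷_)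
  open import Data.List.Relation.Unary.Unique.Propositional using (Unique)
  import Data.List.Relation.Unary.Unique.Propositional.Properties as Uniq
  open import Data.List.Membership.Propositional using (_∈_)
  open import Data.List.Membership.Propositional.Properties using (∈-map⁺; ∈-upTo⁺)
  open import Data.List.Relation.Binary.Permutation.Propositional.Properties using (map⁺)
  open import Data.Product using (∃; _×_; _,_; proj₁; proj₂)
  open import Data.Empty using (⊥-elim)
  open import Relation.Nullary
  open import Relation.Binary.PropositionalEquality hiding ([_])
  open Counting
  open Lin F
  open Action F
  open Basis F
  open Kernel F
  open Centralizer F
  open LinAlg F

  mult-same : ∀ k κ → mult (k ∷ κ) k ≡ suc (mult κ k)
  -- `mult` filters by `does (p ℕ.≟ k)`, which computes to the boolean test `≡ᵇ`; the case split has
  -- to be on that test.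
  mult-same k κ with k ℕ.≡ᵇ k | ≡⇒≡ᵇ k k refl
  ... | true | _ = refl

  mult-other : ∀ p k κ → p ≢ k → mult (p ∷ κ) k ≡ mult κ k
  mult-other p k κ ne with p ℕ.≡ᵇ k | ≡ᵇ⇒≡ p k
  ... | true | p≡k = ⊥-elim (ne (p≡k _))
  ... | false | _ = refl

  product-cong : ∀ {L : List ℕ} {g h : ℕ → ℕ} → (∀ k → k ∈ L → g k ≡ h k) → product (map g L) ≡ product (map h L)
  product-cong {[]} e = refl
  product-cong {x ∷ L} e = cong₂ _*_ (e x (here refl)) (product-cong λ k k∈ → e k (there k∈))

  product-update : ∀ {L : List ℕ} {g h : ℕ → ℕ} {k x} → Unique L → k ∈ L → g k ≡ x * h k → (∀ j → k ≢ j → g j ≡ h j) →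
    product (map g L) ≡ x * product (map h L)
  product-update {_ ∷ L} {g} {h} {k} {x} (n ∷ u) (here refl) e other =
    trans (cong₂ _*_ e (product-cong {L} λ j j∈ → other j (All.lookup n j∈))) (*-assoc x (h k) _)
  product-update {y ∷ L} {g} {h} {k} {x} (n ∷ u) (there k∈) e other =
    trans (cong₂ _*_ (other y λ eq → All.lookup n k∈ (sym eq)) (product-update {L} {g} {h} {k} {x} u k∈ e other))
      (trans (sym (*-assoc (h y) x _)) (trans (cong (_* product (map h L)) (*-comm (h y) x)) (*-assoc x (h y) _)))

  upFrom1 : ℕ → List ℕ
  upFrom1 N = map suc (upTo N)

  -- The double product over k and i up to m_k, attributed to single parts: the factor with index i
  -- goes to the occurrence of k from which on i copies of k remain.
  byParts : (ℕ → ℕ → ℕ) → List ℕ → ℕ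
  byParts f [] = 1
  byParts f (k ∷ κ) = f k (mult (k ∷ κ) k) * byParts f κ

  -- Removing the first part lowers one multiplicity by one, which drops the last factor of one
  -- inner product. The range `N` stays fixed while `κ` shrinks.
  regroup : ∀ f N κ → All (1 ≤_) κ → All (_≤ N) κ →
    product (map (λ k → product (map (f k) (upFrom1 (mult κ k)))) (upFrom1 N)) ≡ byParts f κ
  regroup f N [] _ _ = ones (upFrom1 N)
    where
    ones : ∀ (L : List ℕ) → product (map (λ _ → 1) L) ≡ 1
    ones [] = refl
    ones (_ ∷ L) = trans (*-identityˡ _) (ones L)
  regroup f N (suc k ∷ κ) (_ ∷ ps) (le ∷ les) = trans
    (product-update {x = f (suc k) (mult (suc k ∷ κ) (suc k))} (Uniq.map⁺ suc-injective (Uniq.upTo⁺ N)) (∈-map⁺ suc (∈-upTo⁺ le))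
      (trans (cong (λ m → product (map (f (suc k)) (upFrom1 m))) (mult-same (suc k) κ))
        (trans (last (mult κ (suc k))) (cong (λ m → f (suc k) m * product (map (f (suc k)) (upFrom1 (mult κ (suc k))))) (sym (mult-same (suc k) κ)))))
      (λ j ne → cong (λ m → product (map (f j) (upFrom1 m))) (mult-other (suc k) j κ ne)))
    (cong (f (suc k) (mult (suc k ∷ κ) (suc k)) *_) (regroup f N κ ps les))
    where
    last : ∀ m → product (map (f (suc k)) (upFrom1 (suc m))) ≡ f (suc k) (suc m) * product (map (f (suc k)) (upFrom1 m))
    last m = trans (cong (λ L → product (map (f (suc k)) (map suc L))) (sym (upTo-∷ʳ m)))
      (trans (cong product (trans (cong (map (f (suc k))) (map-++ suc (upTo m) [ m ])) (map-++ (f (suc k)) (upFrom1 m) [ suc m ])))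
      (trans (product-++ (map (f (suc k)) (upFrom1 m)) _) (trans (cong (product (map (f (suc k)) (upFrom1 m)) *_) (*-identityʳ _)) (*-comm _ (f (suc k) (suc m))))))

  dk-++ : ∀ κ κ′ k → dk (κ ++ κ′) k ≡ dk κ k + dk κ′ k
  dk-++ [] κ′ k = refl
  dk-++ (p ∷ κ) κ′ k = trans (cong (p ⊓ k +_) (dk-++ κ κ′ k)) (sym (+-assoc (p ⊓ k) _ _))

  dk-above : ∀ {l κ} → All (suc l ≤_) κ → dk κ (suc l) ≡ length κ + dk κ l
  dk-above [] = refl
  dk-above {l} {p ∷ κ} (le ∷ les) = begin
    p ⊓ suc l + dk κ (suc l) ≡⟨ cong₂ _+_ (m≥n⇒m⊓n≡n le) (dk-above les) ⟩
    suc l + (length κ + dk κ l) ≡⟨ cong suc (trans (sym (+-assoc l (length κ) _)) (trans (cong (_+ dk κ l) (+-comm l (length κ))) (+-assoc (length κ) l _))) ⟩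
    suc (length κ + (l + dk κ l)) ≡⟨ cong (λ z → suc (length κ + (z + dk κ l))) (m≥n⇒m⊓n≡n (≤-trans (n≤1+n l) le)) ⟨
    suc (length κ + (p ⊓ l + dk κ l)) ∎
    where open ≡-Reasoning

  dk-below : ∀ {l κ} → All (_≤ suc l) κ → dk κ (suc l) ≡ mult κ (suc l) + dk κ l
  dk-below [] = refl
  dk-below {l} {p ∷ κ} (le ∷ les) with p ≟ suc l
  ... | yes refl = begin
    suc l ⊓ suc l + dk κ (suc l) ≡⟨ cong₂ _+_ (⊓-idem (suc l)) (dk-below les) ⟩
    suc l + (mult κ (suc l) + dk κ l) ≡⟨ cong suc (trans (sym (+-assoc l (mult κ (suc l)) _)) (trans (cong (_+ dk κ l) (+-comm l (mult κ (suc l)))) (+-assoc (mult κ (suc l)) l _))) ⟩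
    suc (mult κ (suc l)) + (l + dk κ l) ≡⟨ cong₂ (λ a b → a + (b + dk κ l)) (sym (mult-same (suc l) κ)) (sym (m≥n⇒m⊓n≡n (n≤1+n l))) ⟩
    mult (suc l ∷ κ) (suc l) + (suc l ⊓ l + dk κ l) ∎
    where open ≡-Reasoning
  ... | no ne = begin
    p ⊓ suc l + dk κ (suc l) ≡⟨ cong₂ _+_ (trans (m≤n⇒m⊓n≡m le) (sym (m≤n⇒m⊓n≡m (s≤s⁻¹ (≤∧≢⇒< le ne))))) (dk-below les) ⟩
    p ⊓ l + (mult κ (suc l) + dk κ l) ≡⟨ trans (sym (+-assoc (p ⊓ l) _ _)) (trans (cong (_+ dk κ l) (+-comm (p ⊓ l) _)) (+-assoc (mult κ (suc l)) _ _)) ⟩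
    mult κ (suc l) + (p ⊓ l + dk κ l) ≡⟨ cong (_+ (p ⊓ l + dk κ l)) (mult-other p (suc l) κ ne) ⟨
    mult (p ∷ κ) (suc l) + (p ⊓ l + dk κ l) ∎
    where
    open ≡-Reasoning

  parts≤sum : ∀ κ → All (_≤ sum κ) κ
  parts≤sum [] = []
  parts≤sum (p ∷ κ) = m≤m+n p _ ∷ All.map (λ le → ≤-trans le (m≤n+m _ p)) (parts≤sum κ)

  module _ {n : ℕ} {A : Mat n} {φ : Poly} (iφ : MonicIrreducible φ) (d : ℕ) (d≡ : d ≡ deg φ) (κ₀ : List ℕ)
    (kernels : ∀ k → HasSize (λ w → Act._•_ A (polyPow φ k) w ≡ 0v) (q ^ (deg φ * dk κ₀ k))) where

    term : ℕ → ℕ → ℕ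
    term k i = q ^ (dk κ₀ k * d) ∸ q ^ ((dk κ₀ k ∸ i) * d)

    -- The growth of `dk κ₀` from l to l + 1 is the number of parts of size at least l + 1: the
    -- `length pre` parts already treated and the `m` copies from here on. So the exponent
    -- `length pre` + `dk κ₀ l` of the excluded choices is `dk κ₀ (suc l)` - `m`, which is the
    -- factor of c_d with i = `m`.
    goodCount-byParts : ∀ pre κ → pre ++ κ ≡ κ₀ → All (1 ≤_) κ → Decreasing κ → (∀ {l} → l ∈ κ → All (l ≤_) pre) →
      goodCount A iφ (dk κ₀) kernels (length pre) κ ≡ byParts term κ
    goodCount-byParts pre [] e _ _ _ = refl
    goodCount-byParts pre (suc l ∷ κ) e (_ ∷ pos) dec above = cong₂ _*_ (cong₂ _∸_ (cong (q ^_) (trans (cong (_* dk κ₀ (suc l)) (sym d≡)) (*-comm d _))) second)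
      (trans (cong (λ j → goodCount A iφ (dk κ₀) kernels j κ) (sym (trans (length-++ pre) (+-comm (length pre) 1))))
        (goodCount-byParts (pre ++ [ suc l ]) κ (trans (++-assoc pre [ suc l ] κ) e) pos (Linked.tail dec)
          (λ l∈ → AllP.++⁺ (above (there l∈)) (All.lookup (below-head dec) l∈ ∷ []))))
      where
      m = mult (suc l ∷ κ) (suc l)
      j = length pre
      growth : dk κ₀ (suc l) ≡ (j + dk κ₀ l) + m
      growth = begin
        dk κ₀ (suc l) ≡⟨ cong (λ z → dk z (suc l)) e ⟨
        dk (pre ++ suc l ∷ κ) (suc l) ≡⟨ dk-++ pre (suc l ∷ κ) (suc l) ⟩
        dk pre (suc l) + dk (suc l ∷ κ) (suc l) ≡⟨ cong₂ _+_ (dk-above (above (here refl))) (dk-below (≤-refl ∷ below-head dec)) ⟩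
        (j + dk pre l) + (m + dk (suc l ∷ κ) l) ≡⟨ arrange j (dk pre l) m (dk (suc l ∷ κ) l) ⟩
        (j + (dk pre l + dk (suc l ∷ κ) l)) + m ≡⟨ cong (λ z → (j + z) + m) (trans (sym (dk-++ pre (suc l ∷ κ) l)) (cong (λ z → dk z l) e)) ⟩
        (j + dk κ₀ l) + m ∎
        where
        open ≡-Reasoning
        arrange : ∀ a b c d → (a + b) + (c + d) ≡ (a + (b + d)) + c
        arrange a b c d = trans (cong ((a + b) +_) (+-comm c d)) (trans (sym (+-assoc (a + b) d c)) (cong (_+ c) (+-assoc a b d)))
      second : (q ^ deg φ) ^ j * q ^ (deg φ * dk κ₀ l) ≡ q ^ ((dk κ₀ (suc l) ∸ m) * d)
      second = begin
        (q ^ deg φ) ^ j * q ^ (deg φ * dk κ₀ l) ≡⟨ cong (_* q ^ (deg φ * dk κ₀ l)) (^-*-assoc q (deg φ) j) ⟩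
        q ^ (deg φ * j) * q ^ (deg φ * dk κ₀ l) ≡⟨ ^-distribˡ-+-* q (deg φ * j) _ ⟨
        q ^ (deg φ * j + deg φ * dk κ₀ l) ≡⟨ cong (q ^_) (*-distribˡ-+ (deg φ) j _) ⟨
        q ^ (deg φ * (j + dk κ₀ l)) ≡⟨ cong (q ^_) (trans (cong (_* (j + dk κ₀ l)) (sym d≡)) (*-comm d _)) ⟩
        q ^ ((j + dk κ₀ l) * d) ≡⟨ cong (λ z → q ^ (z * d)) (m+n∸n≡m (j + dk κ₀ l) m) ⟨
        q ^ (((j + dk κ₀ l) + m ∸ m) * d) ≡⟨ cong (λ z → q ^ ((z ∸ m) * d)) growth ⟨
        q ^ ((dk κ₀ (suc l) ∸ m) * d) ∎
        where open ≡-Reasoning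

    good-size-cd : IsPartition κ₀ → HasSize (Good A φ [] κ₀) (cd q d κ₀)
    good-size-cd (pos , dec) = subst (HasSize _) (trans (goodCount-byParts [] κ₀ refl pos dec (λ _ → [])) (sym (regroup term (sum κ₀) κ₀ pos (parts≤sum κ₀)))) (start κ₀ pos dec)
      where
      start : ∀ κ → All (1 ≤_) κ → Decreasing κ → HasSize (Good A φ [] κ) (goodCount A iφ (dk κ₀) kernels 0 κ)
      start [] _ _ = good-size A iφ (dk κ₀) kernels 0 [] [] [-] [] [] (λ { [] _ _ → [] }) ([] , refl)
      -- Nothing precedes the first choice and `acc` is empty, so the largest part can itself act as
      -- the preceding exponent.
      start (l ∷ κ) pos dec = good-size A iφ (dk κ₀) kernels l (l ∷ κ) [] (≤-refl ∷ dec) pos [] (λ { [] _ _ → [] }) ([] , refl)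

  centralizer-order : ∀ {n} {A : Mat n} {t} → HasType n A t → HasSize (λ g → GL n g × g · A ≡ A · g) (cprod q t)
  centralizer-order {A = A} {t} (D , inA@((valid , dist) , _) , tA) = from-decomp (InClass⇒Decomp inA)
    where
    from-decomp : (∃ λ vs → Decomp A vs (summands D)) → HasSize (λ g → GL _ g × g · A ≡ A · g) (cprod q t)
    from-decomp (vs , dec) = subst (HasSize _) (trans (cong product (map-∘ D)) (product-↭ (map⁺ _ tA)))
      (centralizer-size A valid dist dec (λ e → cd q (deg (proj₁ e)) (proj₂ e)) (All.tabulate λ {e} e∈ →
        let iφ , _ , part , _ = All.lookup valid e∈ in
        good-size-cd {A = A} iφ (deg (proj₁ e)) refl (proj₂ e)
          (λ k → subst (HasSize _) (product-present (proj₁ e) k dist e∈) (block-kernel-size (proj₁ e) k iφ valid dec)) part))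

-- Decidability of types by finite search.

module TypeDec {q : ℕ} (F : FiniteField q) where
  open import Data.Nat.Base as ℕ using (zero; suc; _≤_; s≤s; _∸_)
  import Data.Nat.Properties as ℕP
  open import Data.Fin.Base using (toℕ)
  import Data.Fin.Properties as FinP
  open import Data.List.Base using (List; []; _∷_; _++_; length; map; [_]; concatMap; upTo; cartesianProductWith; cartesianProduct; zip)
  open import Data.List.Properties using (length-map) renaming (≡-dec to ≡-decᴸ)
  open import Data.List.Relation.Unary.All as All using (All; []; _∷_)
  open import Data.List.Relation.Unary.AllPairs using (allPairs?)
  open import Data.List.Relation.Unary.Any using (here; any?)
  open import Data.List.Relation.Unary.Linked using (linked?)
  open import Data.List.Membership.Propositional using (_∈_; find; lose)
  open import Data.List.Membership.Propositional.Properties using (∈-∃++; ∈-cartesianProductWith⁺; ∈-cartesianProduct⁺; ∈-concatMap⁺; ∈-map⁺; ∈-upTo⁺)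
  open import Data.List.Relation.Binary.Pointwise as Pointwise using (Pointwise; Pointwise-length)
  open import Data.List.Relation.Binary.Permutation.Propositional using (_↭_; refl; prep; ↭-sym; ↭-trans; ↭-refl)
  open import Data.List.Relation.Binary.Permutation.Propositional.Properties using (∈-resp-↭; ↭-length; shift; drop-∷; ¬x∷xs↭[])
  open import Data.Product using (∃; _×_; _,_; proj₁; proj₂)
  open import Data.Product.Properties using () renaming (≡-dec to ≡-decˣ)
  open import Data.Unit using (tt)
  open import Data.Empty using (⊥-elim)
  open import Relation.Nullary
  open import Relation.Nullary.Decidable using (map′)
  open import Relation.Unary using (Decidable)
  open import Relation.Binary using (DecidableEquality)
  open import Relation.Binary.PropositionalEquality hiding ([_])
  open Counting
  open PolyRing F using (0F; 1F)
  open PolyArith F using (mul-monic; length-snoc)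
  open Roots F using (size-length; _≟P_)
  open Lin F
  open TypeCount F
  open LinAlg F

  -- The list may contain more than the witnesses, as long as it contains them all; length bounds
  -- provide such lists for factors, coefficient lists and class data.
  search : {X : Set} {P : X → Set} → Decidable P → (xs : List X) → (∀ x → P x → x ∈ xs) → Dec (∃ P)
  search P? xs complete = map′ (λ a → let x , _ , p = find a in x , p) (λ { (x , p) → lose (complete x p) p }) (any? P? xs)

  module _ {X : Set} (_≟X_ : DecidableEquality X) where
    permutation? : (xs ys : List X) → Dec (xs ↭ ys)
    permutation? [] [] = yes ↭-refl
    permutation? [] (y ∷ ys) = no λ p → ¬x∷xs↭[] (↭-sym p)
    permutation? (x ∷ xs) ys with any? (x ≟X_) ys
    ... | no x∉ = no λ p → x∉ (∈-resp-↭ p (here refl))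
    ... | yes x∈ with ∈-∃++ x∈
    ... | as , bs , refl = map′ (λ p → ↭-trans (prep x p) (↭-sym (shift x as bs))) (λ p → drop-∷ (↭-trans p (shift x as bs))) (permutation? xs (as ++ bs))

  listsOver : {X : Set} → List X → ℕ → List (List X)
  listsOver L zero = [ [] ]
  listsOver L (suc k) = cartesianProductWith _∷_ L (listsOver L k)

  ∈-listsOver : {X : Set} (L : List X) (xs : List X) → All (_∈ L) xs → xs ∈ listsOver L (length xs)
  ∈-listsOver L [] _ = here refl
  ∈-listsOver L (x ∷ xs) (x∈ All.∷ xs∈) = ∈-cartesianProductWith⁺ _∷_ x∈ (∈-listsOver L xs xs∈)

  polys : ℕ → List Poly
  polys d = proj₁ (size-length d)

  ∈-polys : ∀ p → p ∈ polys (length p)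
  ∈-polys p = proj₁ (proj₂ (proj₂ (proj₂ (size-length (length p))))) p refl

  Monic? : Decidable Monic
  Monic? p = search (λ r → p ≟P (r ++ [ 1F ])) (polys (length p ∸ 1)) λ { r refl → subst (λ d → r ∈ polys d) (sym (cong (_∸ 1) (length-snoc r))) (∈-polys r) }

  -- Lengths of monic factors are bounded by that of the product, which leaves finitely many pairs
  -- to test.
  MonicIrreducible? : Decidable MonicIrreducible
  MonicIrreducible? φ = Monic? φ ×-dec (1 ℕP.≤? deg φ) ×-dec
    map′ (λ none g h mg mh dg dh e → none ((g , h) , mg , mh , dg , dh , e)) (λ irr → λ { ((g , h) , mg , mh , dg , dh , e) → irr g h mg mh dg dh e })
      (¬? (search (λ { (g , h) → Monic? g ×-dec Monic? h ×-dec (1 ℕP.≤? deg g) ×-dec (1 ℕP.≤? deg h) ×-dec (polyMul g h ≟P φ) })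
        (cartesianProduct short short) λ { (g , h) (mg , mh , _ , _ , e) → ∈-cartesianProduct⁺ (∈-short g (proj₁ (bounds mg mh e))) (∈-short h (proj₂ (bounds mg mh e))) }))
    where
    short : List Poly
    short = concatMap polys (upTo (suc (length φ)))
    ∈-short : ∀ p → length p ≤ length φ → p ∈ short
    ∈-short p le = ∈-concatMap⁺ polys (lose (∈-upTo⁺ (s≤s le)) (∈-polys p))
    bounds : ∀ {g h} → Monic g → Monic h → polyMul g h ≡ φ → length g ≤ length φ × length h ≤ length φ
    bounds (g₀ , refl) (h₀ , refl) e with mul-monic g₀ h₀
    ... | s , es , ls = subst₂ _≤_ (sym (length-snoc g₀)) (sym len) (s≤s (ℕP.m≤m+n _ _)) , subst₂ _≤_ (sym (length-snoc h₀)) (sym len) (s≤s (ℕP.m≤n+m _ _))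
      where
      len : length φ ≡ suc (length g₀ ℕ.+ length h₀)
      len = trans (cong length (trans (sym e) es)) (trans (length-snoc s) (cong suc ls))

  IsPartition? : Decidable IsPartition
  IsPartition? κ = All.all? (1 ℕP.≤?_) κ ×-dec linked? (λ a b → b ℕP.≤? a) κ

  ValidData? : Decidable ValidData
  ValidData? D = All.all? (λ e → MonicIrreducible? (proj₁ e) ×-dec ¬? (proj₁ e ≟P Xpoly) ×-dec IsPartition? (proj₂ e) ×-dec ¬? (≡-decᴸ ℕP._≟_ (proj₂ e) [])) D
    ×-dec allPairs? (λ e e′ → ¬? (proj₁ e ≟P proj₁ e′)) D

  module _ {n : ℕ} where
    LinIndep? : (vs : List (V n)) → Dec (LinIndep vs)
    LinIndep? vs = map′ (λ none cs l e → decidable-stable (zero? cs) λ nz → none (cs , l , e , nz)) (λ li → λ { (cs , l , e , nz) → nz (li cs l e) })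
      (¬? (search (λ cs → (length cs ℕP.≟ length vs) ×-dec (linComb cs vs ≟V 0v) ×-dec ¬? (zero? cs)) (polys (length vs))
        λ cs h → subst (λ k → cs ∈ polys k) (proj₁ h) (∈-polys cs)))
      where
      zero? : (cs : List K) → Dec (All (_≡ 0F) cs)
      zero? = All.all? (FinP._≟ 0F)

    InClass? : (A : Mat n) (D : ClassData) → Dec (InClass n A D)
    InClass? A D = ValidData? D ×-dec search
      (λ vs → Pointwise.decidable (λ v s → polyApply (polyPow (proj₁ s) (proj₂ s)) A v ≟V 0v) vs (summands D)
        ×-dec LinIndep? (cyclicBasis A (zip vs (summands D))) ×-dec (length (cyclicBasis A (zip vs (summands D))) ℕP.≟ n))
      (listsOver (proj₁ (size-V n)) (length (summands D)))
      λ vs h → subst (λ k → vs ∈ listsOver (proj₁ (size-V n)) k) (Pointwise-length (proj₁ h))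
        (∈-listsOver _ vs (All.universal (λ v → proj₁ (proj₂ (proj₂ (proj₂ (size-V n)))) v tt) vs))

    -- A monic polynomial of degree d is a list of length d + 1, so the degrees and partitions of a
    -- type leave finitely many candidates for each entry of the data.
    entries : Ty → List (Poly × List ℕ)
    entries = concatMap λ p → map (_, proj₂ p) (polys (suc (proj₁ p)))

    HasType? : (A : Mat n) (t : Ty) → Dec (HasType n A t)
    HasType? A t = search (λ D → InClass? A D ×-dec permutation? (≡-decˣ ℕP._≟_ (≡-decᴸ ℕP._≟_)) (typeOf D) t)
      (listsOver (entries t) (length t)) λ { D (((valid , _) , _) , p) → subst (λ k → D ∈ listsOver (entries t) k)
        (trans (sym (length-map _ D)) (↭-length p)) (∈-listsOver (entries t) D (All.tabulate λ {e} e∈ →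
          ∈-concatMap⁺ _ (lose (∈-resp-↭ p (∈-map⁺ _ e∈)) (∈-map⁺ _ (monic-length (proj₁ e) (proj₁ (proj₁ (All.lookup valid e∈)))))))) }
      where
      monic-length : ∀ φ → Monic φ → φ ∈ polys (suc (deg φ))
      monic-length φ (r , refl) = subst (λ k → φ ∈ polys k) (trans (length-snoc r) (cong suc (sym (cong (_∸ 1) (length-snoc r))))) (∈-polys φ)

    GLν? : (ν : List ℕ) → Decidable (GLν n ν)
    GLν? ν g = GL? g ×-dec FinP.all? λ i → FinP.all? λ j → ¬? (blockOf ν (toℕ i) ℕP.≟ blockOf ν (toℕ j)) →-dec (_ FinP.≟ _)

    count-exists : ∀ ν A → ∃ λ a → CountInClass n ν A a
    count-exists ν A = size-⊤-filter (size-Mat n) (λ g → GLν? ν g ×-dec Conj? A g)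

    -- One number has to be named before any matrix is given. It is the count for some invertible
    -- matrix of type `t`, whose existence is decided by search; if there is none, the requirement
    -- is vacuous and 0 serves.
    type-count : (t : Ty) (ν : List ℕ) → ∃ λ a → ∀ A → GL n A → HasType n A t → CountInClass n ν A a
    type-count t ν = choose (search (λ A → GL? A ×-dec HasType? A t) (proj₁ (size-Mat n)) λ A _ → proj₁ (proj₂ (proj₂ (proj₂ (size-Mat n)))) A tt)
      where
      choose : Dec (∃ λ A → GL n A × HasType n A t) → ∃ λ a → ∀ A → GL n A → HasType n A t → CountInClass n ν A a
      choose (no none) = 0 , λ A gA tA → ⊥-elim (none (A , gA , tA))
      choose (yes (A₀ , g₀ , t₀)) = proj₁ (count-exists ν A₀) , λ A gA tA →
        subst (CountInClass n ν A) (same-type-count {A = A} {A₀} {ν = ν} gA g₀ tA t₀ (proj₂ (count-exists ν A)) (proj₂ (count-exists ν A₀))) (proj₂ (count-exists ν A))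

-- Double counting of the triples (x, y, g) with x g = g y.

module DoubleCoset {q : ℕ} (F : FiniteField q) where
  open import Data.Nat.Base using (_+_; _*_)
  import Data.Nat.Properties as ℕP
  open import Data.List.Base using (List; []; _∷_; length; map; cartesianProduct)
  open import Data.List.Relation.Unary.All as All using (All; []; _∷_)
  open import Data.List.Relation.Unary.AllPairs using (AllPairs; []; _∷_)
  open import Data.List.Relation.Unary.Any using (Any)
  import Data.List.Relation.Unary.Unique.Propositional.Properties as Uniq
  open import Data.List.Membership.Propositional using (_∈_)
  open import Data.List.Membership.Propositional.Properties using (∈-cartesianProduct⁺; ∈-cartesianProduct⁻)
  open import Data.Product using (∃; _×_; _,_; proj₁; proj₂)
  open import Data.Empty using (⊥-elim)
  open import Relation.Nullary
  open import Relation.Unary using (Decidable)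
  open import Relation.Binary.PropositionalEquality hiding ([_])
  open Counting
  open Lin F
  open LinAlg F

  ∑-map : ∀ {X Y : Set} (f : X → Y) (xs : List X) (g : Y → ℕ) → ∑ (map f xs) g ≡ ∑ xs λ x → g (f x)
  ∑-map f [] g = refl
  ∑-map f (x ∷ xs) g = cong (g (f x) +_) (∑-map f xs g)

  ∑-cartesianProduct : ∀ {X Y : Set} (xs : List X) (ys : List Y) (f : X × Y → ℕ) →
    ∑ (cartesianProduct xs ys) f ≡ ∑ xs λ x → ∑ ys λ y → f (x , y)
  ∑-cartesianProduct [] ys f = refl
  ∑-cartesianProduct (x ∷ xs) ys f = trans (∑-++ (map (x ,_) ys) _ f) (cong₂ _+_ (∑-map (x ,_) ys f) (∑-cartesianProduct xs ys f))

  ∑∑-corr : ∀ {X Y : Set} {P Q : X × Y → Set} {R} {xs : List X} {ys : List Y} (P? : Decidable P) (Q? : Decidable Q) →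
    AllPairs _≢_ xs → AllPairs _≢_ ys →
    Corr (λ p → (proj₁ p ∈ xs × proj₂ p ∈ ys) × P p) (λ p → (proj₁ p ∈ xs × proj₂ p ∈ ys) × Q p) R →
    (∑ xs λ x → ∑ ys λ y → ⟦ P? (x , y) ⟧) ≡ (∑ xs λ x → ∑ ys λ y → ⟦ Q? (x , y) ⟧)
  ∑∑-corr {xs = xs} {ys} P? Q? ux uy c = trans (sym (∑-cartesianProduct xs ys λ p → ⟦ P? p ⟧))
    (trans (size-unique (size-corr c (sized P?)) (sized Q?)) (∑-cartesianProduct xs ys λ p → ⟦ Q? p ⟧))
    where
    sized : ∀ {S : _ → Set} (S? : Decidable S) → HasSize (λ p → (proj₁ p ∈ xs × proj₂ p ∈ ys) × S p) (∑ (cartesianProduct xs ys) λ p → ⟦ S? p ⟧)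
    sized S? = size-⇔ (λ p h → ∈-cartesianProduct⁻ xs ys (proj₁ h) , proj₂ h) (λ p h → ∈-cartesianProduct⁺ (proj₁ (proj₁ h)) (proj₂ (proj₁ h)) , proj₂ h)
      (size-∑ S? (Uniq.cartesianProduct⁺ ux uy))

  ⟦⟧-yes : ∀ {X : Set} (d : Dec X) → X → ⟦ d ⟧ ≡ 1
  ⟦⟧-yes (yes _) x = refl
  ⟦⟧-yes (no n) x = ⊥-elim (n x)

  ⟦⟧-no : ∀ {X : Set} (d : Dec X) → ¬ X → ⟦ d ⟧ ≡ 0
  ⟦⟧-no (yes x) n = ⊥-elim (n x)
  ⟦⟧-no (no _) n = refl

  module _ {n : ℕ} where
    cancelˡ : (M B C : Mat n) → GL n M → M · B ≡ M · C → B ≡ C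
    cancelˡ M B C (M′ , _ , f) e = trans (sym (cancel-invˡ M M′ f B)) (trans (cong (M′ ·_) e) (cancel-invˡ M M′ f C))

    cancelʳ : (M B C : Mat n) → GL n M → B · M ≡ C · M → B ≡ C
    cancelʳ M B C (M′ , e′ , _) e = trans (sym (cancel-invʳ M M′ e′ B)) (trans (cong (_· M′) e) (cancel-invʳ M M′ e′ C))

    inverse-unique : (M b b′ : Mat n) → GL n M → M · b ≡ I → M · b′ ≡ I → b ≡ b′
    inverse-unique M b b′ h e e′ = cancelˡ M b b′ h (trans e (sym e′))

    module _ {λs μs : List ℕ} where
      private
        _~_ : Mat n → Mat n → Set
        _~_ = DoubleCosetRel n λs μs

      ~-sym : ∀ {g h} → g ~ h → h ~ g
      ~-sym {g} {h} (x , y , hx@((x′ , _ , fx) , _) , hy@((y′ , ey , _) , _) , e) = x′ , y′ , GLν-inv λs {x} hx , GLν-inv μs {y} hy , (begin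
        (x′ · h) · y′ ≡⟨ cong (λ z → (x′ · z) · y′) e ⟨
        (x′ · ((x · g) · y)) · y′ ≡⟨ ·-assoc x′ ((x · g) · y) y′ ⟩
        x′ · (((x · g) · y) · y′) ≡⟨ cong (x′ ·_) (cancel-invʳ y y′ ey (x · g)) ⟩
        x′ · (x · g) ≡⟨ cancel-invˡ x x′ fx g ⟩
        g ∎)
        where open ≡-Reasoning

      ~-trans : ∀ {g h k} → g ~ h → h ~ k → g ~ k
      ~-trans {g} {h} {k} (x , y , hx , hy , e) (x₁ , y₁ , hx₁ , hy₁ , e₁) = x₁ · x , y · y₁ , GLν-· λs {g = x₁} {x} hx₁ hx , GLν-· μs {g = y} {y₁} hy hy₁ , (begin
        ((x₁ · x) · g) · (y · y₁) ≡⟨ ·-assoc _ y y₁ ⟨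
        (((x₁ · x) · g) · y) · y₁ ≡⟨ cong (λ z → (z · y) · y₁) (·-assoc x₁ x g) ⟩
        ((x₁ · (x · g)) · y) · y₁ ≡⟨ cong (_· y₁) (·-assoc x₁ (x · g) y) ⟩
        (x₁ · ((x · g) · y)) · y₁ ≡⟨ cong (λ z → (x₁ · z) · y₁) e ⟩
        (x₁ · h) · y₁ ≡⟨ e₁ ⟩
        k ∎)
        where open ≡-Reasoning

      module _ {Hs Ls Gs rs : List (Mat n)}
        (uH : AllPairs _≢_ Hs) (pH : ∀ x → x ∈ Hs → GLν n λs x) (cH : ∀ x → GLν n λs x → x ∈ Hs)
        (uL : AllPairs _≢_ Ls) (pL : ∀ y → y ∈ Ls → GLν n μs y) (cL : ∀ y → GLν n μs y → y ∈ Ls)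
        (uG : AllPairs _≢_ Gs) (pG : ∀ g → g ∈ Gs → GL n g) (cG : ∀ g → GL n g → g ∈ Gs)
        (pR : All (GL n) rs) (dR : AllPairs (λ x y → ¬ (x ~ y)) rs) (cR : ∀ x → GL n x → Any (x ~_) rs) where

        -- For r = x₀ g y₀ the substitution a = x x₀, b = (y₀ y)⁻¹ turns x r y = g into a g = g b.
        same-orbit : ∀ g r → g ~ r →
          (∑ Hs λ x → ∑ Ls λ y → ⟦ (x · r) · y ≟M g ⟧) ≡ (∑ Hs λ x → ∑ Ls λ y → ⟦ x · g ≟M g · y ⟧)
        same-orbit g r (x₀ , y₀ , hx₀@(gx₀@(x₀′ , ex₀ , fx₀) , _) , hy₀@(gy₀@(y₀′ , ey₀ , fy₀) , _) , e₀) =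
          ∑∑-corr {R = λ p a → proj₁ a ≡ proj₁ p · x₀ × (y₀ · proj₂ p) · proj₂ a ≡ I} (λ p → (proj₁ p · r) · proj₂ p ≟M g) (λ a → proj₁ a · g ≟M g · proj₂ a) uH uL (record
            { total = λ { (x , y) ((x∈ , y∈) , e) → total x y (pH x x∈) (pL y y∈) e }
            ; onto = λ { (a , b) ((a∈ , b∈) , e) → onto a b (pH a a∈) (pL b b∈) e }
            ; inj = λ { (x , y) (x′ , y′) (a , b) ((_ , y∈) , _) ((_ , y′∈) , _) (ea , eb) (ea′ , eb′) →
                cong₂ _,_ (cancelʳ x₀ x x′ gx₀ (trans (sym ea) ea′)) (cancelˡ y₀ y y′ gy₀ (left-inverse (y₀ · y) (y₀ · y′) b (GL-· {A = y₀} {y} gy₀ (proj₁ (pL y y∈))) eb eb′)) }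
            ; fun = λ { (x , y) (a , b) (a′ , b′) ((_ , y∈) , _) _ _ (ea , eb) (ea′ , eb′) →
                cong₂ _,_ (trans ea (sym ea′)) (inverse-unique (y₀ · y) b b′ (GL-· {A = y₀} {y} gy₀ (proj₁ (pL y y∈))) eb eb′) } })
          where
          open ≡-Reasoning
          left-inverse : ∀ M M′ b → GL n M → M · b ≡ I → M′ · b ≡ I → M ≡ M′
          left-inverse M M′ b (N , e , f) eb eb′ = trans (sym (·-identityˡ M)) (trans (cong (_· M) (sym eb′)) (trans (·-assoc M′ b M) (trans (cong (M′ ·_) (trans (cong (_· M) (inverse-unique M b N (N , e , f) eb e)) f)) (·-identityʳ M′))))
          expand : ∀ x y → (x · r) · y ≡ ((x · x₀) · g) · (y₀ · y)
          expand x y = begin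
            (x · r) · y ≡⟨ cong (λ z → (x · z) · y) e₀ ⟨
            (x · ((x₀ · g) · y₀)) · y ≡⟨ cong (_· y) (·-assoc x (x₀ · g) y₀) ⟨
            ((x · (x₀ · g)) · y₀) · y ≡⟨ cong (λ z → (z · y₀) · y) (·-assoc x x₀ g) ⟨
            (((x · x₀) · g) · y₀) · y ≡⟨ ·-assoc _ y₀ y ⟩
            ((x · x₀) · g) · (y₀ · y) ∎
          total : ∀ x y → GLν n λs x → GLν n μs y → (x · r) · y ≡ g →
            ∃ λ a → ((proj₁ a ∈ Hs × proj₂ a ∈ Ls) × proj₁ a · g ≡ g · proj₂ a) × (proj₁ a ≡ x · x₀ × (y₀ · y) · proj₂ a ≡ I)
          total x y hx hy e = from-inverse (GLν-· μs {g = y₀} {y} hy₀ hy)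
            where
            from-inverse : GLν n μs (y₀ · y) → ∃ λ a → ((proj₁ a ∈ Hs × proj₂ a ∈ Ls) × proj₁ a · g ≡ g · proj₂ a) × (proj₁ a ≡ x · x₀ × (y₀ · y) · proj₂ a ≡ I)
            from-inverse hM@((b , eb , fb) , _) = (x · x₀ , b) , ((cH _ (GLν-· λs {g = x} {x₀} hx hx₀) , cL b (GLν-inv μs {y₀ · y} hM)) , (begin
              (x · x₀) · g ≡⟨ cancel-invʳ (y₀ · y) b eb ((x · x₀) · g) ⟨
              (((x · x₀) · g) · (y₀ · y)) · b ≡⟨ cong (_· b) (trans (sym (expand x y)) e) ⟩
              g · b ∎)) , refl , eb
          onto : ∀ a b → GLν n λs a → GLν n μs b → a · g ≡ g · b →
            ∃ λ p → ((proj₁ p ∈ Hs × proj₂ p ∈ Ls) × (proj₁ p · r) · proj₂ p ≡ g) × (a ≡ proj₁ p · x₀ × (y₀ · proj₂ p) · b ≡ I)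
          onto a b ha hb@((b′ , eb , fb) , _) e = (a · x₀′ , y₀′ · b′) ,
            ((cH _ (GLν-· λs {g = a} {x₀′} ha (GLν-inv λs {x₀} hx₀)) , cL _ (GLν-· μs {g = y₀′} {b′} (GLν-inv μs {y₀} hy₀) (GLν-inv μs {b} hb))) , (begin
              ((a · x₀′) · r) · (y₀′ · b′) ≡⟨ expand (a · x₀′) (y₀′ · b′) ⟩
              (((a · x₀′) · x₀) · g) · (y₀ · (y₀′ · b′)) ≡⟨ cong₂ (λ u v → (u · g) · v) (cancel-invʳ x₀′ x₀ fx₀ a) (cancel-invˡ y₀′ y₀ ey₀ b′) ⟩
              (a · g) · b′ ≡⟨ cong (_· b′) e ⟩
              (g · b) · b′ ≡⟨ cancel-invʳ b b′ eb g ⟩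
              g ∎)) ,
            sym (cancel-invʳ x₀′ x₀ fx₀ a) , trans (cong (_· b) (cancel-invˡ y₀′ y₀ ey₀ b′)) fb

        other-orbit : ∀ g r → ¬ (g ~ r) → (∑ Hs λ x → ∑ Ls λ y → ⟦ (x · r) · y ≟M g ⟧) ≡ 0
        other-orbit g r n≁ = trans (∑-cong Hs λ x x∈ → trans (∑-cong Ls λ y y∈ → ⟦⟧-no ((x · r) · y ≟M g) λ e → n≁ (~-sym {r} {g} (x , y , pH x x∈ , pL y y∈ , e))) (∑-0 Ls)) (∑-0 Hs)

        exactly-one : ∀ h → GL n h → (∑ Gs λ g → ⟦ h ≟M g ⟧) ≡ 1
        exactly-one h gh = ∑-representative {R = _≡_} {g = h} Gs (λ g → ⟦ h ≟M g ⟧) uG (λ e e′ → trans (sym e) e′)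
          (cG h gh) (λ g e → ⟦⟧-yes (h ≟M g) e) (λ g ne → ⟦⟧-no (h ≟M g) ne)

        -- For a fixed representative `r`, every pair (x, y) gives x r y = g for exactly one g, so
        -- each double coset contributes the full number of pairs. Summed over g first, only the
        -- representative of the double coset of g contributes, and `same-orbit` turns its solutions
        -- of x r y = g into those of x g = g y.
        burnside : length Hs * length Ls * length rs ≡ ∑ Hs λ x → ∑ Ls λ y → ∑ Gs λ g → ⟦ x · g ≟M g · y ⟧
        burnside = begin
          length Hs * length Ls * length rs ≡⟨ ℕP.*-comm _ (length rs) ⟩
          length rs * (length Hs * length Ls) ≡⟨ ∑-const rs _ ⟨
          (∑ rs λ r → length Hs * length Ls) ≡⟨ ∑-cong rs (λ r r∈ → sym (pairs r (All.lookup pR r∈))) ⟩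
          (∑ rs λ r → ∑ Gs λ g → ∑ Hs λ x → ∑ Ls λ y → ⟦ (x · r) · y ≟M g ⟧) ≡⟨ ∑-swap rs Gs _ ⟩
          (∑ Gs λ g → ∑ rs λ r → ∑ Hs λ x → ∑ Ls λ y → ⟦ (x · r) · y ≟M g ⟧) ≡⟨ ∑-cong Gs (λ g g∈ →
              ∑-representative {R = _~_} {g = g} rs _ dR (λ {x} {y} p r → ~-trans {x} {g} {y} (~-sym {g} {x} p) r) (cR g (pG g g∈)) (same-orbit g) (other-orbit g)) ⟩
          (∑ Gs λ g → ∑ Hs λ x → ∑ Ls λ y → ⟦ x · g ≟M g · y ⟧) ≡⟨ ∑-swap Gs Hs _ ⟩
          (∑ Hs λ x → ∑ Gs λ g → ∑ Ls λ y → ⟦ x · g ≟M g · y ⟧) ≡⟨ ∑-cong Hs (λ x _ → ∑-swap Gs Ls _) ⟩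
          (∑ Hs λ x → ∑ Ls λ y → ∑ Gs λ g → ⟦ x · g ≟M g · y ⟧) ∎
          where
          open ≡-Reasoning
          pairs : ∀ r → GL n r → (∑ Gs λ g → ∑ Hs λ x → ∑ Ls λ y → ⟦ (x · r) · y ≟M g ⟧) ≡ length Hs * length Ls
          pairs r gr = trans (∑-swap Gs Hs _) (trans (∑-cong Hs λ x x∈ → trans (∑-swap Gs Ls _)
            (trans (∑-cong Ls λ y y∈ → exactly-one ((x · r) · y) (GL-· {A = x · r} {y} (GL-· {A = x} {r} (proj₁ (pH x x∈)) gr) (proj₁ (pL y y∈))))
              (trans (∑-const Ls 1) (ℕP.*-identityʳ _)))) (∑-const Hs _))

    module _ {Gs : List (Mat n)} (uG : AllPairs _≢_ Gs) (pG : ∀ g → g ∈ Gs → GL n g) (cG : ∀ g → GL n g → g ∈ Gs) where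

      intertwiners : Mat n → Mat n → ℕ
      intertwiners x y = ∑ Gs λ g → ⟦ x · g ≟M g · y ⟧

      -- The solutions of x h = h y form a translate of the centralizer: with `k · x ≡ A · k` and
      -- `m · A ≡ y · m`, the map sending `h` to `(k · h) · m` is a bijection onto the matrices
      -- commuting with `A`.
      intertwiners-conjugate : ∀ {A x y z} → HasSize (λ g → GL n g × g · A ≡ A · g) z → Conj A x → Conj A y → intertwiners x y ≡ z
      intertwiners-conjugate {A} {x} {y} hz A~x (m , gm@(m′ , em , fm) , cm) with Conj-sym {A = A} {x} A~x
      ... | k , gk@(k′ , ek , fk) , ck = size-unique (size-corr {R = λ h g → g ≡ (k · h) · m} (record
          { total = λ h (h∈ , e) → (k · h) · m , (GL-· {A = k · h} {m} (GL-· {A = k} {h} gk (pG h h∈)) gm , commute h e) , refl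
          ; onto = λ g (gg , e) → (k′ · g) · m′ , (cG _ (GL-· {A = k′ · g} {m′} (GL-· {A = k′} {g} (GL-inv gk) gg) (GL-inv gm)) , intertwine g e) ,
              sym (trans (cong (_· m) (trans (sym (·-assoc k (k′ · g) m′)) (cong (_· m′) (cancel-invˡ k′ k ek g)))) (cancel-invʳ m′ m fm g))
          ; inj = λ h h′ g _ _ e e′ → cancelˡ k h h′ gk (cancelʳ m (k · h) (k · h′) gm (trans (sym e) e′))
          ; fun = λ { _ _ _ _ _ _ refl refl → refl } }) (size-∑ (λ h → x · h ≟M h · y) uG)) hz
        where
        open ≡-Reasoning
        commute : ∀ h → x · h ≡ h · y → ((k · h) · m) · A ≡ A · ((k · h) · m)
        commute h e = begin
          ((k · h) · m) · A ≡⟨ ·-assoc (k · h) m A ⟩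
          (k · h) · (m · A) ≡⟨ cong ((k · h) ·_) cm ⟩
          (k · h) · (y · m) ≡⟨ ·-assoc (k · h) y m ⟨
          ((k · h) · y) · m ≡⟨ cong (_· m) (·-assoc k h y) ⟩
          (k · (h · y)) · m ≡⟨ cong (λ z → (k · z) · m) e ⟨
          (k · (x · h)) · m ≡⟨ cong (_· m) (·-assoc k x h) ⟨
          ((k · x) · h) · m ≡⟨ cong (λ z → (z · h) · m) ck ⟩
          ((A · k) · h) · m ≡⟨ cong (_· m) (·-assoc A k h) ⟩
          (A · (k · h)) · m ≡⟨ ·-assoc A (k · h) m ⟩
          A · ((k · h) · m) ∎
        ck′ : x · k′ ≡ k′ · A
        ck′ = begin
          x · k′ ≡⟨ cancel-invˡ k k′ fk (x · k′) ⟨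
          k′ · (k · (x · k′)) ≡⟨ cong (k′ ·_) (·-assoc k x k′) ⟨
          k′ · ((k · x) · k′) ≡⟨ cong (λ z → k′ · (z · k′)) ck ⟩
          k′ · ((A · k) · k′) ≡⟨ cong (k′ ·_) (cancel-invʳ k k′ ek A) ⟩
          k′ · A ∎
        cm′ : m′ · y ≡ A · m′
        cm′ = begin
          m′ · y ≡⟨ cancel-invʳ m m′ em (m′ · y) ⟨
          ((m′ · y) · m) · m′ ≡⟨ cong (_· m′) (·-assoc m′ y m) ⟩
          (m′ · (y · m)) · m′ ≡⟨ cong (λ z → (m′ · z) · m′) cm ⟨
          (m′ · (m · A)) · m′ ≡⟨ cong (_· m′) (cancel-invˡ m m′ fm A) ⟩
          A · m′ ∎
        intertwine : ∀ g → g · A ≡ A · g → x · ((k′ · g) · m′) ≡ ((k′ · g) · m′) · y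
        intertwine g e = begin
          x · ((k′ · g) · m′) ≡⟨ ·-assoc x (k′ · g) m′ ⟨
          (x · (k′ · g)) · m′ ≡⟨ cong (_· m′) (·-assoc x k′ g) ⟨
          ((x · k′) · g) · m′ ≡⟨ cong (λ z → (z · g) · m′) ck′ ⟩
          ((k′ · A) · g) · m′ ≡⟨ cong (_· m′) (·-assoc k′ A g) ⟩
          (k′ · (A · g)) · m′ ≡⟨ cong (λ z → (k′ · z) · m′) e ⟨
          (k′ · (g · A)) · m′ ≡⟨ cong (_· m′) (·-assoc k′ g A) ⟨
          ((k′ · g) · A) · m′ ≡⟨ ·-assoc (k′ · g) A m′ ⟩
          (k′ · g) · (A · m′) ≡⟨ cong ((k′ · g) ·_) cm′ ⟨
          (k′ · g) · (m′ · y) ≡⟨ ·-assoc (k′ · g) m′ y ⟨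
          ((k′ · g) · m′) · y ∎

      intertwiners-other : ∀ {A x y} → Conj A x → ¬ Conj A y → intertwiners x y ≡ 0
      intertwiners-other {A} {x} {y} A~x A≁y = trans (∑-cong Gs λ g g∈ → ⟦⟧-no (x · g ≟M g · y) λ e →
        A≁y (Conj-trans {A = A} {x} {y} A~x (Conj-sym {A = y} {x} (g , pG g g∈ , sym e)))) (∑-0 Gs)

      module _ {Hs Ls rs : List (Mat n)} (pH : ∀ x → x ∈ Hs → GL n x)
        (w : Mat n → ℕ) (hw : ∀ A → A ∈ rs → HasSize (λ g → GL n g × g · A ≡ A · g) (w A))
        (dR : AllPairs (λ x y → ¬ Conj x y) rs) (cR : ∀ x → GL n x → Any (Conj x) rs) where

        private
          summand : Mat n → Mat n → Mat n → ℕ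
          summand x y A = ⟦ Conj? A x ⟧ * (⟦ Conj? A y ⟧ * w A)

        -- Exactly one representative is conjugate to `x`. Its term is the centralizer order if `y`
        -- lies in the same class and 0 otherwise, which is `intertwiners x y` in both cases.
        intertwiners-sum : ∀ x y → GL n x → intertwiners x y ≡ ∑ rs (summand x y)
        intertwiners-sum x y gx = sym (trans (∑-cong rs λ A A∈ → evaluate A A∈ (Conj? A x) (Conj? A y))
            (∑-representative {R = Conj} {g = x} rs (λ A → ⟦ Conj? A x ⟧ * intertwiners x y) dR (λ {A} {B} p r → Conj-trans {A = A} {x} {B} (Conj-sym {A = x} {A} p) r) (cR x gx)
              (λ A x~A → trans (cong (_* intertwiners x y) (⟦⟧-yes (Conj? A x) (Conj-sym {A = x} {A} x~A))) (ℕP.*-identityˡ _))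
              (λ A x≁A → cong (_* intertwiners x y) (⟦⟧-no (Conj? A x) λ A~x → x≁A (Conj-sym {A = A} {x} A~x)))))
          where
          evaluate : ∀ A → A ∈ rs → (d : Dec (Conj A x)) (e : Dec (Conj A y)) → ⟦ d ⟧ * (⟦ e ⟧ * w A) ≡ ⟦ d ⟧ * intertwiners x y
          evaluate A A∈ (no _) e = refl
          evaluate A A∈ (yes A~x) (yes A~y) = cong (1 *_) (trans (ℕP.*-identityˡ (w A)) (sym (intertwiners-conjugate {A} {x} {y} (hw A A∈) A~x A~y)))
          evaluate A A∈ (yes A~x) (no A≁y) = cong (1 *_) (sym (intertwiners-other {A} {x} {y} A~x A≁y))

        -- Written over class representatives, the summand is a product of a factor in x and a
        -- factor in y, so after interchanging the sums the two group sums separate.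
        class-sum : (∑ Hs λ x → ∑ Ls λ y → intertwiners x y) ≡ ∑ rs λ A → (∑ Hs λ x → ⟦ Conj? A x ⟧) * ((∑ Ls λ y → ⟦ Conj? A y ⟧) * w A)
        class-sum = begin
          (∑ Hs λ x → ∑ Ls λ y → intertwiners x y) ≡⟨ ∑-cong Hs (λ x x∈ → trans (∑-cong Ls λ y _ → intertwiners-sum x y (pH x x∈)) (∑-swap Ls rs (summand x))) ⟩
          (∑ Hs λ x → ∑ rs λ A → ∑ Ls λ y → summand x y A) ≡⟨ ∑-swap Hs rs _ ⟩
          (∑ rs λ A → ∑ Hs λ x → ∑ Ls λ y → summand x y A) ≡⟨ ∑-cong rs (λ A _ → trans (∑-cong Hs λ x _ → trans (∑-*ˡ Ls (λ y → ⟦ Conj? A y ⟧ * w A) ⟦ Conj? A x ⟧) (cong (⟦ Conj? A x ⟧ *_) (∑-*ʳ Ls (λ y → ⟦ Conj? A y ⟧) (w A)))) (∑-*ʳ Hs (λ x → ⟦ Conj? A x ⟧) _)) ⟩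
          (∑ rs λ A → (∑ Hs λ x → ⟦ Conj? A x ⟧) * ((∑ Ls λ y → ⟦ Conj? A y ⟧) * w A)) ∎
          where open ≡-Reasoning

-- Grouping conjugacy classes by type.

module Formula {q : ℕ} (F : FiniteField q) where
  open import Data.Nat.Base using (_+_; _*_)
  import Data.Nat.Properties as ℕP
  open import Data.List.Base using (List; []; _∷_; _++_; foldr)
  open import Data.List.Relation.Unary.All as All using (All; []; _∷_)
  open import Data.List.Relation.Unary.AllPairs using (AllPairs; []; _∷_)
  import Data.List.Relation.Unary.AllPairs.Properties as AllPairsP
  open import Data.List.Relation.Unary.Any using (Any; here; there)
  import Data.List.Relation.Unary.Any.Properties as AnyP
  open import Data.List.Membership.Propositional using (_∈_)
  open import Data.List.Membership.Propositional.Properties using (∈-++⁻)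
  open import Data.List.Relation.Binary.Permutation.Propositional using (_↭_)
  open import Data.Product using (∃; _×_; _,_; proj₁; proj₂)
  open import Data.Sum using (_⊎_; inj₁; inj₂)
  open import Relation.Nullary
  open import Relation.Binary.PropositionalEquality hiding ([_])
  open Counting
  open Lin F
  open Kernel F using (types-agree)
  open Order F using (centralizer-order)
  open DoubleCoset F
  open LinAlg F

  module _ {n : ℕ} (N : Ty → ℕ) where
    ClassCounts : List Ty → Set
    ClassCounts ts = ∀ t → t ∈ ts → NumClasses (λ A → GL n A × HasType n A t) Conj (N t)

    -- The lists contained in the class counts, put together; for a covering list of distinct types
    -- they represent every conjugacy class exactly once.
    representatives : ∀ ts → ClassCounts ts → List (Mat n)
    representatives [] h = []
    representatives (t ∷ ts) h = proj₁ (h t (here refl)) ++ representatives ts (λ s s∈ → h s (there s∈))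

    representative-type : ∀ ts (h : ClassCounts ts) A → A ∈ representatives ts h → ∃ λ t → t ∈ ts × GL n A × HasType n A t
    representative-type (t ∷ ts) h A A∈ = split (∈-++⁻ (proj₁ (h t (here refl))) A∈)
      where
      split : A ∈ proj₁ (h t (here refl)) ⊎ A ∈ representatives ts (λ s s∈ → h s (there s∈)) → ∃ λ s → s ∈ t ∷ ts × GL n A × HasType n A s
      split (inj₁ i) = t , here refl , All.lookup (proj₁ (proj₂ (h t (here refl)))) i
      split (inj₂ i) = let s , s∈ , r = representative-type ts (λ s s∈ → h s (there s∈)) A i in s , there s∈ , r

    -- Within one type the class count already excludes conjugate representatives; across two types
    -- a conjugation would make the types permutations of each other.
    representatives-distinct : ∀ ts (h : ClassCounts ts) → AllPairs (λ s t → ¬ (s ↭ t)) ts → AllPairs (λ A B → ¬ Conj A B) (representatives ts h)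
    representatives-distinct [] h _ = []
    representatives-distinct (t ∷ ts) h (d ∷ ds) = AllPairsP.++⁺ (proj₁ (proj₂ (proj₂ (h t (here refl)))))
      (representatives-distinct ts (λ s s∈ → h s (there s∈)) ds)
      (All.tabulate λ {A} A∈ → All.tabulate λ {B} B∈ c →
        let s , s∈ , _ , tB = representative-type ts (λ s s∈ → h s (there s∈)) B B∈ in
        All.lookup d s∈ (types-agree {A = A} {B} (proj₂ (All.lookup (proj₁ (proj₂ (h t (here refl)))) A∈)) tB c))

    representatives-complete : ∀ ts (h : ClassCounts ts) x → GL n x → Any (HasType n x) ts → Any (Conj x) (representatives ts h)
    representatives-complete (t ∷ ts) h x gx (here tx) = AnyP.++⁺ˡ (proj₁ (proj₂ (proj₂ (proj₂ (h t (here refl))))) x (gx , tx))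
    representatives-complete (t ∷ ts) h x gx (there a) = AnyP.++⁺ʳ (proj₁ (h t (here refl))) (representatives-complete ts (λ s s∈ → h s (there s∈)) x gx a)

    -- The weight is constant on the `N t` representatives of one type, which is how the number of
    -- classes enters as a factor.
    ∑-representatives : ∀ (f g : Ty → ℕ) (z : Ty → ℕ) (w : Mat n → ℕ) ts (h : ClassCounts ts) →
      (∀ t → t ∈ ts → ∀ A → GL n A → HasType n A t → w A ≡ f t * (g t * z t)) →
      ∑ (representatives ts h) w ≡ foldr (λ t s → N t * f t * g t * z t + s) 0 ts
    ∑-representatives f g z w [] h e = refl
    ∑-representatives f g z w (t ∷ ts) h e = trans (∑-++ xs _ w) (cong₂ _+_
      (trans (∑-cong xs λ A A∈ → let gA , tA = All.lookup (proj₁ (proj₂ (h t (here refl)))) A∈ in e t (here refl) A gA tA)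
        (trans (∑-const xs _) (trans (cong (_* (f t * (g t * z t))) (proj₂ (proj₂ (proj₂ (proj₂ (h t (here refl)))))))
          (trans (sym (ℕP.*-assoc (N t) (f t) _)) (sym (ℕP.*-assoc (N t * f t) (g t) (z t)))))))
      (∑-representatives f g z w ts (λ s s∈ → h s (there s∈)) (λ s s∈ → e s (there s∈))))
      where xs = proj₁ (h t (here refl))

  class-intersection : ∀ {n ν k c} {A : Mat n} (h : HasSize (GLν n ν) k) → CountInClass n ν A c → (∑ (proj₁ h) λ x → ⟦ Conj? A x ⟧) ≡ c
  class-intersection {A = A} (xs , u , p , c , _) hc = size-unique
    (size-⇔ (λ x h → p x (proj₁ h) , proj₂ h) (λ x h → c x (proj₁ h) , proj₂ h) (size-∑ (Conj? A) u)) hc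

  double-coset-formula : ∀ {n la mu} (a : Ty → List ℕ → ℕ) →
    (∀ t A → GL n A → HasType n A t → CountInClass n la A (a t la)) →
    (∀ t A → GL n A → HasType n A t → CountInClass n mu A (a t mu)) →
    ∀ ts → AllPairs (λ s t → ¬ (s ↭ t)) ts → (∀ A → GL n A → Any (HasType n A) ts) →
    ∀ N → ClassCounts {n} N ts → ∀ {gla gmu D} →
    HasSize (GLν n la) gla → HasSize (GLν n mu) gmu → NumClasses (GL n) (DoubleCosetRel n la mu) D →
    gla * gmu * D ≡ foldr (λ t s → N t * a t la * a t mu * cprod q t + s) 0 ts
  double-coset-formula {n} {la} {mu} a hla hmu ts distinct cover N counts
    sla@(Hs , uH , pH , cH , refl) smu@(Ls , uL , pL , cL , refl) (rs , pR , dR , cR , refl) = total (size-⊤-filter (size-Mat n) GL?)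
    where
    reps : List (Mat n)
    reps = representatives N ts counts
    centralizer : ∀ A → ∃ λ w → HasSize (λ g → GL n g × g · A ≡ A · g) w
    centralizer A = size-⊤-filter (size-Mat n) (λ g → GL? g ×-dec (g · A ≟M A · g))
    total : (∃ λ k → HasSize (GL n) k) → _
    total (_ , Gs , uG , pG , cG , _) = trans
      (burnside {λs = la} {mu} uH pH cH uL pL cL uG pG cG pR dR cR)
      (trans (class-sum uG pG cG {Hs} {Ls} {reps} (λ x x∈ → proj₁ (pH x x∈)) (λ A → proj₁ (centralizer A)) (λ A _ → proj₂ (centralizer A))
          (representatives-distinct N ts counts distinct) (λ x gx → representatives-complete N ts counts x gx (cover x gx)))
        (∑-representatives N (λ t → a t la) (λ t → a t mu) (cprod q) (λ A → (∑ Hs λ x → ⟦ Conj? A x ⟧) * ((∑ Ls λ y → ⟦ Conj? A y ⟧) * proj₁ (centralizer A))) ts counts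
          λ t _ A gA tA → cong₂ _*_ (class-intersection {n} {la} {A = A} sla (hla t A gA tA))
            (cong₂ _*_ (class-intersection {n} {mu} {A = A} smu (hmu t A gA tA)) (size-unique (proj₂ (centralizer A)) (centralizer-order tA)))))

open import Data.Nat using (ℕ; _*_; _+_)
open import Data.List using (List; foldr)
open import Data.List.Membership.Propositional using (_∈_)
open import Data.List.Relation.Unary.AllPairs using (AllPairs)
open import Data.List.Relation.Unary.Any using (Any)
open import Data.List.Relation.Binary.Permutation.Propositional using (_↭_)
open import Data.Product using (∃; _×_; _,_)
open import Relation.Nullary using (¬_)
open import Relation.Binary.PropositionalEquality using (_≡_)

theorem4 : (q : ℕ) (F : FiniteField q) (n : ℕ) (la mu : List ℕ) →
    PartitionOf n la → PartitionOf n mu →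
    let open LinAlg F in
    ((t : Ty) (ν : List ℕ) → PartitionOf n ν →
    ∃ λ a → ∀ A → GL n A → HasType n A t → CountInClass n ν A a)
    ×
    ((a : Ty → List ℕ → ℕ) →
    (∀ t ν A → PartitionOf n ν → GL n A → HasType n A t → CountInClass n ν A (a t ν)) →
    (ts : List Ty) →
    AllPairs (λ s t → ¬ (s ↭ t)) ts →
    (∀ t → t ∈ ts → ∃ λ A → GL n A × HasType n A t) →
    (∀ A → GL n A → Any (HasType n A) ts) →
    (N : Ty → ℕ) →
    (∀ t → t ∈ ts → NumClasses (λ A → GL n A × HasType n A t) Conj (N t)) →
    (gla gmu D : ℕ) →
    HasSize (GLν n la) gla → HasSize (GLν n mu) gmu →
    NumClasses (GL n) (DoubleCosetRel n la mu) D →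
    gla * gmu * D ≡ foldr (λ t s → N t * a t la * a t mu * cprod q t + s) 0 ts)
theorem4 q F n la mu pla pmu =
  (λ t ν _ → TypeDec.type-count F t ν) ,
  λ a ha ts distinct _ cover N counts gla gmu D →
    Formula.double-coset-formula F a (λ t A → ha t la A pla) (λ t A → ha t mu A pmu) ts distinct cover N counts
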